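{- Let $k$ be a nonnegative integer and $a,b$ coprime integers with $0<b<2^k a$. Then for every nonnegative integer $L$, $G(L;b-1/a,b,2^k a)$ is a polynomial in $q$ with nonnegative coefficients.
   Context: For integers $L\ge0$ and parameters $\alpha,\beta,K$, $G(L;\alpha,\beta,K)=\sum_{j=-\infty}^{\infty}(-1)^j q^{Kj((\alpha+\beta)j+\alpha-\beta)/2}\begin{bmatrix}2L\\ L-Kj\end{bmatrix}_q$, where $\begin{bmatrix}n\\ m\end{bmatrix}_q=\frac{(q;q)_n}{(q;q)_m(q;q)_{n-m}}$ for $m\in\{0,\dots,n\}$ and $0$ otherwise, and $(q;q)_n=\prod_{i=1}^n(1-q^i)$. -}

module Defs where

open import Data.Nat as ℕ using (ℕ; zero; suc; _∸_; _≤ᵇ_; _%_; _≡ᵇ_)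
open import Data.Integer as ℤ using (ℤ; +_; -[1+_]; ∣_∣; _/_)
open import Data.Bool using (if_then_else_)

-- Formal power series in q with integer coefficients: n ↦ coefficient of q^n.
PS : Set
PS = ℕ → ℤ

Σ< : ℕ → (ℕ → ℤ) → ℤ
Σ< zero    f = + 0
Σ< (suc n) f = Σ< n f ℤ.+ f n

zeroPS : PS
zeroPS _ = + 0

onePS : PS
onePS zero    = + 1
onePS (suc _) = + 0

_⊛_ : PS → PS → PS
(f ⊛ g) n = Σ< (suc n) (λ i → f i ℤ.* g (n ∸ i))
infixl 7 _⊛_

oneMinusQ^ : ℕ → PS
oneMinusQ^ i n = (if n ≡ᵇ 0 then + 1 else + 0) ℤ.- (if n ≡ᵇ i then + 1 else + 0)

qPoch : ℕ → PS
qPoch zero    = onePS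
qPoch (suc n) = qPoch n ⊛ oneMinusQ^ (suc n)

-- 1/(1 - q^(i+1)) = Σ_t q^((i+1) t)  (the inverse power series)
geomInv : ℕ → PS
geomInv i n = if (n % suc i) ≡ᵇ 0 then + 1 else + 0

qPochInv : ℕ → PS
qPochInv zero    = onePS
qPochInv (suc n) = qPochInv n ⊛ geomInv n

qBinom : ℕ → ℤ → PS
qBinom n (+ m)     = if m ≤ᵇ n then qPoch n ⊛ qPochInv m ⊛ qPochInv (n ∸ m) else zeroPS
qBinom n -[1+ _ ]  = zeroPS

shift : ℕ → PS → PS
shift e P n = if e ≤ᵇ n then P (n ∸ e) else + 0

K : ℕ → ℤ → ℤ
K k a = + (2 ℕ.^ k) ℤ.* a

-- Exponent K j ((α+β) j + α - β)/2 with α = b - 1/a, β = b, K = 2^k a,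
-- which simplifies exactly to 2^k j ((2ab - 1) j - 1) / 2 (a nonnegative integer).
expo : ℕ → ℤ → ℤ → ℤ → ℤ
expo k a b j = (+ (2 ℕ.^ k) ℤ.* j ℤ.* ((+ 2 ℤ.* a ℤ.* b ℤ.- + 1) ℤ.* j ℤ.- + 1)) / + 2

-- G(L; b - 1/a, b, 2^k a).  Terms with |j| > L vanish (since K ≥ 1 the lower index
-- L - Kj leaves {0..2L}), so the sum over j ∈ ℤ is the sum over j ∈ [-L, L].
G : ℕ → ℤ → ℤ → ℕ → PS
G k a b L n = Σ< (suc (2 ℕ.* L)) λ i →
  let j = + i ℤ.- + L in
  (ℤ.- + 1) ℤ.^ ∣ j ∣ ℤ.* shift ∣ expo k a b j ∣ (qBinom (2 ℕ.* L) (+ L ℤ.- K k a ℤ.* j)) n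

{-# OPTIONS --safe #-}
module Submission where

-- Let P_{a,b}(L,M) = Σ_j (-1)^j q^{j((2ab-1)j-1)/2} [L+M+(a-b)j; L+aj] [L+M-(a-b)j; L-aj].
-- A form of the q-Saalschütz sum (the Burge transform) writes P_{a+b,b} as a positive
-- combination of the P_{a,b}, and P_{a,b}(L,M) = P_{b,a}(M,L), so Euclid's algorithm reduces
-- coprime a, b ≥ 1 to P_{1,1}(L,M) = q^{LM} [L+M; L], which follows from a telescoping sum.
-- The limit M → ∞ (q-Vandermonde) turns P_{a-b,b} into G(L; b-1/a, b, a) for 0 < b < a.
-- Two quadratic transformations, which expand [2L; L-2x]_q and q^{2x²} [2L; L-2x]_q positively
-- in the [2r; r-x]_{q²}, take (b, 2^k a) to (b, 2^{k+1} a) and to (b + 2^k a, 2^{k+1} a).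
-- The induction on k covers b = 2^k a as well: this needs only a = b = 1, k = 0, where G is
-- 1 for L = 0 and 0 otherwise, and it is what makes b = 2^{k-1} a, that is a = 1, accessible.

open import Defs
open import Algebra using (CommutativeRing; IsCommutativeRing)
open import Data.Bool as Bool using (true; false; if_then_else_)
open import Data.Empty using (⊥-elim)
open import Data.Integer as ℤ using (ℤ; +_; -[1+_])
import Data.Integer.Properties as ℤ
open import Data.Integer.Tactic.RingSolver using () renaming (solve-∀ to ℤ-solve-∀)
open import Data.Nat as ℕ using (ℕ; zero; suc; _∸_; _≡ᵇ_; _≤ᵇ_)
import Data.Nat.Coprimality as Coprimality
open import Data.Nat.Coprimality using (Coprime)
open import Data.Nat.Divisibility using (∣-refl; ∣m∣n⇒∣m+n; ∣n⇒∣m*n)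
import Data.Nat.DivMod as ℕ
import Data.Nat.Properties as ℕ
open import Data.Nat.Tactic.RingSolver using (solve-∀)
open import Data.Product using (Σ; ∃; _,_; _×_)
open import Data.Sum using (_⊎_; inj₁; inj₂)
open import Data.Unit using (tt)
open import Function using (_∘_)
open import Level using (Level; _⊔_; 0ℓ)
open import Relation.Binary.Definitions using (tri<; tri≈; tri>)
open import Relation.Binary.PropositionalEquality as ≡ using (_≡_; _≗_)

-- Since j((2ab-1)j-1)/2 = (ab-1)j² + j(j-1)/2 and the binomial factors are unchanged under j → -j,
-- every sum is a theta series whose weights depend on a and b only through p = ab-1. The three
-- transformations therefore have one shape: if Q^(u j²) times the binomial factor at j expands
-- positively in simpler factors, with coefficients free of j, then positivity for p gives
-- positivity for p + u. The Burge transform has u = b², the quadratic ones have u = 0 and u = 2^k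
-- a². The second parameter M is what gives Euclid's algorithm room to run: G has no symmetry
-- between a and b, while P has one, at the price of exchanging L and M. M is sent to infinity only
-- once P is known to be positive.

≤-gap : ∀ s n → n ℕ.< s ⊎ ∃ λ d → s ℕ.+ d ≡ n
≤-gap s n with ℕ.<-≤-connex n s
... | inj₁ n<s = inj₁ n<s
... | inj₂ s≤n = inj₂ (n ∸ s , ℕ.m+[n∸m]≡n s≤n)

coprime-reduce : ∀ {a b} m → Coprime a (b ℕ.+ m ℕ.* a) → Coprime a b
coprime-reduce m coprime (d∣a , d∣b) = coprime (d∣a , ∣m∣n⇒∣m+n d∣b (∣n⇒∣m*n m d∣a))

coprime-refl : ∀ {a} → Coprime a a → a ≡ 1
coprime-refl coprime = coprime (∣-refl , ∣-refl)

positive-product : ∀ {r n} a b → suc r ≡ a ℕ.* n → 1 ℕ.≤ a ℕ.* suc b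
positive-product (suc a) b e = ℕ.s≤s ℕ.z≤n

tri : ℕ → ℕ
tri zero    = 0
tri (suc n) = suc n ℕ.+ tri n

sum-suc : ∀ {s v n} → s ℕ.+ (v ℕ.+ v) ≡ n → s ℕ.+ (suc v ℕ.+ suc v) ≡ suc (suc n)
sum-suc {s} {v} ≡.refl = identity s v
    where
    identity : ∀ s v → s ℕ.+ (suc v ℕ.+ suc v) ≡ suc (suc (s ℕ.+ (v ℕ.+ v)))
    identity = solve-∀

module QSeries {c ℓ : Level} (R : CommutativeRing c ℓ) where

  open CommutativeRing R hiding (zero)
  open import Algebra.Properties.CommutativeSemigroup +-commutativeSemigroup using (interchange)
  open import Algebra.Properties.Group +-group using (∙-cancelˡ)
  open import Algebra.Properties.Ring ring using (-‿+-comm; -‿distribʳ-*; -0#≈0#)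
  open import Algebra.Properties.Semiring.Exp semiring using (_^_; ^-homo-*; ^-congʳ; ^-congˡ; ^-assocʳ)
  open import Algebra.Solver.Ring.NaturalCoefficients.Default commutativeSemiring
  open import Relation.Binary.Reasoning.Setoid setoid

  -- Finite sums

  -- conv n f = Σ_{s + t = n} f s t
  conv : ℕ → (ℕ → ℕ → Carrier) → Carrier
  conv zero    f = f 0 0
  conv (suc n) f = f 0 (suc n) + conv n (λ s t → f (suc s) t)

  -- alt n f = Σ_{j ≤ n} (-1)^j f j
  alt : ℕ → (ℕ → Carrier) → Carrier
  alt zero    f = f 0
  alt (suc n) f = f 0 - alt n (λ j → f (suc j))

  conv-cong : ∀ n {f g : ℕ → ℕ → Carrier} → (∀ s t → s ℕ.+ t ≡ n → f s t ≈ g s t) → conv n f ≈ conv n g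
  conv-cong zero    h = h 0 0 ≡.refl
  conv-cong (suc n) h = +-cong (h 0 (suc n) ≡.refl) (conv-cong n λ s t e → h (suc s) t (≡.cong suc e))

  conv-zero : ∀ n {f : ℕ → ℕ → Carrier} → (∀ s t → s ℕ.+ t ≡ n → f s t ≈ 0#) → conv n f ≈ 0#
  conv-zero zero    h = h 0 0 ≡.refl
  conv-zero (suc n) h = trans (+-cong (h 0 (suc n) ≡.refl) (conv-zero n λ s t e → h (suc s) t (≡.cong suc e))) (+-identityˡ 0#)

  conv-+ : ∀ n (f g : ℕ → ℕ → Carrier) → conv n (λ s t → f s t + g s t) ≈ conv n f + conv n g
  conv-+ zero    f g = refl
  conv-+ (suc n) f g = trans (+-congˡ (conv-+ n _ _)) (interchange _ _ _ _)

  conv-*ˡ : ∀ n k (f : ℕ → ℕ → Carrier) → conv n (λ s t → k * f s t) ≈ k * conv n f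
  conv-*ˡ zero    k f = refl
  conv-*ˡ (suc n) k f = trans (+-congˡ (conv-*ˡ n k _)) (sym (distribˡ k _ _))

  conv-last : ∀ n (f : ℕ → ℕ → Carrier) → conv (suc n) f ≈ conv n (λ s t → f s (suc t)) + f (suc n) 0
  conv-last zero    f = refl
  conv-last (suc n) f = trans (+-congˡ (conv-last n λ s t → f (suc s) t)) (sym (+-assoc _ _ _))

  conv-shift : ∀ n (u : ℕ → Carrier) → u 0 ≈ 0# → u (suc n) ≈ 0# → conv n (λ s _ → u (suc s)) ≈ conv n (λ s _ → u s)
  conv-shift n u u0 un = begin
    conv n (λ s _ → u (suc s))        ≈⟨ +-identityˡ _ ⟨
    0# + conv n (λ s _ → u (suc s))   ≈⟨ +-congʳ u0 ⟨
    conv (suc n) (λ s _ → u s)        ≈⟨ conv-last n (λ s _ → u s) ⟩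
    conv n (λ s _ → u s) + u (suc n)  ≈⟨ +-congˡ un ⟩
    conv n (λ s _ → u s) + 0#         ≈⟨ +-identityʳ _ ⟩
    conv n (λ s _ → u s)              ∎

  conv-dropˡ : ∀ b n (f : ℕ → ℕ → Carrier) → (∀ s t → s ℕ.< b → f s t ≈ 0#) →
    conv (b ℕ.+ n) f ≈ conv n (λ s t → f (b ℕ.+ s) t)
  conv-dropˡ zero    n f h = refl
  conv-dropˡ (suc b) n f h = begin
    f 0 (suc (b ℕ.+ n)) + conv (b ℕ.+ n) (λ s t → f (suc s) t)  ≈⟨ +-congʳ (h 0 _ (ℕ.s≤s ℕ.z≤n)) ⟩
    0# + conv (b ℕ.+ n) (λ s t → f (suc s) t)                   ≈⟨ +-identityˡ _ ⟩
    conv (b ℕ.+ n) (λ s t → f (suc s) t)                        ≈⟨ conv-dropˡ b n _ (λ s t s<b → h (suc s) t (ℕ.s≤s s<b)) ⟩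
    conv n (λ s t → f (suc (b ℕ.+ s)) t)                        ∎

  conv-dropʳ : ∀ a n (f : ℕ → ℕ → Carrier) → (∀ s t → t ℕ.< a → f s t ≈ 0#) →
    conv (a ℕ.+ n) f ≈ conv n (λ s t → f s (a ℕ.+ t))
  conv-dropʳ zero    n f h = refl
  conv-dropʳ (suc a) n f h = begin
    conv (suc (a ℕ.+ n)) f                                     ≈⟨ conv-last (a ℕ.+ n) f ⟩
    conv (a ℕ.+ n) (λ s t → f s (suc t)) + f (suc (a ℕ.+ n)) 0  ≈⟨ +-congˡ (h _ 0 (ℕ.s≤s ℕ.z≤n)) ⟩
    conv (a ℕ.+ n) (λ s t → f s (suc t)) + 0#                  ≈⟨ +-identityʳ _ ⟩
    conv (a ℕ.+ n) (λ s t → f s (suc t))                       ≈⟨ conv-dropʳ a n _ (λ s t t<a → h s (suc t) (ℕ.s≤s t<a)) ⟩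
    conv n (λ s t → f s (suc (a ℕ.+ t)))                       ∎

  alt-cong : ∀ n {f g : ℕ → Carrier} → (∀ j → f j ≈ g j) → alt n f ≈ alt n g
  alt-cong zero    h = h 0
  alt-cong (suc n) h = +-cong (h 0) (-‿cong (alt-cong n λ j → h (suc j)))

  alt-zero : ∀ n {f : ℕ → Carrier} → (∀ j → f j ≈ 0#) → alt n f ≈ 0#
  alt-zero zero    h = h 0
  alt-zero (suc n) h = trans (+-cong (h 0) (trans (-‿cong (alt-zero n λ j → h (suc j))) -0#≈0#)) (+-identityˡ 0#)

  alt-+ : ∀ n (f g : ℕ → Carrier) → alt n (λ j → f j + g j) ≈ alt n f + alt n g
  alt-+ zero    f g = refl
  alt-+ (suc n) f g = begin
    f 0 + g 0 - alt n (λ j → f (suc j) + g (suc j))                       ≈⟨ +-congˡ (-‿cong (alt-+ n _ _)) ⟩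
    f 0 + g 0 - (alt n (λ j → f (suc j)) + alt n (λ j → g (suc j)))       ≈⟨ +-congˡ (-‿+-comm _ _) ⟨
    f 0 + g 0 + (- alt n (λ j → f (suc j)) + - alt n (λ j → g (suc j)))   ≈⟨ interchange _ _ _ _ ⟩
    f 0 - alt n (λ j → f (suc j)) + (g 0 - alt n (λ j → g (suc j)))       ∎

  alt-*ˡ : ∀ n k (f : ℕ → Carrier) → alt n (λ j → k * f j) ≈ k * alt n f
  alt-*ˡ zero    k f = refl
  alt-*ˡ (suc n) k f = begin
    k * f 0 - alt n (λ j → k * f (suc j))      ≈⟨ +-congˡ (-‿cong (alt-*ˡ n k _)) ⟩
    k * f 0 - k * alt n (λ j → f (suc j))      ≈⟨ +-congˡ (-‿distribʳ-* _ _) ⟩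
    k * f 0 + k * - alt n (λ j → f (suc j))    ≈⟨ distribˡ k _ _ ⟨
    k * (f 0 - alt n (λ j → f (suc j)))        ∎

  alt-telescope : ∀ n (t : ℕ → Carrier) → t (suc n) ≈ 0# → alt n (λ j → t j + t (suc j)) ≈ t 0
  alt-telescope zero    t e = trans (+-congˡ e) (+-identityʳ _)
  alt-telescope (suc n) t e = begin
    t 0 + t 1 - alt n (λ j → t (suc j) + t (suc (suc j)))  ≈⟨ +-congˡ (-‿cong (alt-telescope n (λ j → t (suc j)) e)) ⟩
    t 0 + t 1 - t 1                                        ≈⟨ +-assoc _ _ _ ⟩
    t 0 + (t 1 - t 1)                                      ≈⟨ +-congˡ (-‿inverseʳ _) ⟩
    t 0 + 0#                                               ≈⟨ +-identityʳ _ ⟩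
    t 0                                                    ∎

  alt-conv : ∀ N n (f : ℕ → ℕ → ℕ → Carrier) → alt N (λ j → conv n (f j)) ≈ conv n (λ s t → alt N (λ j → f j s t))
  alt-conv N zero    f = refl
  alt-conv N (suc n) f = trans (alt-+ N _ _) (+-congˡ (alt-conv N n λ j s t → f j (suc s) t))

  conv-head : ∀ n (f : ℕ → ℕ → Carrier) → (∀ s t → f (suc s) t ≈ 0#) → conv n f ≈ f 0 n
  conv-head zero    f h = refl
  conv-head (suc n) f h = trans (+-congˡ (conv-zero n λ s t _ → h s t)) (+-identityʳ _)

  alt-head : ∀ n (f : ℕ → Carrier) → (∀ j → f (suc j) ≈ 0#) → alt n f ≈ f 0
  alt-head zero    f h = refl
  alt-head (suc n) f h = trans (+-congˡ (trans (-‿cong (alt-zero n h)) -0#≈0#)) (+-identityʳ _)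

  -- Q^(p j² + j(j-1)/2) + Q^(p j² + j(j+1)/2), the terms j and -j of a theta series taken together (1 for j = 0).
  weight : Carrier → ℕ → ℕ → Carrier
  weight Q p zero    = 1#
  weight Q p (suc j) = Q ^ (p ℕ.* (suc j ℕ.* suc j)) * (Q ^ tri j + Q ^ tri (suc j))

  -- Σ_{|j| ≤ N} (-1)^j Q^(p j² + j(j-1)/2) f|j|
  theta : Carrier → ℕ → ℕ → (ℕ → Carrier) → Carrier
  theta Q N p f = alt N (λ j → weight Q p j * f j)

  theta-cong : ∀ Q N p {f g} → (∀ j → f j ≈ g j) → theta Q N p f ≈ theta Q N p g
  theta-cong Q N p h = alt-cong N λ j → *-congˡ (h j)

  weight-+ : ∀ Q p u j → weight Q (p ℕ.+ u) j ≈ weight Q p j * Q ^ (u ℕ.* (j ℕ.* j))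
  weight-+ Q p u zero    rewrite ℕ.*-zeroʳ u = sym (*-identityˡ 1#)
  weight-+ Q p u (suc j) rewrite ℕ.*-distribʳ-+ (suc j ℕ.* suc j) p u = begin
    Q ^ (p ℕ.* n ℕ.+ u ℕ.* n) * S        ≈⟨ *-congʳ (^-homo-* Q (p ℕ.* n) (u ℕ.* n)) ⟩
    Q ^ (p ℕ.* n) * Q ^ (u ℕ.* n) * S    ≈⟨ solve 3 (λ x y s → x :* y :* s := x :* s :* y) refl _ _ S ⟩
    Q ^ (p ℕ.* n) * S * Q ^ (u ℕ.* n)    ∎
    where
    n = suc j ℕ.* suc j
    S = Q ^ tri j + Q ^ tri (suc j)

  theta-+ : ∀ Q N p u f → theta Q N (p ℕ.+ u) f ≈ theta Q N p (λ j → Q ^ (u ℕ.* (j ℕ.* j)) * f j)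
  theta-+ Q N p u f = alt-cong N λ j → trans (*-congʳ (weight-+ Q p u j)) (*-assoc _ _ _)

  theta-conv : ∀ Q N p n (φ : ℕ → ℕ → Carrier) (f : ℕ → ℕ → ℕ → Carrier) →
    theta Q N p (λ j → conv n (λ s t → φ s t * f s t j)) ≈ conv n (λ s t → φ s t * theta Q N p (f s t))
  theta-conv Q N p n φ f = begin
    alt N (λ j → weight Q p j * conv n (λ s t → φ s t * f s t j))
      ≈⟨ alt-cong N (λ j → trans (sym (conv-*ˡ n _ _)) (conv-cong n λ s t _ →
           solve 3 (λ w x y → w :* (x :* y) := x :* (w :* y)) refl (weight Q p j) (φ s t) (f s t j))) ⟩
    alt N (λ j → conv n (λ s t → φ s t * (weight Q p j * f s t j)))
      ≈⟨ alt-conv N n (λ j s t → φ s t * (weight Q p j * f s t j)) ⟩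
    conv n (λ s t → alt N (λ j → φ s t * (weight Q p j * f s t j)))
      ≈⟨ conv-cong n (λ s t _ → alt-*ˡ N _ _) ⟩
    conv n (λ s t → φ s t * theta Q N p (f s t)) ∎

  theta-congQ : ∀ {Q Q′} N p f → Q ≈ Q′ → theta Q N p f ≈ theta Q′ N p f
  theta-congQ N p f e = alt-cong N λ { zero → refl ; (suc j) → *-congʳ (*-cong (^-congˡ (p ℕ.* (suc j ℕ.* suc j)) e) (+-cong (^-congˡ (tri j) e) (^-congˡ (tri (suc j)) e))) }

  -- Cancelling 1 - q^(n+1) stands in for division by q-factorials. The condition passes from q to
  -- q², as the quadratic transformations require.
  Regular : Carrier → Set (c ⊔ ℓ)
  Regular q = ∀ n {x y} → (1# - q ^ suc n) * x ≈ (1# - q ^ suc n) * y → x ≈ y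

  -- q-binomial coefficients

  module QBinomial (q : Carrier) (regular : Regular q) where

    pow : ∀ a b {k} → a ℕ.+ b ≡ k → q ^ k ≈ q ^ a * q ^ b
    pow a b ≡.refl = ^-homo-* q a b

    pow* : ∀ a b {k} → a ℕ.+ b ≡ k → ∀ x → q ^ a * (q ^ b * x) ≈ q ^ k * x
    pow* a b e x = trans (sym (*-assoc _ _ _)) (*-congʳ (sym (pow a b e)))

    ν : ℕ → Carrier
    ν n = 1# - q ^ n

    ν-0 : ν 0 ≈ 0#
    ν-0 = -‿inverseʳ 1#

    -- The additive relations among the `ν` used below come from this one; it leaves identities in a
    -- commutative semiring with the `ν` as indeterminates.
    ν-+ : ∀ a b → ν (a ℕ.+ b) ≈ ν a + q ^ a * ν b
    ν-+ a b = begin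
      1# - q ^ (a ℕ.+ b)                                ≈⟨ +-congˡ (-‿cong (^-homo-* q a b)) ⟩
      1# - q ^ a * q ^ b                                ≈⟨ +-congʳ (+-identityʳ 1#) ⟨
      1# + 0# - q ^ a * q ^ b                           ≈⟨ +-congʳ (+-congˡ (-‿inverseˡ (q ^ a))) ⟨
      1# + (- (q ^ a) + q ^ a) - q ^ a * q ^ b          ≈⟨ solve 3 (λ m x y → con 1 :+ (m :+ x) :+ y := con 1 :+ m :+ (x :* con 1 :+ y)) refl (- (q ^ a)) (q ^ a) (- (q ^ a * q ^ b)) ⟩
      1# - q ^ a + (q ^ a * 1# - q ^ a * q ^ b)         ≈⟨ +-congˡ (+-congˡ (-‿distribʳ-* (q ^ a) (q ^ b))) ⟩
      1# - q ^ a + (q ^ a * 1# + q ^ a * - (q ^ b))     ≈⟨ +-congˡ (distribˡ (q ^ a) 1# (- (q ^ b))) ⟨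
      1# - q ^ a + q ^ a * (1# - q ^ b)                 ∎

    fact : ℕ → Carrier
    fact zero    = 1#
    fact (suc n) = fact n * ν (suc n)

    -- In place of division: identities between quotients of q-factorials are multiplied out with
    -- `gauss-fact`, and the factorials are cancelled here.
    fact-cancel : ∀ n {x y} → fact n * x ≈ fact n * y → x ≈ y
    fact-cancel zero    e = trans (sym (*-identityˡ _)) (trans e (*-identityˡ _))
    fact-cancel (suc n) e = regular n (fact-cancel n (trans (sym (*-assoc _ _ _)) (trans e (*-assoc _ _ _))))

    -- gauss a b is the q-binomial coefficient [a+b; a].
    gauss : ℕ → ℕ → Carrier
    gauss zero    b       = 1#
    gauss (suc a) zero    = 1#
    gauss (suc a) (suc b) = gauss a (suc b) + q ^ suc a * gauss (suc a) b

    gauss-0ʳ : ∀ a → gauss a 0 ≈ 1#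
    gauss-0ʳ zero    = refl
    gauss-0ʳ (suc a) = refl

    -- Both terms of Pascal's rule become multiples of (q;q)_(a+b+1), with the factors `ν (suc a)`
    -- and `q ^ suc a * ν (suc b)`; by `ν-+` these add up to the one missing factor.
    gauss-fact : ∀ a b → gauss a b * (fact a * fact b) ≈ fact (a ℕ.+ b)
    gauss-fact zero    b    = solve 1 (λ x → con 1 :* (con 1 :* x) := x) refl (fact b)
    gauss-fact (suc a) zero = begin
      1# * (fact (suc a) * 1#)  ≈⟨ solve 1 (λ x → con 1 :* (x :* con 1) := x) refl (fact (suc a)) ⟩
      fact (suc a)              ≡⟨ ≡.cong fact (ℕ.+-identityʳ (suc a)) ⟨
      fact (suc a ℕ.+ 0)        ∎
    gauss-fact (suc a) (suc b) = begin
      (g₁ + q ^ suc a * g₂) * (fact a * ν (suc a) * (fact b * ν (suc b)))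
        ≈⟨ solve 7 (λ g₁ Q g₂ A u B v → (g₁ :+ Q :* g₂) :* (A :* u :* (B :* v)) :=
                      (g₁ :* (A :* (B :* v))) :* u :+ Q :* (v :* (g₂ :* (A :* u :* B)))) refl
             g₁ (q ^ suc a) g₂ (fact a) (ν (suc a)) (fact b) (ν (suc b)) ⟩
      g₁ * (fact a * fact (suc b)) * ν (suc a) + q ^ suc a * (ν (suc b) * (g₂ * (fact (suc a) * fact b)))
        ≈⟨ +-cong (*-congʳ (trans (gauss-fact a (suc b)) (reflexive (≡.cong fact (ℕ.+-suc a b))))) (*-congˡ (*-congˡ (gauss-fact (suc a) b))) ⟩
      F * ν (suc a) + q ^ suc a * (ν (suc b) * F)
        ≈⟨ solve 4 (λ F u Q v → F :* u :+ Q :* (v :* F) := F :* (u :+ Q :* v)) refl F (ν (suc a)) (q ^ suc a) (ν (suc b)) ⟩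
      F * (ν (suc a) + q ^ suc a * ν (suc b))
        ≈⟨ *-congˡ (ν-+ (suc a) (suc b)) ⟨
      F * ν (suc a ℕ.+ suc b)
        ≡⟨ ≡.cong (λ n → fact n * ν (suc a ℕ.+ suc b)) (≡.sym (ℕ.+-suc a b)) ⟩
      fact (suc a ℕ.+ suc b) ∎
      where g₁ = gauss a (suc b)
            g₂ = gauss (suc a) b
            F  = fact (suc (a ℕ.+ b))

    gauss-comm : ∀ a b → gauss a b ≈ gauss b a
    gauss-comm a b = fact-cancel b (fact-cancel a (begin
      fact a * (fact b * gauss a b)  ≈⟨ solve 3 (λ A B g → A :* (B :* g) := g :* (A :* B)) refl (fact a) (fact b) (gauss a b) ⟩
      gauss a b * (fact a * fact b)  ≈⟨ gauss-fact a b ⟩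
      fact (a ℕ.+ b)                 ≡⟨ ≡.cong fact (ℕ.+-comm a b) ⟩
      fact (b ℕ.+ a)                 ≈⟨ gauss-fact b a ⟨
      gauss b a * (fact b * fact a)  ≈⟨ solve 3 (λ A B g → A :* (B :* g) := g :* (B :* A)) refl (fact a) (fact b) (gauss b a) ⟨
      fact a * (fact b * gauss b a)  ∎))

    gauss-pascalʳ : ∀ a b → gauss (suc a) (suc b) ≈ gauss (suc a) b + q ^ suc b * gauss a (suc b)
    gauss-pascalʳ a b = begin
      gauss (suc a) (suc b)                           ≈⟨ gauss-comm (suc a) (suc b) ⟩
      gauss b (suc a) + q ^ suc b * gauss (suc b) a   ≈⟨ +-cong (gauss-comm b (suc a)) (*-congˡ (gauss-comm (suc b) a)) ⟩
      gauss (suc a) b + q ^ suc b * gauss a (suc b)   ∎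

    ν-gaussˡ : ∀ a b → ν (suc a) * gauss (suc a) b ≈ ν (suc (a ℕ.+ b)) * gauss a b
    ν-gaussˡ a b = fact-cancel b (fact-cancel a (begin
      fact a * (fact b * (ν (suc a) * gauss (suc a) b))
        ≈⟨ solve 4 (λ A B u g → A :* (B :* (u :* g)) := g :* (A :* u :* B)) refl (fact a) (fact b) (ν (suc a)) (gauss (suc a) b) ⟩
      gauss (suc a) b * (fact (suc a) * fact b)
        ≈⟨ gauss-fact (suc a) b ⟩
      fact (a ℕ.+ b) * ν (suc (a ℕ.+ b))
        ≈⟨ *-congʳ (gauss-fact a b) ⟨
      gauss a b * (fact a * fact b) * ν (suc (a ℕ.+ b))
        ≈⟨ solve 4 (λ A B u g → A :* (B :* (u :* g)) := g :* (A :* B) :* u) refl (fact a) (fact b) (ν (suc (a ℕ.+ b))) (gauss a b) ⟨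
      fact a * (fact b * (ν (suc (a ℕ.+ b)) * gauss a b)) ∎))

    ν-gaussʳ : ∀ a b → ν (suc b) * gauss a (suc b) ≈ ν (suc (a ℕ.+ b)) * gauss a b
    ν-gaussʳ a b = begin
      ν (suc b) * gauss a (suc b)      ≈⟨ *-congˡ (gauss-comm a (suc b)) ⟩
      ν (suc b) * gauss (suc b) a      ≈⟨ ν-gaussˡ b a ⟩
      ν (suc (b ℕ.+ a)) * gauss b a    ≈⟨ *-cong (reflexive (≡.cong (λ n → ν (suc n)) (ℕ.+-comm b a))) (gauss-comm b a) ⟩
      ν (suc (a ℕ.+ b)) * gauss a b    ∎

    ν-gauss : ∀ a b → ν (suc a) * gauss (suc a) b ≈ ν (suc b) * gauss a (suc b)
    ν-gauss a b = trans (ν-gaussˡ a b) (sym (ν-gaussʳ a b))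

    -- Both sides are the q-multinomial coefficient [a+b+c; a, b, c].
    gauss-trinomial : ∀ a b c → gauss a (b ℕ.+ c) * gauss b c ≈ gauss a b * gauss (a ℕ.+ b) c
    gauss-trinomial a b c = fact-cancel c (fact-cancel b (fact-cancel a (begin
      fact a * (fact b * (fact c * (gauss a (b ℕ.+ c) * gauss b c)))
        ≈⟨ solve 5 (λ A B C g h → A :* (B :* (C :* (g :* h))) := g :* (A :* (h :* (B :* C)))) refl (fact a) (fact b) (fact c) (gauss a (b ℕ.+ c)) (gauss b c) ⟩
      gauss a (b ℕ.+ c) * (fact a * (gauss b c * (fact b * fact c)))
        ≈⟨ *-congˡ (*-congˡ (gauss-fact b c)) ⟩
      gauss a (b ℕ.+ c) * (fact a * fact (b ℕ.+ c))
        ≈⟨ gauss-fact a (b ℕ.+ c) ⟩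
      fact (a ℕ.+ (b ℕ.+ c))
        ≡⟨ ≡.cong fact (ℕ.+-assoc a b c) ⟨
      fact (a ℕ.+ b ℕ.+ c)
        ≈⟨ gauss-fact (a ℕ.+ b) c ⟨
      gauss (a ℕ.+ b) c * (fact (a ℕ.+ b) * fact c)
        ≈⟨ *-congˡ (*-congʳ (gauss-fact a b)) ⟨
      gauss (a ℕ.+ b) c * (gauss a b * (fact a * fact b) * fact c)
        ≈⟨ solve 5 (λ A B C g h → A :* (B :* (C :* (g :* h))) := h :* (g :* (A :* B) :* C)) refl (fact a) (fact b) (fact c) (gauss a b) (gauss (a ℕ.+ b) c) ⟨
      fact a * (fact b * (fact c * (gauss a b * gauss (a ℕ.+ b) c))) ∎)))

    -- γ X N s is [X+N-s; X], understood as 0 when s > N.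
    γ : ℕ → ℕ → ℕ → Carrier
    γ X N       zero    = gauss X N
    γ X zero    (suc s) = 0#
    γ X (suc N) (suc s) = γ X N s

    γ-+ : ∀ X s d → γ X (s ℕ.+ d) s ≡ gauss X d
    γ-+ X zero    d = ≡.refl
    γ-+ X (suc s) d = γ-+ X s d

    γ-< : ∀ X {N s} → N ℕ.< s → γ X N s ≡ 0#
    γ-< X {zero}  {suc s} _           = ≡.refl
    γ-< X {suc N} {suc s} (ℕ.s≤s N<s) = γ-< X N<s

    -- Extension by zero keeps both Pascal rules valid for every `s`: at `s = N` the term with
    -- `suc s` drops out, and beyond that everything is 0. Sums can then be split without case
    -- distinctions on their range.
    γ-pascalˡ : ∀ X N s → γ (suc X) N s ≈ γ X N s + q ^ suc X * γ (suc X) N (suc s)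
    γ-pascalˡ X zero zero = begin
      1#                        ≈⟨ gauss-0ʳ X ⟨
      gauss X 0                 ≈⟨ solve 2 (λ g Q → g := g :+ Q :* con 0) refl (gauss X 0) (q ^ suc X) ⟩
      gauss X 0 + q ^ suc X * 0# ∎
    γ-pascalˡ X (suc N) zero    = refl
    γ-pascalˡ X zero    (suc s) = solve 1 (λ Q → con 0 := con 0 :+ Q :* con 0) refl (q ^ suc X)
    γ-pascalˡ X (suc N) (suc s) = γ-pascalˡ X N s

    γ-pascalʳ : ∀ X N s → γ (suc X) N s ≈ γ (suc X) N (suc s) + q ^ (N ∸ s) * γ X N s
    γ-pascalʳ X zero zero = begin
      1#                     ≈⟨ gauss-0ʳ X ⟨
      gauss X 0              ≈⟨ solve 1 (λ g → g := con 0 :+ con 1 :* g) refl (gauss X 0) ⟩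
      0# + 1# * gauss X 0    ∎
    γ-pascalʳ X (suc N) zero    = gauss-pascalʳ X N
    γ-pascalʳ X zero    (suc s) = solve 0 (con 0 := con 0 :+ con 1 :* con 0) refl
    γ-pascalʳ X (suc N) (suc s) = γ-pascalʳ X N s

    -- For `s > N` the coefficient is 0 and any exponent will do; otherwise N = s + d, which makes
    -- the truncated subtractions in the exponents exact.
    γ-pow : ∀ X N s {e e′} → (∀ d → s ℕ.+ d ≡ N → e ≡ e′) → q ^ e * γ X N s ≈ q ^ e′ * γ X N s
    γ-pow X N s h with ≤-gap s N
    ... | inj₁ N<s rewrite γ-< X N<s = trans (zeroʳ _) (sym (zeroʳ _))
    ... | inj₂ (d , e) rewrite h d e = refl

    -- The Burge transform

    γ-≡ : ∀ {X X′ N} s d → X ≡ X′ → s ℕ.+ d ≡ N → γ X N s ≡ gauss X′ d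
    γ-≡ s d ≡.refl ≡.refl = γ-+ _ s d

    γ-shift : ∀ X b N s → γ X (b ℕ.+ N) (b ℕ.+ s) ≡ γ X N s
    γ-shift X zero    N s = ≡.refl
    γ-shift X (suc b) N s = γ-shift X b N s

    -- the second summand in Pascal's rule for [x+1; s]
    pascalTail : ℕ → ℕ → Carrier
    pascalTail x zero    = 0#
    pascalTail x (suc s) = q ^ (x ∸ s) * γ s x s

    γ-pascalTail : ∀ x s → γ s (suc x) s ≈ γ s x s + pascalTail x s
    γ-pascalTail x zero    = sym (+-identityʳ 1#)
    γ-pascalTail x (suc s) = γ-pascalʳ s x s

    private
      -- (s+1)(s+1+c) + (x-s) = (x+c+1) + s(s+c+1): after the shift s → s+1 the tail of Pascal's
      -- rule turns the exponent for c into the exponent for c+1, up to a power free of s.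
      absorb-power : ∀ x s c →
        q ^ (suc s ℕ.* (suc s ℕ.+ c)) * (q ^ (x ∸ s) * γ s x s) ≈ q ^ suc (x ℕ.+ c) * (q ^ (s ℕ.* (s ℕ.+ suc c)) * γ s x s)
      absorb-power x s c = begin
        q ^ E * (q ^ (x ∸ s) * γ s x s)                       ≈⟨ pow* E (x ∸ s) ≡.refl _ ⟩
        q ^ (E ℕ.+ (x ∸ s)) * γ s x s                         ≈⟨ γ-pow s x s exponents ⟩
        q ^ (suc (x ℕ.+ c) ℕ.+ s ℕ.* (s ℕ.+ suc c)) * γ s x s  ≈⟨ pow* (suc (x ℕ.+ c)) (s ℕ.* (s ℕ.+ suc c)) ≡.refl _ ⟨
        q ^ suc (x ℕ.+ c) * (q ^ (s ℕ.* (s ℕ.+ suc c)) * γ s x s) ∎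
        where
        E = suc s ℕ.* (suc s ℕ.+ c)
        identity : ∀ s d c → suc s ℕ.* (suc s ℕ.+ c) ℕ.+ d ≡ suc (s ℕ.+ d ℕ.+ c) ℕ.+ s ℕ.* (s ℕ.+ suc c)
        identity = solve-∀
        exponents : ∀ d → s ℕ.+ d ≡ x → E ℕ.+ (x ∸ s) ≡ suc (x ℕ.+ c) ℕ.+ s ℕ.* (s ℕ.+ suc c)
        exponents d ≡.refl rewrite ℕ.m+n∸m≡n s d = identity s d c

      absorb-power′ : ∀ x s c l X →
        q ^ (s ℕ.* (s ℕ.+ c)) * (q ^ suc (x ℕ.+ c ℕ.+ l) * γ X l s) ≈
        q ^ suc (x ℕ.+ c) * (q ^ (s ℕ.* (s ℕ.+ suc c)) * (q ^ (l ∸ s) * γ X l s))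
      absorb-power′ x s c l X = begin
        q ^ (s ℕ.* (s ℕ.+ c)) * (q ^ suc (x ℕ.+ c ℕ.+ l) * γ X l s)
          ≈⟨ pow* (s ℕ.* (s ℕ.+ c)) (suc (x ℕ.+ c ℕ.+ l)) ≡.refl _ ⟩
        q ^ (s ℕ.* (s ℕ.+ c) ℕ.+ suc (x ℕ.+ c ℕ.+ l)) * γ X l s
          ≈⟨ γ-pow X l s exponents ⟩
        q ^ (suc (x ℕ.+ c) ℕ.+ (F ℕ.+ (l ∸ s))) * γ X l s
          ≈⟨ pow* (suc (x ℕ.+ c)) (F ℕ.+ (l ∸ s)) ≡.refl _ ⟨
        q ^ suc (x ℕ.+ c) * (q ^ (F ℕ.+ (l ∸ s)) * γ X l s)
          ≈⟨ *-congˡ (pow* F (l ∸ s) ≡.refl _) ⟨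
        q ^ suc (x ℕ.+ c) * (q ^ F * (q ^ (l ∸ s) * γ X l s)) ∎
        where
        F = s ℕ.* (s ℕ.+ suc c)
        identity : ∀ x s d c → s ℕ.* (s ℕ.+ c) ℕ.+ suc (x ℕ.+ c ℕ.+ (s ℕ.+ d)) ≡ suc (x ℕ.+ c) ℕ.+ (s ℕ.* (s ℕ.+ suc c) ℕ.+ d)
        identity = solve-∀
        exponents : ∀ d → s ℕ.+ d ≡ l → s ℕ.* (s ℕ.+ c) ℕ.+ suc (x ℕ.+ c ℕ.+ l) ≡ suc (x ℕ.+ c) ℕ.+ (F ℕ.+ (l ∸ s))
        exponents d ≡.refl rewrite ℕ.m+n∸m≡n s d = identity x s d c

    -- Pascal's rule for [x+1; s] leaves the sum for x and, after s → s+1, a power of q times the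
    -- sum for x, c+1, l-1; the two values recombine by Pascal's rule. In the usual notation this is
    -- Σ q^(s(s+c)) [x; s] [l+c; l-s] = [x+l+c; l].
    q-vandermonde : ∀ x c l →
      conv l (λ s _ → q ^ (s ℕ.* (s ℕ.+ c)) * (γ s x s * γ (c ℕ.+ s) l s)) ≈ gauss l (x ℕ.+ c)
    q-vandermonde zero c l = begin
      conv l _                    ≈⟨ conv-head l _ (λ s _ → solve 2 (λ Q y → Q :* (con 0 :* y) := con 0) refl (q ^ (suc s ℕ.* (suc s ℕ.+ c))) _) ⟩
      1# * (1# * gauss (c ℕ.+ 0) l)  ≈⟨ solve 1 (λ g → con 1 :* (con 1 :* g) := g) refl _ ⟩
      gauss (c ℕ.+ 0) l           ≡⟨ ≡.cong (λ c → gauss c l) (ℕ.+-identityʳ c) ⟩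
      gauss c l                   ≈⟨ gauss-comm c l ⟩
      gauss l c                   ∎
    q-vandermonde (suc x) c zero = trans (*-congˡ (*-congˡ (gauss-0ʳ (c ℕ.+ 0)))) (solve 0 (con 1 :* (con 1 :* con 1) := con 1) refl)
    q-vandermonde (suc x) c (suc l) = begin
      conv (suc l) (λ s _ → Q s * (γ s (suc x) s * y s))
        ≈⟨ conv-cong (suc l) (λ s _ _ → trans (*-congˡ (*-congʳ (γ-pascalTail x s)))
             (solve 4 (λ Q b d y → Q :* ((b :+ d) :* y) := Q :* (b :* y) :+ Q :* (d :* y)) refl (Q s) (γ s x s) (pascalTail x s) (y s))) ⟩
      conv (suc l) (λ s _ → Q s * (γ s x s * y s) + u s)
        ≈⟨ conv-+ (suc l) (λ s _ → Q s * (γ s x s * y s)) (λ s _ → u s) ⟩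
      conv (suc l) (λ s _ → Q s * (γ s x s * y s)) + (u 0 + conv l (λ s _ → u (suc s)))
        ≈⟨ +-cong (q-vandermonde x c (suc l)) (+-cong (solve 2 (λ Q y → Q :* (con 0 :* y) := con 0) refl _ _) (conv-cong l λ s _ _ → tail s)) ⟩
      gauss (suc l) (x ℕ.+ c) + (0# + conv l (λ s _ → q ^ suc (x ℕ.+ c) * (q ^ (s ℕ.* (s ℕ.+ suc c)) * (γ s x s * γ (suc c ℕ.+ s) l s))))
        ≈⟨ +-congˡ (trans (+-identityˡ _) (trans (conv-*ˡ l _ _) (*-congˡ (q-vandermonde x (suc c) l)))) ⟩
      gauss (suc l) (x ℕ.+ c) + q ^ suc (x ℕ.+ c) * gauss l (x ℕ.+ suc c)
        ≡⟨ ≡.cong (λ k → gauss (suc l) (x ℕ.+ c) + q ^ suc (x ℕ.+ c) * gauss l k) (ℕ.+-suc x c) ⟩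
      gauss (suc l) (x ℕ.+ c) + q ^ suc (x ℕ.+ c) * gauss l (suc (x ℕ.+ c))
        ≈⟨ gauss-pascalʳ l (x ℕ.+ c) ⟨
      gauss (suc l) (suc (x ℕ.+ c)) ∎
      where
      Q : ℕ → Carrier
      Q s = q ^ (s ℕ.* (s ℕ.+ c))
      y : ℕ → Carrier
      y s = γ (c ℕ.+ s) (suc l) s
      u : ℕ → Carrier
      u s = Q s * (pascalTail x s * y s)
      tail : ∀ s → u (suc s) ≈ q ^ suc (x ℕ.+ c) * (q ^ (s ℕ.* (s ℕ.+ suc c)) * (γ s x s * γ (suc c ℕ.+ s) l s))
      tail s rewrite ℕ.+-suc c s = begin
        Q (suc s) * (pascalTail x (suc s) * z)    ≈⟨ *-assoc _ _ _ ⟨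
        Q (suc s) * pascalTail x (suc s) * z      ≈⟨ *-congʳ (absorb-power x s c) ⟩
        A * (C * γ s x s) * z                     ≈⟨ solve 4 (λ A C b z → A :* (C :* b) :* z := A :* (C :* (b :* z))) refl A C (γ s x s) z ⟩
        A * (C * (γ s x s * z))                   ∎
        where
        z = γ (suc (c ℕ.+ s)) l s
        A = q ^ suc (x ℕ.+ c)
        C = q ^ (s ℕ.* (s ℕ.+ suc c))

    -- The induction on x uses Pascal's rule in each of the three factors of the summand.
    q-saalschütz : ∀ x N c l →
      conv l (λ s _ → q ^ (s ℕ.* (s ℕ.+ c)) * (γ (x ℕ.+ c ℕ.+ l) N s * γ s x s * γ (c ℕ.+ s) l s)) ≈
      gauss N (x ℕ.+ c) * gauss (N ℕ.+ c) l
    q-saalschütz zero N c l = begin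
      conv l _                                        ≈⟨ conv-head l _ (λ s _ → solve 3 (λ Q g y → Q :* (g :* con 0 :* y) := con 0) refl (q ^ (suc s ℕ.* (suc s ℕ.+ c))) _ _) ⟩
      1# * (gauss (c ℕ.+ l) N * 1# * gauss (c ℕ.+ 0) l)  ≈⟨ solve 2 (λ g h → con 1 :* (g :* con 1 :* h) := g :* h) refl _ _ ⟩
      gauss (c ℕ.+ l) N * gauss (c ℕ.+ 0) l              ≈⟨ *-cong (gauss-comm (c ℕ.+ l) N) (reflexive (≡.cong (λ c → gauss c l) (ℕ.+-identityʳ c))) ⟩
      gauss N (c ℕ.+ l) * gauss c l                    ≈⟨ gauss-trinomial N c l ⟩
      gauss N c * gauss (N ℕ.+ c) l                    ∎
    q-saalschütz (suc x) zero c l = begin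
      conv l _                                        ≈⟨ conv-head l _ (λ s _ → solve 3 (λ Q b y → Q :* (con 0 :* b :* y) := con 0) refl (q ^ (suc s ℕ.* (suc s ℕ.+ c))) _ _) ⟩
      1# * (1# * 1# * gauss (c ℕ.+ 0) l)               ≈⟨ solve 1 (λ h → con 1 :* (con 1 :* con 1 :* h) := con 1 :* h) refl _ ⟩
      1# * gauss (c ℕ.+ 0) l                          ≡⟨ ≡.cong (λ c → 1# * gauss c l) (ℕ.+-identityʳ c) ⟩
      1# * gauss c l                                  ∎
    q-saalschütz (suc x) (suc N) c l = begin
      conv l (λ s _ → Q s * (g s * γ s (suc x) s * y s))
        ≈⟨ conv-cong l (λ s _ _ → expand s) ⟩
      conv l (λ s _ → Q s * (γ X (suc N) s * γ s x s * y s) + mid s + u s)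
        ≈⟨ trans (conv-+ l _ _) (+-congʳ (conv-+ l _ _)) ⟩
      conv l (λ s _ → Q s * (γ X (suc N) s * γ s x s * y s)) + conv l (λ s _ → mid s) + conv l (λ s _ → u s)
        ≈⟨ +-congˡ (conv-shift l u (solve 3 (λ Q g y → Q :* (g :* con 0 :* y) := con 0) refl _ _ _) u-last) ⟨
      conv l (λ s _ → Q s * (γ X (suc N) s * γ s x s * y s)) + conv l (λ s _ → mid s) + conv l (λ s _ → u (suc s))
        ≈⟨ trans (+-assoc _ _ _) (+-cong (q-saalschütz x (suc N) c l) (trans (sym (conv-+ l _ _)) (conv-cong l λ s _ _ → tail s))) ⟩
      gauss (suc N) (x ℕ.+ c) * gauss (suc N ℕ.+ c) l +
      conv l (λ s _ → A * (q ^ (s ℕ.* (s ℕ.+ suc c)) * (γ (x ℕ.+ suc c ℕ.+ l) N s * γ s x s * γ (suc c ℕ.+ s) l s)))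
        ≈⟨ +-congˡ (trans (conv-*ˡ l _ _) (*-congˡ (q-saalschütz x N (suc c) l))) ⟩
      gauss (suc N) (x ℕ.+ c) * gauss (suc N ℕ.+ c) l + A * (gauss N (x ℕ.+ suc c) * gauss (N ℕ.+ suc c) l)
        ≡⟨ ≡.cong₂ (λ j k → gauss (suc N) (x ℕ.+ c) * gauss (suc N ℕ.+ c) l + A * (gauss N j * gauss k l)) (ℕ.+-suc x c) (ℕ.+-suc N c) ⟩
      gauss (suc N) (x ℕ.+ c) * gauss (suc N ℕ.+ c) l + A * (gauss N (suc (x ℕ.+ c)) * gauss (suc N ℕ.+ c) l)
        ≈⟨ solve 4 (λ a A b c → a :* c :+ A :* (b :* c) := (a :+ A :* b) :* c) refl (gauss (suc N) (x ℕ.+ c)) A (gauss N (suc (x ℕ.+ c))) (gauss (suc N ℕ.+ c) l) ⟩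
      (gauss (suc N) (x ℕ.+ c) + A * gauss N (suc (x ℕ.+ c))) * gauss (suc N ℕ.+ c) l
        ≈⟨ *-congʳ (gauss-pascalʳ N (x ℕ.+ c)) ⟨
      gauss (suc N) (suc (x ℕ.+ c)) * gauss (suc N ℕ.+ c) l ∎
      where
      X = x ℕ.+ c ℕ.+ l
      A = q ^ suc (x ℕ.+ c)
      Q : ℕ → Carrier
      Q s = q ^ (s ℕ.* (s ℕ.+ c))
      g : ℕ → Carrier
      g s = γ (suc X) (suc N) s
      y : ℕ → Carrier
      y s = γ (c ℕ.+ s) l s
      mid : ℕ → Carrier
      mid s = Q s * (q ^ suc X * γ (suc X) N s * γ s x s * y s)
      u : ℕ → Carrier
      u s = Q s * (g s * pascalTail x s * y s)
      u-last : u (suc l) ≈ 0#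
      u-last rewrite γ-< (c ℕ.+ suc l) (ℕ.n<1+n l) = solve 2 (λ Q g → Q :* (g :* con 0) := con 0) refl _ _
      expand : ∀ s → Q s * (g s * γ s (suc x) s * y s) ≈ Q s * (γ X (suc N) s * γ s x s * y s) + mid s + u s
      expand s = begin
        Q s * (g s * γ s (suc x) s * y s)
          ≈⟨ *-congˡ (*-congʳ (*-congˡ (γ-pascalTail x s))) ⟩
        Q s * (g s * (γ s x s + pascalTail x s) * y s)
          ≈⟨ solve 5 (λ Q g b d y → Q :* (g :* (b :+ d) :* y) := Q :* (g :* b :* y) :+ Q :* (g :* d :* y)) refl (Q s) (g s) (γ s x s) (pascalTail x s) (y s) ⟩
        Q s * (g s * γ s x s * y s) + u s
          ≈⟨ +-congʳ (*-congˡ (*-congʳ (*-congʳ (γ-pascalˡ X (suc N) s)))) ⟩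
        Q s * ((γ X (suc N) s + q ^ suc X * γ (suc X) N s) * γ s x s * y s) + u s
          ≈⟨ +-congʳ (solve 6 (λ Q h P k b y → Q :* ((h :+ P :* k) :* b :* y) := Q :* (h :* b :* y) :+ Q :* (P :* k :* b :* y)) refl
               (Q s) (γ X (suc N) s) (q ^ suc X) (γ (suc X) N s) (γ s x s) (y s)) ⟩
        Q s * (γ X (suc N) s * γ s x s * y s) + mid s + u s ∎
      -- Both terms carry the power q^(x+c+1 + s(s+c+1)). What remains, `ζ` and q^(l-s) times `y s`,
      -- is Pascal's rule for the third factor with c+1 in place of c.
      tail : ∀ s → mid s + u (suc s) ≈
        A * (q ^ (s ℕ.* (s ℕ.+ suc c)) * (γ (x ℕ.+ suc c ℕ.+ l) N s * γ s x s * γ (suc c ℕ.+ s) l s))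
      tail s rewrite ℕ.+-suc c s | ℕ.+-suc x c = begin
        Q s * (q ^ suc X * k * b * y s) + Q (suc s) * (k * (q ^ (x ∸ s) * b) * ζ)
          ≈⟨ solve 8 (λ Q P k b y R W ζ → Q :* (P :* k :* b :* y) :+ R :* (k :* (W :* b) :* ζ) :=
                        Q :* (P :* y) :* (k :* b) :+ R :* (W :* b) :* (k :* ζ)) refl
               (Q s) (q ^ suc X) k b (y s) (Q (suc s)) (q ^ (x ∸ s)) ζ ⟩
        Q s * (q ^ suc X * y s) * (k * b) + Q (suc s) * (q ^ (x ∸ s) * b) * (k * ζ)
          ≈⟨ +-cong (*-congʳ (absorb-power′ x s c l (c ℕ.+ s))) (*-congʳ (absorb-power x s c)) ⟩
        A * (C * (q ^ (l ∸ s) * y s)) * (k * b) + A * (C * b) * (k * ζ)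
          ≈⟨ solve 7 (λ A C W y k b ζ → A :* (C :* (W :* y)) :* (k :* b) :+ A :* (C :* b) :* (k :* ζ) :=
                        A :* (C :* (k :* b :* (ζ :+ W :* y)))) refl
               A C (q ^ (l ∸ s)) (y s) k b ζ ⟩
        A * (C * (k * b * (ζ + q ^ (l ∸ s) * y s)))
          ≈⟨ *-congˡ (*-congˡ (*-congˡ (γ-pascalʳ (c ℕ.+ s) l s))) ⟨
        A * (C * (k * b * γ (suc (c ℕ.+ s)) l s)) ∎
        where
        C = q ^ (s ℕ.* (s ℕ.+ suc c))
        k = γ (suc X) N s
        b = γ s x s
        ζ = γ (suc (c ℕ.+ s)) l (suc s)

    -- B L M a b = [L+M+a-b; L+a] [L+M-a+b; L-a]
    B : ℕ → ℕ → ℕ → ℕ → Carrier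
    B L M a b = γ (L ℕ.+ a) M b * γ (M ℕ.+ b) L a

    B-swap : ∀ L M a b → B L M a b ≈ B M L b a
    B-swap L M a b = *-comm _ _

    B-0ˡ : ∀ {L} M {a} b → L ℕ.< a → B L M a b ≈ 0#
    B-0ˡ {L} M {a} b L<a rewrite γ-< (M ℕ.+ b) L<a = zeroʳ _

    B-0ʳ : ∀ L {M} a {b} → M ℕ.< b → B L M a b ≈ 0#
    B-0ʳ L {M} a {b} M<b rewrite γ-< (L ℕ.+ a) M<b = zeroˡ _

    -- `B t i a b` is 0 unless a ≤ t and b ≤ i, so only l+1 terms of the sum survive, and in these
    -- both factors are genuine q-binomial coefficients.
    conv-B : ∀ a b l (φ : ℕ → Carrier) →
      conv (b ℕ.+ (a ℕ.+ l)) (λ i t → φ i * B t i a b) ≈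
      conv l (λ s t → φ (b ℕ.+ s) * (gauss (a ℕ.+ t ℕ.+ a) s * gauss (b ℕ.+ s ℕ.+ b) t))
    conv-B a b l φ = begin
      conv (b ℕ.+ (a ℕ.+ l)) (λ i t → φ i * B t i a b)
        ≈⟨ conv-dropˡ b (a ℕ.+ l) _ (λ i t i<b → trans (*-congˡ (B-0ʳ t a i<b)) (zeroʳ _)) ⟩
      conv (a ℕ.+ l) (λ s t → φ (b ℕ.+ s) * B t (b ℕ.+ s) a b)
        ≈⟨ conv-dropʳ a l _ (λ i t t<a → trans (*-congˡ (B-0ˡ _ b t<a)) (zeroʳ _)) ⟩
      conv l (λ s t → φ (b ℕ.+ s) * B (a ℕ.+ t) (b ℕ.+ s) a b)
        ≈⟨ conv-cong l (λ s t _ → *-congˡ (*-cong (reflexive (γ-+ _ b s)) (reflexive (γ-+ _ a t)))) ⟩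
      conv l (λ s t → φ (b ℕ.+ s) * (gauss (a ℕ.+ t ℕ.+ a) s * gauss (b ℕ.+ s ℕ.+ b) t)) ∎

    conv-B-0 : ∀ L a b (φ : ℕ → Carrier) → L ℕ.< b ℕ.+ a → conv L (λ i t → φ i * B t i a b) ≈ 0#
    conv-B-0 L a b φ L<b+a = conv-zero L λ i t e → trans (*-congˡ (vanish i t e)) (zeroʳ _)
      where
      vanish : ∀ i t → i ℕ.+ t ≡ L → B t i a b ≈ 0#
      vanish i t e with ℕ.<-≤-connex i b | ℕ.<-≤-connex t a
      ... | inj₁ i<b | _ = B-0ʳ t a i<b
      ... | inj₂ _   | inj₁ t<a = B-0ˡ i b t<a
      ... | inj₂ b≤i | inj₂ a≤t = ⊥-elim (ℕ.<-irrefl (≡.sym e) (ℕ.<-≤-trans L<b+a (ℕ.+-mono-≤ b≤i a≤t)))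

    private
      -- Brings a surviving term to the q-Saalschütz form with x = 2a+l and c = 2b; the exponent
      -- fits because (b+s)² = b² + s(s+2b). `ψ` stands for the factor containing M, which becomes 1
      -- in the limit M → ∞.
      summand : ∀ a b l s t → s ℕ.+ t ≡ l → ∀ (ψ : Carrier) →
        q ^ ((b ℕ.+ s) ℕ.* (b ℕ.+ s)) * (ψ * (gauss (a ℕ.+ t ℕ.+ a) s * gauss (b ℕ.+ s ℕ.+ b) t)) ≈
        q ^ (b ℕ.* b) * (q ^ (s ℕ.* (s ℕ.+ (b ℕ.+ b))) * (ψ * γ s (a ℕ.+ a ℕ.+ l) s * γ (b ℕ.+ b ℕ.+ s) l s))
      summand a b l s t ≡.refl ψ = begin
        q ^ ((b ℕ.+ s) ℕ.* (b ℕ.+ s)) * (ψ * (gauss (a ℕ.+ t ℕ.+ a) s * gauss (b ℕ.+ s ℕ.+ b) t))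
          ≈⟨ *-cong (pow (b ℕ.* b) (s ℕ.* (s ℕ.+ (b ℕ.+ b))) (square b s))
               (*-congˡ (*-cong (trans (gauss-comm _ s) (reflexive (≡.sym (γ-≡ {N = a ℕ.+ a ℕ.+ (s ℕ.+ t)} s (a ℕ.+ t ℕ.+ a) ≡.refl (top a s t)))))
                                (reflexive (≡.sym (γ-≡ s t (bottom b s) ≡.refl))))) ⟩
        q ^ (b ℕ.* b) * q ^ (s ℕ.* (s ℕ.+ (b ℕ.+ b))) * (ψ * (γ s (a ℕ.+ a ℕ.+ (s ℕ.+ t)) s * γ (b ℕ.+ b ℕ.+ s) (s ℕ.+ t) s))
          ≈⟨ solve 5 (λ B S p x y → B :* S :* (p :* (x :* y)) := B :* (S :* (p :* x :* y))) refl _ _ ψ _ _ ⟩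
        q ^ (b ℕ.* b) * (q ^ (s ℕ.* (s ℕ.+ (b ℕ.+ b))) * (ψ * γ s (a ℕ.+ a ℕ.+ (s ℕ.+ t)) s * γ (b ℕ.+ b ℕ.+ s) (s ℕ.+ t) s)) ∎
        where
        square : ∀ b s → b ℕ.* b ℕ.+ s ℕ.* (s ℕ.+ (b ℕ.+ b)) ≡ (b ℕ.+ s) ℕ.* (b ℕ.+ s)
        square = solve-∀
        top : ∀ a s t → s ℕ.+ (a ℕ.+ t ℕ.+ a) ≡ a ℕ.+ a ℕ.+ (s ℕ.+ t)
        top = solve-∀
        bottom : ∀ b s → b ℕ.+ b ℕ.+ s ≡ b ℕ.+ s ℕ.+ b
        bottom = solve-∀

    -- If L < a+b or M < b, both sides are 0. Otherwise L = a+b+l and M = b+m, and after removal of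
    -- the vanishing terms this is q-Saalschütz with x = 2a+l, N = m, c = 2b.
    burge : ∀ L M a b →
      conv L (λ i t → q ^ (i ℕ.* i) * γ (L ℕ.+ L) M i * B t i a b) ≈ q ^ (b ℕ.* b) * B L M (a ℕ.+ b) b
    burge L M a b with ≤-gap (b ℕ.+ a) L
    ... | inj₁ L<b+a = begin
      conv L _                             ≈⟨ conv-B-0 L a b _ L<b+a ⟩
      0#                                   ≈⟨ zeroʳ _ ⟨
      q ^ (b ℕ.* b) * 0#                   ≈⟨ *-congˡ (B-0ˡ M b (≡.subst (L ℕ.<_) (ℕ.+-comm b a) L<b+a)) ⟨
      q ^ (b ℕ.* b) * B L M (a ℕ.+ b) b    ∎
    ... | inj₂ (l , ≡.refl) rewrite ℕ.+-assoc b a l with ≤-gap b M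
    ...   | inj₁ M<b = begin
      conv (b ℕ.+ (a ℕ.+ l)) _             ≈⟨ conv-B a b l (λ i → q ^ (i ℕ.* i) * γ (L′ ℕ.+ L′) M i) ⟩
      conv l _                             ≈⟨ conv-zero l (λ s t _ → trans (*-congʳ (*-congˡ (reflexive (γ-< (L′ ℕ.+ L′) (ℕ.<-≤-trans M<b (ℕ.m≤m+n b s))))))
                                                (solve 2 (λ Q g → Q :* con 0 :* g := con 0) refl _ _)) ⟩
      0#                                   ≈⟨ zeroʳ _ ⟨
      q ^ (b ℕ.* b) * 0#                   ≈⟨ *-congˡ (B-0ʳ L′ (a ℕ.+ b) M<b) ⟨
      q ^ (b ℕ.* b) * B L′ M (a ℕ.+ b) b    ∎
      where L′ = b ℕ.+ (a ℕ.+ l)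
    ...   | inj₂ (m , ≡.refl) = begin
      conv L′ _
        ≈⟨ conv-B a b l (λ i → q ^ (i ℕ.* i) * γ (L′ ℕ.+ L′) (b ℕ.+ m) i) ⟩
      conv l (λ s t → q ^ ((b ℕ.+ s) ℕ.* (b ℕ.+ s)) * γ (L′ ℕ.+ L′) (b ℕ.+ m) (b ℕ.+ s) * (gauss (a ℕ.+ t ℕ.+ a) s * gauss (b ℕ.+ s ℕ.+ b) t))
        ≈⟨ conv-cong l (λ s t e → trans (*-assoc _ _ _) (trans (*-congˡ (*-congʳ (reflexive
             (≡.trans (γ-shift (L′ ℕ.+ L′) b m s) (≡.cong (λ X → γ X m s) (double a b l)))))) (summand a b l s t e _))) ⟩
      conv l (λ s _ → q ^ (b ℕ.* b) * (q ^ (s ℕ.* (s ℕ.+ c′)) * (γ (x ℕ.+ c′ ℕ.+ l) m s * γ s x s * γ (c′ ℕ.+ s) l s)))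
        ≈⟨ trans (conv-*ˡ l _ _) (*-congˡ (q-saalschütz x m c′ l)) ⟩
      q ^ (b ℕ.* b) * (gauss m (x ℕ.+ c′) * gauss (m ℕ.+ c′) l)
        ≈⟨ *-congˡ (*-cong (trans (gauss-comm m _) (reflexive (≡.sym (γ-≡ b m (first a b l) ≡.refl))))
                           (reflexive (≡.sym (γ-≡ {N = L′} (a ℕ.+ b) l (second b m) (third a b l))))) ⟩
      q ^ (b ℕ.* b) * B L′ (b ℕ.+ m) (a ℕ.+ b) b ∎
      where
      L′ = b ℕ.+ (a ℕ.+ l)
      x = a ℕ.+ a ℕ.+ l
      c′ = b ℕ.+ b
      double : ∀ a b l → b ℕ.+ (a ℕ.+ l) ℕ.+ (b ℕ.+ (a ℕ.+ l)) ≡ a ℕ.+ a ℕ.+ l ℕ.+ (b ℕ.+ b) ℕ.+ l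
      double = solve-∀
      first : ∀ a b l → b ℕ.+ (a ℕ.+ l) ℕ.+ (a ℕ.+ b) ≡ a ℕ.+ a ℕ.+ l ℕ.+ (b ℕ.+ b)
      first = solve-∀
      second : ∀ b m → b ℕ.+ m ℕ.+ b ≡ m ℕ.+ (b ℕ.+ b)
      second = solve-∀
      third : ∀ a b l → a ℕ.+ b ℕ.+ l ≡ b ℕ.+ (a ℕ.+ l)
      third = solve-∀

    -- The limit M → ∞ of the Burge transform.
    burge-∞ : ∀ L a b →
      conv L (λ i t → q ^ (i ℕ.* i) * B t i a b) ≈ q ^ (b ℕ.* b) * γ (L ℕ.+ (a ℕ.+ b)) L (a ℕ.+ b)
    burge-∞ L a b with ≤-gap (b ℕ.+ a) L
    ... | inj₁ L<b+a = begin
      conv L _                                                ≈⟨ conv-B-0 L a b _ L<b+a ⟩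
      0#                                                      ≈⟨ zeroʳ _ ⟨
      q ^ (b ℕ.* b) * 0#                                      ≡⟨ ≡.cong (q ^ (b ℕ.* b) *_) (γ-< _ (≡.subst (L ℕ.<_) (ℕ.+-comm b a) L<b+a)) ⟨
      q ^ (b ℕ.* b) * γ (L ℕ.+ (a ℕ.+ b)) L (a ℕ.+ b)         ∎
    ... | inj₂ (l , ≡.refl) rewrite ℕ.+-assoc b a l = begin
      conv L′ _
        ≈⟨ conv-B a b l (λ i → q ^ (i ℕ.* i)) ⟩
      conv l (λ s t → q ^ ((b ℕ.+ s) ℕ.* (b ℕ.+ s)) * (gauss (a ℕ.+ t ℕ.+ a) s * gauss (b ℕ.+ s ℕ.+ b) t))
        ≈⟨ conv-cong l (λ s t e → trans (*-congˡ (sym (*-identityˡ _))) (trans (summand a b l s t e 1#) (*-congˡ (*-congˡ (*-congʳ (*-identityˡ _)))))) ⟩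
      conv l (λ s _ → q ^ (b ℕ.* b) * (q ^ (s ℕ.* (s ℕ.+ c′)) * (γ s x s * γ (c′ ℕ.+ s) l s)))
        ≈⟨ trans (conv-*ˡ l _ _) (*-congˡ (q-vandermonde x c′ l)) ⟩
      q ^ (b ℕ.* b) * gauss l (x ℕ.+ c′)
        ≈⟨ *-congˡ (trans (gauss-comm l _) (reflexive (≡.sym (γ-≡ {N = L′} (a ℕ.+ b) l (first a b l) (third a b l))))) ⟩
      q ^ (b ℕ.* b) * γ (L′ ℕ.+ (a ℕ.+ b)) L′ (a ℕ.+ b) ∎
      where
      L′ = b ℕ.+ (a ℕ.+ l)
      x = a ℕ.+ a ℕ.+ l
      c′ = b ℕ.+ b
      first : ∀ a b l → b ℕ.+ (a ℕ.+ l) ℕ.+ (a ℕ.+ b) ≡ a ℕ.+ a ℕ.+ l ℕ.+ (b ℕ.+ b)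
      first = solve-∀
      third : ∀ a b l → a ℕ.+ b ℕ.+ l ≡ b ℕ.+ (a ℕ.+ l)
      third = solve-∀

    -- For p = ab - 1 the exponents are the j((2ab-1)j-1)/2 of the theorem.
    P : ℕ → ℕ → ℕ → ℕ → ℕ → ℕ → Carrier
    P N p a b L M = theta q N p (λ j → B L M (j ℕ.* a) (j ℕ.* b))

    P-swap : ∀ N p a b L M → P N p a b L M ≈ P N p b a M L
    P-swap N p a b L M = theta-cong q N p λ j → B-swap L M (j ℕ.* a) (j ℕ.* b)

    P-burge : ∀ N p a b L M →
      P N (p ℕ.+ b ℕ.* b) (a ℕ.+ b) b L M ≈ conv L (λ i t → q ^ (i ℕ.* i) * γ (L ℕ.+ L) M i * P N p a b t i)
    P-burge N p a b L M = begin
      theta q N (p ℕ.+ b ℕ.* b) (λ j → B L M (j ℕ.* (a ℕ.+ b)) (j ℕ.* b))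
        ≈⟨ theta-+ q N p (b ℕ.* b) _ ⟩
      _ ≈⟨ theta-cong q N p (λ j → trans
             (reflexive (≡.cong₂ (λ e k → q ^ e * B L M k (j ℕ.* b)) (exponent b j) (ℕ.*-distribˡ-+ j a b)))
             (sym (burge L M (j ℕ.* a) (j ℕ.* b)))) ⟩
      theta q N p (λ j → conv L (λ i t → q ^ (i ℕ.* i) * γ (L ℕ.+ L) M i * B t i (j ℕ.* a) (j ℕ.* b)))
        ≈⟨ theta-conv q N p L (λ i t → q ^ (i ℕ.* i) * γ (L ℕ.+ L) M i) (λ i t j → B t i (j ℕ.* a) (j ℕ.* b)) ⟩
      conv L (λ i t → q ^ (i ℕ.* i) * γ (L ℕ.+ L) M i * P N p a b t i) ∎
      where
      exponent : ∀ b j → b ℕ.* b ℕ.* (j ℕ.* j) ≡ j ℕ.* b ℕ.* (j ℕ.* b)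
      exponent = solve-∀

    P-burge-∞ : ∀ N p a b L →
      theta q N (p ℕ.+ b ℕ.* b) (λ j → γ (L ℕ.+ j ℕ.* (a ℕ.+ b)) L (j ℕ.* (a ℕ.+ b))) ≈
      conv L (λ i t → q ^ (i ℕ.* i) * P N p a b t i)
    P-burge-∞ N p a b L = begin
      theta q N (p ℕ.+ b ℕ.* b) (λ j → γ (L ℕ.+ j ℕ.* (a ℕ.+ b)) L (j ℕ.* (a ℕ.+ b)))
        ≈⟨ theta-+ q N p (b ℕ.* b) _ ⟩
      _ ≈⟨ theta-cong q N p (λ j → trans
             (reflexive (≡.cong₂ (λ e k → q ^ e * γ (L ℕ.+ k) L k) (exponent b j) (ℕ.*-distribˡ-+ j a b)))
             (sym (burge-∞ L (j ℕ.* a) (j ℕ.* b)))) ⟩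
      theta q N p (λ j → conv L (λ i t → q ^ (i ℕ.* i) * B t i (j ℕ.* a) (j ℕ.* b)))
        ≈⟨ theta-conv q N p L (λ i t → q ^ (i ℕ.* i)) (λ i t j → B t i (j ℕ.* a) (j ℕ.* b)) ⟩
      conv L (λ i t → q ^ (i ℕ.* i) * P N p a b t i) ∎
      where
      exponent : ∀ b j → b ℕ.* b ℕ.* (j ℕ.* j) ≡ j ℕ.* b ℕ.* (j ℕ.* b)
      exponent = solve-∀

    -- Telescoping evaluations for a = b = 1

    ν-γˡ : ∀ X N s n → suc X ℕ.+ N ≡ s ℕ.+ n → ν (suc X) * γ (suc X) N s ≈ ν n * γ X N s
    ν-γˡ X N s n e with ≤-gap s N
    ... | inj₁ N<s rewrite γ-< (suc X) N<s | γ-< X N<s = trans (zeroʳ _) (sym (zeroʳ _))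
    ... | inj₂ (d , ≡.refl) rewrite γ-+ (suc X) s d | γ-+ X s d = trans (ν-gaussˡ X d) (*-congʳ (reflexive (≡.cong ν n-eq)))
      where
      rearrange : ∀ X s d → s ℕ.+ suc (X ℕ.+ d) ≡ suc X ℕ.+ (s ℕ.+ d)
      rearrange = solve-∀
      n-eq : suc (X ℕ.+ d) ≡ n
      n-eq = ℕ.+-cancelˡ-≡ s _ _ (≡.trans (rearrange X s d) e)

    ν-γʳ : ∀ X s l → ν l * γ X (s ℕ.+ l) s ≈ ν (X ℕ.+ l) * γ X (s ℕ.+ l) (suc s)
    ν-γʳ X zero    zero    = trans (*-congʳ ν-0) (trans (zeroˡ _) (sym (zeroʳ _)))
    ν-γʳ X zero    (suc l) rewrite ℕ.+-suc X l = ν-gaussʳ X l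
    ν-γʳ X (suc s) l       = ν-γʳ X s l

    weight-0 : ∀ j → weight q 0 (suc j) ≈ q ^ tri j * (1# + q ^ suc j)
    weight-0 j = begin
      1# * (q ^ tri j + q ^ tri (suc j))             ≈⟨ *-congˡ (+-congˡ (^-homo-* q (suc j) (tri j))) ⟩
      1# * (q ^ tri j + q ^ suc j * q ^ tri j)       ≈⟨ solve 2 (λ t j → con 1 :* (t :+ j :* t) := t :* (con 1 :+ j)) refl (q ^ tri j) (q ^ suc j) ⟩
      q ^ tri j * (1# + q ^ suc j)                   ∎

    -- Divides the factor (1 - q^(L+1))(1 + q^j), where L+1 = j+l, into two pieces, each of which
    -- cancels against a denominator of one of the two q-binomial coefficients [L+1+M; L+1+j] and
    -- [L+1+M; L+1-j]. Adding `ν j` to both sides avoids subtraction.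
    ν-split : ∀ j l → ν (j ℕ.+ l) * (1# + q ^ j) ≈ ν (j ℕ.+ l ℕ.+ j) + q ^ j * ν l
    ν-split j l = ∙-cancelˡ (ν j) _ _ (begin
      ν j + ν L * (1# + q ^ j)                  ≈⟨ solve 3 (λ a b Q → a :+ b :* (con 1 :+ Q) := (a :+ Q :* b) :+ b) refl (ν j) (ν L) (q ^ j) ⟩
      ν j + q ^ j * ν L + ν L                   ≈⟨ +-cong (ν-+ j L) (sym (ν-+ j l)) ⟨
      ν (j ℕ.+ L) + (ν j + q ^ j * ν l)         ≈⟨ solve 3 (λ a b c → a :+ (b :+ c) := b :+ (a :+ c)) refl (ν (j ℕ.+ L)) (ν j) (q ^ j * ν l) ⟩
      ν j + (ν (j ℕ.+ L) + q ^ j * ν l)         ≡⟨ ≡.cong (λ k → ν j + (ν k + q ^ j * ν l)) (ℕ.+-comm j L) ⟩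
      ν j + (ν (L ℕ.+ j) + q ^ j * ν l)         ∎)
      where L = j ℕ.+ l

    private
      -- After multiplication by ν (L+1) the j-th term of the sum for L+1 is, up to the factor ν n,
      -- q^M times the j-th term for L plus t j + t (j+1); the latter telescopes.
      module Recursion (L M : ℕ) where
        n = suc L ℕ.+ M

        A : ℕ → Carrier
        A j = B (suc L) M j j
        A′ : ℕ → Carrier
        A′ j = B L M j j
        -- [L+M; L+j+1] [L+M; L-j], the product common to the expansions of the terms j and j+1,
        -- hence the one that telescopes.
        O : ℕ → Carrier
        O j = γ (L ℕ.+ suc j) M (suc j) * γ (M ℕ.+ j) L j

        t : ℕ → Carrier
        t zero    = 0#
        t (suc j) = q ^ tri j * O j

        -- The factor 1 - q^(L+j+2) lowers the first coefficient in `A (suc j)`, and Pascal's rule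
        -- splits the second. In `minus` the two coefficients exchange roles.
        plus : ∀ j → ν (suc L ℕ.+ suc j) * A (suc j) ≈ ν n * (O j + q ^ (M ℕ.+ suc j) * A′ (suc j))
        plus j rewrite ℕ.+-suc M j = begin
          ν (suc X) * (γ (suc X) M (suc j) * γ (suc Y) (suc L) (suc j))
            ≈⟨ *-assoc _ _ _ ⟨
          ν (suc X) * γ (suc X) M (suc j) * γ (suc Y) (suc L) (suc j)
            ≈⟨ *-cong (ν-γˡ X M (suc j) n (sizes L j M)) (γ-pascalˡ Y (suc L) (suc j)) ⟩
          ν n * γ X M (suc j) * (γ Y L j + q ^ suc Y * γ (suc Y) L (suc j))
            ≈⟨ solve 5 (λ n x y Q z → n :* x :* (y :+ Q :* z) := n :* (x :* y :+ Q :* (x :* z))) refl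
                 (ν n) (γ X M (suc j)) (γ Y L j) (q ^ suc Y) (γ (suc Y) L (suc j)) ⟩
          ν n * (γ X M (suc j) * γ Y L j + q ^ suc Y * (γ X M (suc j) * γ (suc Y) L (suc j))) ∎
          where
          X = L ℕ.+ suc j
          Y = M ℕ.+ j
          sizes : ∀ L j M → suc (L ℕ.+ suc j) ℕ.+ M ≡ suc j ℕ.+ (suc L ℕ.+ M)
          sizes = solve-∀

        minus : ∀ j l → j ℕ.+ l ≡ suc L → ν l * A j ≈ ν n * (O j + q ^ (M ∸ j) * A′ j)
        minus j l e rewrite ℕ.+-suc L j = begin
          ν l * (γ (suc X) M j * γ Y (suc L) j)
            ≈⟨ solve 3 (λ n x y → n :* (x :* y) := x :* (n :* y)) refl (ν l) (γ (suc X) M j) (γ Y (suc L) j) ⟩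
          γ (suc X) M j * (ν l * γ Y (suc L) j)
            ≈⟨ *-cong (γ-pascalʳ X M j) (≡.subst (λ K → ν l * γ Y K j ≈ ν (Y ℕ.+ l) * γ Y K (suc j)) e (ν-γʳ Y j l)) ⟩
          (γ (suc X) M (suc j) + q ^ (M ∸ j) * γ X M j) * (ν (Y ℕ.+ l) * γ Y L j)
            ≡⟨ ≡.cong (λ k → (γ (suc X) M (suc j) + q ^ (M ∸ j) * γ X M j) * (ν k * γ Y L j)) size ⟩
          (γ (suc X) M (suc j) + q ^ (M ∸ j) * γ X M j) * (ν n * γ Y L j)
            ≈⟨ solve 5 (λ x Q y n z → (x :+ Q :* y) :* (n :* z) := n :* (x :* z :+ Q :* (y :* z))) refl
                 (γ (suc X) M (suc j)) (q ^ (M ∸ j)) (γ X M j) (ν n) (γ Y L j) ⟩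
          ν n * (γ (suc X) M (suc j) * γ Y L j + q ^ (M ∸ j) * (γ X M j * γ Y L j)) ∎
          where
          X = L ℕ.+ j
          Y = M ℕ.+ j
          size : Y ℕ.+ l ≡ n
          size = ≡.trans (ℕ.+-assoc M j l) (≡.trans (≡.cong (M ℕ.+_) e) (ℕ.+-comm M (suc L)))

        A′-power : ∀ j → q ^ j * (q ^ (M ∸ j) * A′ j) ≈ q ^ M * A′ j
        A′-power j = begin
          q ^ j * (q ^ (M ∸ j) * A′ j)                                  ≈⟨ pow* j (M ∸ j) ≡.refl _ ⟩
          q ^ (j ℕ.+ (M ∸ j)) * (γ (L ℕ.+ j) M j * γ (M ℕ.+ j) L j)      ≈⟨ *-assoc _ _ _ ⟨
          q ^ (j ℕ.+ (M ∸ j)) * γ (L ℕ.+ j) M j * γ (M ℕ.+ j) L j        ≈⟨ *-congʳ (γ-pow (L ℕ.+ j) M j (λ d e → ℕ.m+[n∸m]≡n (≡.subst (j ℕ.≤_) e (ℕ.m≤m+n j d)))) ⟩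
          q ^ M * γ (L ℕ.+ j) M j * γ (M ℕ.+ j) L j                      ≈⟨ *-assoc _ _ _ ⟩
          q ^ M * A′ j                                                  ∎

        step : ∀ j → ν (suc L) * (weight q 0 j * A j) ≈ ν n * (t j + t (suc j) + q ^ M * (weight q 0 j * A′ j))
        step zero = begin
          ν (suc L) * (1# * A 0)                                ≈⟨ *-congˡ (*-identityˡ _) ⟩
          ν (suc L) * A 0                                       ≈⟨ minus 0 (suc L) ≡.refl ⟩
          ν n * (O 0 + q ^ M * A′ 0)                            ≈⟨ solve 4 (λ n o Q a → n :* (o :+ Q :* a) := n :* (con 0 :+ con 1 :* o :+ Q :* (con 1 :* a))) refl (ν n) (O 0) (q ^ M) (A′ 0) ⟩
          ν n * (0# + 1# * O 0 + q ^ M * (1# * A′ 0))           ∎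
        step (suc j) with ≤-gap (suc j) (suc L)
        ... | inj₁ L<j = begin
          ν (suc L) * (w * A (suc j))
            ≈⟨ *-congˡ (*-congˡ (B-0ˡ M (suc j) L<j)) ⟩
          ν (suc L) * (w * 0#)
            ≈⟨ solve 7 (λ u w n T S g Q → u :* (w :* con 0) := n :* (T :* (g :* con 0) :+ S :* (Q :* con 0) :+ Q :* (w :* con 0))) refl
                 (ν (suc L)) w (ν n) (q ^ tri j) (q ^ tri (suc j)) (γ (L ℕ.+ suc j) M (suc j)) (q ^ M) ⟩
          ν n * (q ^ tri j * (γ (L ℕ.+ suc j) M (suc j) * 0#) + q ^ tri (suc j) * (q ^ M * 0#) + q ^ M * (w * 0#))
            ≈⟨ *-congˡ (+-cong (+-cong (*-congˡ (*-congˡ (reflexive (γ-< (M ℕ.+ j) (ℕ.s≤s⁻¹ L<j)))))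
                                       (*-congˡ (trans (*-congˡ (reflexive (γ-< (M ℕ.+ suc j) L<1+j))) (trans (zeroʳ _) (sym (zeroʳ _))))))
                               (*-congˡ (*-congˡ (B-0ˡ M (suc j) L<1+j)))) ⟨
          ν n * (t (suc j) + t (suc (suc j)) + q ^ M * (w * A′ (suc j))) ∎
          where
          w = weight q 0 (suc j)
          L<1+j : L ℕ.< suc j
          L<1+j = ℕ.<-trans (ℕ.n<1+n L) L<j
        ... | inj₂ (l , e) = begin
          ν (suc L) * (weight q 0 (suc j) * a)
            ≈⟨ *-cong (reflexive (≡.cong ν (≡.sym e))) (*-congʳ (weight-0 j)) ⟩
          ν (suc j ℕ.+ l) * (T * (1# + J) * a)
            ≈⟨ solve 4 (λ x T J a → x :* (T :* J :* a) := T :* (x :* J :* a)) refl (ν (suc j ℕ.+ l)) T (1# + J) a ⟩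
          T * (ν (suc j ℕ.+ l) * (1# + J) * a)
            ≈⟨ *-congˡ (*-congʳ (trans (ν-split (suc j) l) (+-congʳ (reflexive (≡.cong (λ k → ν (k ℕ.+ suc j)) e))))) ⟩
          T * ((ν (suc L ℕ.+ suc j) + J * ν l) * a)
            ≈⟨ solve 5 (λ T x J y a → T :* ((x :+ J :* y) :* a) := T :* (x :* a) :+ T :* (J :* (y :* a))) refl T (ν (suc L ℕ.+ suc j)) J (ν l) a ⟩
          T * (ν (suc L ℕ.+ suc j) * a) + T * (J * (ν l * a))
            ≈⟨ +-cong (*-congˡ (plus j)) (*-congˡ (*-congˡ (minus (suc j) l e))) ⟩
          T * (ν n * (O j + q ^ (M ℕ.+ suc j) * a′)) + T * (J * (ν n * (O (suc j) + q ^ (M ∸ suc j) * a′)))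
            ≈⟨ solve 8 (λ T n o Y a J p Z → T :* (n :* (o :+ Y :* a)) :+ T :* (J :* (n :* (p :+ Z :* a))) :=
                           n :* (T :* o :+ J :* T :* p :+ T :* (Y :* a :+ J :* (Z :* a)))) refl
                 T (ν n) (O j) (q ^ (M ℕ.+ suc j)) a′ J (O (suc j)) (q ^ (M ∸ suc j)) ⟩
          ν n * (T * O j + J * T * O (suc j) + T * (q ^ (M ℕ.+ suc j) * a′ + J * (q ^ (M ∸ suc j) * a′)))
            ≈⟨ *-congˡ (+-cong (+-congˡ (*-congʳ (sym (^-homo-* q (suc j) (tri j))))) (*-congˡ (+-cong (*-congʳ (^-homo-* q M (suc j))) (A′-power (suc j))))) ⟩
          ν n * (t (suc j) + t (suc (suc j)) + T * (q ^ M * J * a′ + q ^ M * a′))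
            ≈⟨ *-congˡ (+-congˡ (solve 4 (λ T Q J a → T :* (Q :* J :* a :+ Q :* a) := Q :* (T :* (con 1 :+ J) :* a)) refl T (q ^ M) J a′)) ⟩
          ν n * (t (suc j) + t (suc (suc j)) + q ^ M * (T * (1# + J) * a′))
            ≈⟨ *-congˡ (+-congˡ (*-congˡ (*-congʳ (weight-0 j)))) ⟨
          ν n * (t (suc j) + t (suc (suc j)) + q ^ M * (weight q 0 (suc j) * a′)) ∎
          where
          T  = q ^ tri j
          J  = q ^ suc j
          a  = A (suc j)
          a′ = A′ (suc j)

        recursion : ∀ N → suc L ℕ.≤ N → ν (suc L) * theta q N 0 A ≈ ν n * (q ^ M * theta q N 0 A′)
        recursion N L<N = begin
          ν (suc L) * theta q N 0 A
            ≈⟨ alt-*ˡ N _ _ ⟨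
          alt N (λ j → ν (suc L) * (weight q 0 j * A j))
            ≈⟨ trans (alt-cong N step) (alt-*ˡ N _ _) ⟩
          ν n * alt N (λ j → t j + t (suc j) + q ^ M * (weight q 0 j * A′ j))
            -- The telescoping part contributes `t 0`, which is 0; the far end `t (suc N)` vanishes
            -- because N > L.
            ≈⟨ *-congˡ (trans (alt-+ N _ _) (+-cong (alt-telescope N t t-last) (alt-*ˡ N _ _))) ⟩
          ν n * (0# + q ^ M * theta q N 0 A′)
            ≈⟨ *-congˡ (+-identityˡ _) ⟩
          ν n * (q ^ M * theta q N 0 A′) ∎
          where
          t-last : t (suc N) ≈ 0#
          t-last rewrite γ-< (M ℕ.+ N) L<N = trans (*-congˡ (zeroʳ _)) (zeroʳ _)

    -- Both sides satisfy ν(L+1) f(L+1) = ν(L+M+1) q^M f(L), the left by `recursion` and the right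
    -- by `ν-gaussˡ`; `ν (suc L)` is then cancelled. The bound L ≤ N makes the truncated sum
    -- complete.
    theta-B : ∀ N L M → L ℕ.≤ N → theta q N 0 (λ j → B L M j j) ≈ q ^ (L ℕ.* M) * gauss L M
    theta-B N zero M _ = begin
      theta q N 0 (λ j → B 0 M j j)  ≈⟨ alt-head N _ (λ j → trans (*-congˡ (B-0ˡ M (suc j) (ℕ.s≤s ℕ.z≤n))) (zeroʳ _)) ⟩
      1# * (1# * gauss (M ℕ.+ 0) 0)  ≈⟨ *-congˡ (*-congˡ (gauss-0ʳ (M ℕ.+ 0))) ⟩
      1# * (1# * 1#)                 ≈⟨ *-congˡ (*-identityˡ 1#) ⟩
      1# * 1#                        ∎
    theta-B N (suc L) M L<N = regular L (begin
      ν (suc L) * theta q N 0 (λ j → B (suc L) M j j)          ≈⟨ Recursion.recursion L M N L<N ⟩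
      ν n * (q ^ M * theta q N 0 (λ j → B L M j j))            ≈⟨ *-congˡ (*-congˡ (theta-B N L M (ℕ.<⇒≤ L<N))) ⟩
      ν n * (q ^ M * (q ^ (L ℕ.* M) * gauss L M))              ≈⟨ *-congˡ (pow* M (L ℕ.* M) ≡.refl _) ⟩
      ν n * (Q * gauss L M)                                    ≈⟨ solve 3 (λ n Q g → n :* (Q :* g) := Q :* (n :* g)) refl (ν n) Q (gauss L M) ⟩
      Q * (ν n * gauss L M)                                    ≈⟨ *-congˡ (ν-gaussˡ L M) ⟨
      Q * (ν (suc L) * gauss (suc L) M)                        ≈⟨ solve 3 (λ n Q g → n :* (Q :* g) := Q :* (n :* g)) refl (ν (suc L)) Q (gauss (suc L) M) ⟨
      ν (suc L) * (Q * gauss (suc L) M)                        ∎)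
      where
      n = suc L ℕ.+ M
      Q = q ^ (suc L ℕ.* M)

    -- With n = L+1, this is the q-binomial theorem for (z;q)_(2n) at z = q^(-n), where one factor
    -- is 0. As z is a negative power of q, the proof telescopes instead: by both Pascal rules each
    -- term is `t j + t (suc j)`, with `o j` = [2L+1; L-j].
    theta-central : ∀ N L → suc L ℕ.≤ N → theta q N 0 (λ j → γ (suc L ℕ.+ j) (suc L) j) ≈ 0#
    theta-central N L L<N = trans (alt-cong N step) (alt-telescope N t t-last)
      where
      o : ℕ → Carrier
      o j = γ (L ℕ.+ suc j) L j
      t : ℕ → Carrier
      t zero    = 0#
      t (suc j) = (1# + q ^ suc L) * (q ^ tri j * o j)
      t-last : t (suc N) ≈ 0#
      t-last rewrite γ-< (L ℕ.+ suc N) L<N = trans (*-congˡ (zeroʳ _)) (zeroʳ _)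
      step : ∀ j → weight q 0 j * γ (suc L ℕ.+ j) (suc L) j ≈ t j + t (suc j)
      step zero rewrite ℕ.+-comm L 1 | ℕ.+-identityʳ L = begin
        1# * gauss (suc L) (suc L)                                    ≈⟨ *-congˡ (γ-pascalˡ L (suc L) 0) ⟩
        1# * (gauss L (suc L) + q ^ suc L * gauss (suc L) L)          ≈⟨ *-congˡ (+-congʳ (gauss-comm L (suc L))) ⟩
        1# * (gauss (suc L) L + q ^ suc L * gauss (suc L) L)          ≈⟨ solve 2 (λ g Q → con 1 :* (g :+ Q :* g) := con 0 :+ (con 1 :+ Q) :* (con 1 :* g)) refl (gauss (suc L) L) (q ^ suc L) ⟩
        0# + (1# + q ^ suc L) * (1# * gauss (suc L) L)                ∎
      step (suc j) = begin
        weight q 0 (suc j) * γ (suc X) (suc L) (suc j)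
          ≈⟨ *-congʳ (weight-0 j) ⟩
        T * (1# + J) * γ (suc X) (suc L) (suc j)
          ≈⟨ solve 3 (λ T J g → T :* (con 1 :+ J) :* g := T :* (g :+ J :* g)) refl T J (γ (suc X) (suc L) (suc j)) ⟩
        T * (γ (suc X) (suc L) (suc j) + J * γ (suc X) (suc L) (suc j))
          ≈⟨ *-congˡ (+-cong (γ-pascalˡ X (suc L) (suc j)) (*-congˡ (γ-pascalʳ X (suc L) (suc j)))) ⟩
        T * (o j + q ^ suc X * o₁ + J * (o₁ + q ^ (L ∸ j) * o j))
          ≈⟨ solve 6 (λ T a X b J Y → T :* (a :+ X :* b :+ J :* (b :+ Y :* a)) := T :* (a :+ X :* b :+ J :* b :+ J :* (Y :* a))) refl
               T (o j) (q ^ suc X) o₁ J (q ^ (L ∸ j)) ⟩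
        T * (o j + q ^ suc X * o₁ + J * o₁ + J * (q ^ (L ∸ j) * o j))
          ≈⟨ *-congˡ (+-cong (+-congʳ (+-congˡ (*-congʳ (pow (suc L) (suc j) ≡.refl)))) power) ⟩
        T * (o j + q ^ suc L * J * o₁ + J * o₁ + q ^ suc L * o j)
          ≈⟨ solve 5 (λ T a Q J b → T :* (a :+ Q :* J :* b :+ J :* b :+ Q :* a) := (con 1 :+ Q) :* (T :* a) :+ (con 1 :+ Q) :* (J :* T :* b)) refl
               T (o j) (q ^ suc L) J o₁ ⟩
        (1# + q ^ suc L) * (T * o j) + (1# + q ^ suc L) * (J * T * o₁)
          ≈⟨ +-congˡ (*-congˡ (*-cong (pow (suc j) (tri j) ≡.refl) (reflexive (≡.cong (λ X → γ X L (suc j)) (ℕ.+-suc L (suc j)))))) ⟨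
        t (suc j) + t (suc (suc j)) ∎
        where
        X = L ℕ.+ suc j
        T = q ^ tri j
        J = q ^ suc j
        o₁ = γ (suc X) L (suc j)
        power : J * (q ^ (L ∸ j) * o j) ≈ q ^ suc L * o j
        power = trans (pow* (suc j) (L ∸ j) ≡.refl _) (γ-pow X L j λ d e → ≡.cong suc (ℕ.m+[n∸m]≡n (≡.subst (j ℕ.≤_) e (ℕ.m≤m+n j d))))

  -- conv₂ n f = Σ_{s + 2v = n} f s v
  conv₂ : ℕ → (ℕ → ℕ → Carrier) → Carrier
  conv₂ zero          f = f 0 0
  conv₂ (suc zero)    f = f 1 0
  conv₂ (suc (suc n)) f = f (suc (suc n)) 0 + conv₂ n (λ s v → f s (suc v))

  conv₂-cong : ∀ n {f g : ℕ → ℕ → Carrier} → (∀ s v → s ℕ.+ (v ℕ.+ v) ≡ n → f s v ≈ g s v) → conv₂ n f ≈ conv₂ n g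
  conv₂-cong zero          h = h 0 0 ≡.refl
  conv₂-cong (suc zero)    h = h 1 0 ≡.refl
  conv₂-cong (suc (suc n)) h = +-cong (h (suc (suc n)) 0 (ℕ.+-identityʳ _)) (conv₂-cong n λ s v e → h s (suc v) (sum-suc {s} {v} e))

  conv₂-zero : ∀ n {f : ℕ → ℕ → Carrier} → (∀ s v → s ℕ.+ (v ℕ.+ v) ≡ n → f s v ≈ 0#) → conv₂ n f ≈ 0#
  conv₂-zero zero          h = h 0 0 ≡.refl
  conv₂-zero (suc zero)    h = h 1 0 ≡.refl
  conv₂-zero (suc (suc n)) h = trans (+-cong (h (suc (suc n)) 0 (ℕ.+-identityʳ _)) (conv₂-zero n λ s v e → h s (suc v) (sum-suc {s} {v} e))) (+-identityˡ 0#)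

  conv₂-+ : ∀ n (f g : ℕ → ℕ → Carrier) → conv₂ n (λ s v → f s v + g s v) ≈ conv₂ n f + conv₂ n g
  conv₂-+ zero          f g = refl
  conv₂-+ (suc zero)    f g = refl
  conv₂-+ (suc (suc n)) f g = trans (+-congˡ (conv₂-+ n _ _)) (solve 4 (λ a b c d → (a :+ b) :+ (c :+ d) := (a :+ c) :+ (b :+ d)) refl _ _ _ _)

  conv₂-*ˡ : ∀ n k (f : ℕ → ℕ → Carrier) → conv₂ n (λ s v → k * f s v) ≈ k * conv₂ n f
  conv₂-*ˡ zero          k f = refl
  conv₂-*ˡ (suc zero)    k f = refl
  conv₂-*ˡ (suc (suc n)) k f = trans (+-congˡ (conv₂-*ˡ n k _)) (sym (distribˡ k _ _))

  conv₂-drop : ∀ x n (f : ℕ → ℕ → Carrier) → (∀ s v → v ℕ.< x → f s v ≈ 0#) →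
    conv₂ (x ℕ.+ x ℕ.+ n) f ≈ conv₂ n (λ s v → f s (x ℕ.+ v))
  conv₂-drop zero    n f h = refl
  conv₂-drop (suc x) n f h rewrite ℕ.+-suc x x = begin
    f _ 0 + conv₂ (x ℕ.+ x ℕ.+ n) (λ s v → f s (suc v))  ≈⟨ +-congʳ (h _ 0 (ℕ.s≤s ℕ.z≤n)) ⟩
    0# + conv₂ (x ℕ.+ x ℕ.+ n) (λ s v → f s (suc v))     ≈⟨ +-identityˡ _ ⟩
    conv₂ (x ℕ.+ x ℕ.+ n) (λ s v → f s (suc v))          ≈⟨ conv₂-drop x n _ (λ s v v<x → h s (suc v) (ℕ.s≤s v<x)) ⟩
    conv₂ n (λ s v → f s (suc x ℕ.+ v))                  ∎

  -- A point (s, v) of the line s + 2v = h+1 has two neighbours on the line for h: (s-1, v), read by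
  -- `prevˢ`, and (s+1, v-1), read by `prevᵛ`. Missing neighbours count as 0.
  prevˢ : (ℕ → ℕ → Carrier) → ℕ → ℕ → Carrier
  prevˢ f zero    v = 0#
  prevˢ f (suc s) v = f s v

  prevᵛ : (ℕ → ℕ → Carrier) → ℕ → ℕ → Carrier
  prevᵛ f s zero    = 0#
  prevᵛ f s (suc v) = f (suc s) v

  conv₂-prevˢ : ∀ n f → conv₂ (suc n) (prevˢ f) ≈ conv₂ n f
  conv₂-prevˢ zero          f = refl
  conv₂-prevˢ (suc zero)    f = +-identityʳ _
  conv₂-prevˢ (suc (suc n)) f = +-congˡ (trans (conv₂-cong (suc n) λ { zero v _ → refl ; (suc s) v _ → refl }) (conv₂-prevˢ n λ s v → f s (suc v)))

  conv₂-suc : ∀ n f → (∀ v → f 0 v ≈ 0#) → conv₂ n (λ s v → f (suc s) v) ≈ conv₂ (suc n) f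
  conv₂-suc zero          f h = refl
  conv₂-suc (suc zero)    f h = trans (sym (+-identityʳ _)) (+-congˡ (sym (h 1)))
  conv₂-suc (suc (suc n)) f h = +-congˡ (conv₂-suc n _ λ v → h (suc v))

  -- The points (0, v) of the lower line are never of the form (s+1, v-1), so `f` has to vanish
  -- there.
  conv₂-prevᵛ : ∀ n f → (∀ v → f 0 v ≈ 0#) → conv₂ (suc n) (prevᵛ f) ≈ conv₂ n f
  conv₂-prevᵛ zero    f h = sym (h 0)
  conv₂-prevᵛ (suc n) f h = trans (+-identityˡ _) (conv₂-suc n f h)

  theta-conv₂ : ∀ Q N p n (φ : ℕ → ℕ → Carrier) (f : ℕ → ℕ → ℕ → Carrier) →
    theta Q N p (λ j → conv₂ n (λ s v → φ s v * f s v j)) ≈ conv₂ n (λ s v → φ s v * theta Q N p (f s v))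
  theta-conv₂ Q N p n φ f = go n φ f
    where
    scale : ∀ k (g : ℕ → Carrier) → theta Q N p (λ j → k * g j) ≈ k * theta Q N p g
    scale k g = trans (alt-cong N λ j → solve 3 (λ w x y → w :* (x :* y) := x :* (w :* y)) refl (weight Q p j) k (g j)) (alt-*ˡ N k _)
    go : ∀ n (φ : ℕ → ℕ → Carrier) (f : ℕ → ℕ → ℕ → Carrier) →
      theta Q N p (λ j → conv₂ n (λ s v → φ s v * f s v j)) ≈ conv₂ n (λ s v → φ s v * theta Q N p (f s v))
    go zero          φ f = scale _ _
    go (suc zero)    φ f = scale _ _
    go (suc (suc n)) φ f = begin
      theta Q N p (λ j → φ (suc (suc n)) 0 * f (suc (suc n)) 0 j + conv₂ n (λ s v → φ s (suc v) * f s (suc v) j))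
        ≈⟨ trans (alt-cong N λ j → distribˡ _ _ _) (alt-+ N _ _) ⟩
      theta Q N p (λ j → φ (suc (suc n)) 0 * f (suc (suc n)) 0 j) + theta Q N p (λ j → conv₂ n (λ s v → φ s (suc v) * f s (suc v) j))
        ≈⟨ +-cong (scale _ _) (go n (λ s v → φ s (suc v)) (λ s v → f s (suc v))) ⟩
      conv₂ (suc (suc n)) (λ s v → φ s v * theta Q N p (f s v)) ∎

  regular-square : ∀ {q} → Regular q → Regular (q ^ 2)
  regular-square {q} regular n {x} {y} e = regular (n ℕ.+ suc n) (trans (*-congʳ eq) (trans e (*-congʳ (sym eq))))
    where
    eq : 1# - q ^ (suc n ℕ.+ suc n) ≈ 1# - (q ^ 2) ^ suc n
    eq = +-congˡ (-‿cong (trans (^-congʳ q (≡.cong (suc n ℕ.+_) (≡.sym (ℕ.+-identityʳ (suc n))))) (sym (^-assocʳ q 2 (suc n)))))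

  -- Quadratic transformations

  module Doubling (q : Carrier) (regular : Regular q) where
    open QBinomial q regular
    module S = QBinomial (q ^ 2) (regular-square regular)

    ν-square : ∀ s → S.ν s ≈ ν (s ℕ.+ s)
    ν-square s = +-congˡ (-‿cong (trans (^-assocʳ q 2 s) (^-congʳ q (≡.cong (s ℕ.+_) (ℕ.+-identityʳ s)))))

    -- This is the origin of the products (-q;q)_s in both transformations: a factor 1 + q^s raises
    -- `ν s` to base q², the base of the trinomial coefficients.
    ν-factor : ∀ s → (1# + q ^ s) * ν s ≈ S.ν s
    ν-factor s = begin
      (1# + q ^ s) * ν s    ≈⟨ solve 2 (λ Q n → (con 1 :+ Q) :* n := n :+ Q :* n) refl (q ^ s) (ν s) ⟩
      ν s + q ^ s * ν s     ≈⟨ ν-+ s s ⟨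
      ν (s ℕ.+ s)           ≈⟨ ν-square s ⟨
      S.ν s                 ∎

    -- A sum over s + 2v = h is evaluated by a first-order recurrence in h; each term
    -- of ν (h+1) times the sum splits into two neighbours, which recombine.
    module Recurrence
      (y A C : ℕ → ℕ → ℕ → Carrier)
      (y-0 : ∀ w → y 0 0 w ≈ 1#)
      (y-split : ∀ s v w → ν (s ℕ.+ (v ℕ.+ v)) * y s v w ≈ prevˢ (λ s v → A s v (suc w)) s v + prevᵛ (λ s v → C s v w) s v)
      (y-join : ∀ s v w → A s v w + C s v w ≈ ν (s ℕ.+ (w ℕ.+ w)) * y s v w)
      (C-0 : ∀ v w → C 0 v w ≈ 0#) where

      -- The splitting sends (s, v, w) to (s-1, v, w+1) and (s+1, v-1, w). Both keep s+v+w and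
      -- increase w-v = N by one, so h falls while N rises; hence the induction on h for all N. The
      -- value [2h+2N; h] obeys the same recurrence by `ν-gauss`.
      evaluate : ∀ N h → conv₂ h (λ s v → y s v (v ℕ.+ N)) ≈ gauss h (h ℕ.+ (N ℕ.+ N))
      evaluate N zero    = y-0 N
      evaluate N (suc h) = regular h (begin
        ν (suc h) * conv₂ (suc h) (λ s v → y s v (v ℕ.+ N))
          ≈⟨ conv₂-*ˡ (suc h) _ _ ⟨
        conv₂ (suc h) (λ s v → ν (suc h) * y s v (v ℕ.+ N))
          ≈⟨ conv₂-cong (suc h) split-term ⟩
        conv₂ (suc h) (λ s v → prevˢ A′ s v + prevᵛ C′ s v)
          ≈⟨ conv₂-+ (suc h) _ _ ⟩
        conv₂ (suc h) (prevˢ A′) + conv₂ (suc h) (prevᵛ C′)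
          ≈⟨ +-cong (conv₂-prevˢ h A′) (conv₂-prevᵛ h C′ λ v → C-0 v _) ⟩
        conv₂ h A′ + conv₂ h C′
          ≈⟨ conv₂-+ h A′ C′ ⟨
        conv₂ h (λ s v → A′ s v + C′ s v)
          ≈⟨ conv₂-cong h (λ s v e → trans (y-join s v _) (*-congʳ (reflexive (≡.cong ν (join-size s v e))))) ⟩
        conv₂ h (λ s v → ν n * y s v (v ℕ.+ suc N))
          ≈⟨ conv₂-*ˡ h _ _ ⟩
        ν n * conv₂ h (λ s v → y s v (v ℕ.+ suc N))
          ≈⟨ *-congˡ (evaluate (suc N) h) ⟩
        ν n * gauss h (h ℕ.+ (suc N ℕ.+ suc N))
          ≡⟨ ≡.cong₂ (λ n b → ν n * gauss h b) (n-size h N) (b-size h N) ⟩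
        ν (suc b) * gauss h (suc b)
          ≈⟨ ν-gauss h b ⟨
        ν (suc h) * gauss (suc h) b ∎)
        where
        n = h ℕ.+ (suc N ℕ.+ suc N)
        b = suc h ℕ.+ (N ℕ.+ N)
        A′ C′ : ℕ → ℕ → Carrier
        A′ s v = A s v (v ℕ.+ suc N)
        C′ s v = C s v (v ℕ.+ suc N)
        join-size : ∀ s v → s ℕ.+ (v ℕ.+ v) ≡ h → s ℕ.+ (v ℕ.+ suc N ℕ.+ (v ℕ.+ suc N)) ≡ n
        join-size s v ≡.refl = identity s v N
          where
          identity : ∀ s v N → s ℕ.+ (v ℕ.+ suc N ℕ.+ (v ℕ.+ suc N)) ≡ s ℕ.+ (v ℕ.+ v) ℕ.+ (suc N ℕ.+ suc N)
          identity = solve-∀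
        n-size : ∀ h N → h ℕ.+ (suc N ℕ.+ suc N) ≡ suc (suc h ℕ.+ (N ℕ.+ N))
        n-size = solve-∀
        b-size : ∀ h N → h ℕ.+ (suc N ℕ.+ suc N) ≡ suc (suc h ℕ.+ (N ℕ.+ N))
        b-size = solve-∀
        prevˢ-eq : ∀ s v → prevˢ (λ s′ v′ → A s′ v′ (suc (v ℕ.+ N))) s v ≡ prevˢ A′ s v
        prevˢ-eq zero    v = ≡.refl
        prevˢ-eq (suc s) v = ≡.cong (A s v) (≡.sym (ℕ.+-suc v N))
        prevᵛ-eq : ∀ s v → prevᵛ (λ s′ v′ → C s′ v′ (v ℕ.+ N)) s v ≡ prevᵛ C′ s v
        prevᵛ-eq s zero    = ≡.refl
        prevᵛ-eq s (suc v) = ≡.cong (C (suc s) v) (≡.sym (ℕ.+-suc v N))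
        split-term : ∀ s v → s ℕ.+ (v ℕ.+ v) ≡ suc h → ν (suc h) * y s v (v ℕ.+ N) ≈ prevˢ A′ s v + prevᵛ C′ s v
        split-term s v e = begin
          ν (suc h) * y s v (v ℕ.+ N)              ≡⟨ ≡.cong (λ k → ν k * y s v (v ℕ.+ N)) e ⟨
          ν (s ℕ.+ (v ℕ.+ v)) * y s v (v ℕ.+ N)    ≈⟨ y-split s v (v ℕ.+ N) ⟩
          _                                        ≡⟨ ≡.cong₂ _+_ (prevˢ-eq s v) (prevᵛ-eq s v) ⟩
          prevˢ A′ s v + prevᵛ C′ s v              ∎

    -- the trinomial coefficient [s+v+w; s, v, w] in base q²
    τ : ℕ → ℕ → ℕ → Carrier
    τ s v w = S.gauss s (v ℕ.+ w) * S.gauss v w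

    -- In base q² both sides are the q-factorial of s+v+w+1 divided by those of s, v and w; that
    -- expression is symmetric in the three, which gives `τ-v` as well.
    τ-w : ∀ s v w → S.ν (suc s) * τ (suc s) v w ≈ S.ν (suc w) * τ s v (suc w)
    τ-w s v w rewrite ℕ.+-suc v w = begin
      S.ν (suc s) * (S.gauss (suc s) (v ℕ.+ w) * S.gauss v w)
        ≈⟨ trans (sym (*-assoc _ _ _)) (*-congʳ (S.ν-gauss s (v ℕ.+ w))) ⟩
      S.ν (suc (v ℕ.+ w)) * m * S.gauss v w
        ≈⟨ solve 3 (λ n g h → n :* g :* h := g :* (n :* h)) refl _ m _ ⟩
      m * (S.ν (suc (v ℕ.+ w)) * S.gauss v w)
        ≈⟨ *-congˡ (S.ν-gaussʳ v w) ⟨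
      m * (S.ν (suc w) * S.gauss v (suc w))
        ≈⟨ solve 3 (λ n g h → n :* (g :* h) := g :* (n :* h)) refl _ m _ ⟨
      S.ν (suc w) * (m * S.gauss v (suc w)) ∎
      where m = S.gauss s (suc (v ℕ.+ w))

    τ-v : ∀ s v w → S.ν (suc s) * τ (suc s) v w ≈ S.ν (suc v) * τ s (suc v) w
    τ-v s v w = begin
      S.ν (suc s) * (S.gauss (suc s) (v ℕ.+ w) * S.gauss v w)
        ≈⟨ trans (sym (*-assoc _ _ _)) (*-congʳ (S.ν-gauss s (v ℕ.+ w))) ⟩
      S.ν (suc (v ℕ.+ w)) * m * S.gauss v w
        ≈⟨ solve 3 (λ n g h → n :* g :* h := g :* (n :* h)) refl _ m _ ⟩
      m * (S.ν (suc (v ℕ.+ w)) * S.gauss v w)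
        ≈⟨ *-congˡ (S.ν-gaussˡ v w) ⟨
      m * (S.ν (suc v) * S.gauss (suc v) w)
        ≈⟨ solve 3 (λ n g h → n :* (g :* h) := g :* (n :* h)) refl _ m _ ⟨
      S.ν (suc v) * (m * S.gauss (suc v) w) ∎
      where m = S.gauss s (suc (v ℕ.+ w))

    -- (-q; q)_s
    negPoch : ℕ → Carrier
    negPoch zero    = 1#
    negPoch (suc s) = negPoch s * (1# + q ^ suc s)

    -- q^(s(s-1)/2) (-q; q)_s
    negPoch′ : ℕ → Carrier
    negPoch′ zero    = 1#
    negPoch′ (suc s) = negPoch′ s * (q ^ s * (1# + q ^ suc s))

    private
      -- Here 1 - q^(s+2v) is split as `ν s` plus q^s `ν (v + v)`. Each unit moved into or out of
      -- `s` leaves a power q^s, and these accumulate to the q^(s(s-1)/2) in `negPoch′`.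
      module Plain where
        y A C : ℕ → ℕ → ℕ → Carrier
        y s v w = negPoch′ s * τ s v w
        A s v w = q ^ s * ν (w ℕ.+ w) * y s v w
        C s v w = ν s * y s v w

        y-0 : ∀ w → y 0 0 w ≈ 1#
        y-0 w = solve 0 (con 1 :* (con 1 :* con 1) := con 1) refl

        y-join : ∀ s v w → A s v w + C s v w ≈ ν (s ℕ.+ (w ℕ.+ w)) * y s v w
        y-join s v w = begin
          q ^ s * ν (w ℕ.+ w) * y s v w + ν s * y s v w   ≈⟨ solve 4 (λ Q a b y → Q :* a :* y :+ b :* y := (b :+ Q :* a) :* y) refl (q ^ s) (ν (w ℕ.+ w)) (ν s) (y s v w) ⟩
          (ν s + q ^ s * ν (w ℕ.+ w)) * y s v w           ≈⟨ *-congʳ (ν-+ s (w ℕ.+ w)) ⟨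
          ν (s ℕ.+ (w ℕ.+ w)) * y s v w                   ∎

        part-s : ∀ s v w → ν s * y s v w ≈ prevˢ (λ s v → A s v (suc w)) s v
        part-s zero    v w = trans (*-congʳ ν-0) (zeroˡ _)
        part-s (suc s) v w = begin
          ν (suc s) * (negPoch′ s * (q ^ s * (1# + q ^ suc s)) * τ (suc s) v w)
            ≈⟨ solve 5 (λ n p Q f t → n :* (p :* (Q :* f) :* t) := p :* Q :* (f :* n :* t)) refl (ν (suc s)) (negPoch′ s) (q ^ s) (1# + q ^ suc s) (τ (suc s) v w) ⟩
          negPoch′ s * q ^ s * ((1# + q ^ suc s) * ν (suc s) * τ (suc s) v w)
            ≈⟨ *-congˡ (trans (*-congʳ (ν-factor (suc s))) (trans (τ-w s v w) (*-congʳ (ν-square (suc w))))) ⟩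
          negPoch′ s * q ^ s * (ν (suc w ℕ.+ suc w) * τ s v (suc w))
            ≈⟨ solve 4 (λ p Q n t → p :* Q :* (n :* t) := Q :* n :* (p :* t)) refl (negPoch′ s) (q ^ s) (ν (suc w ℕ.+ suc w)) (τ s v (suc w)) ⟩
          A s v (suc w) ∎

        part-v : ∀ s v w → q ^ s * ν (v ℕ.+ v) * y s v w ≈ prevᵛ (λ s v → C s v w) s v
        part-v s zero    w = trans (*-congʳ (trans (*-congˡ ν-0) (zeroʳ _))) (zeroˡ _)
        part-v s (suc v) w = begin
          q ^ s * ν (suc v ℕ.+ suc v) * (negPoch′ s * τ s (suc v) w)
            ≈⟨ solve 4 (λ p Q n t → Q :* n :* (p :* t) := p :* Q :* (n :* t)) refl (negPoch′ s) (q ^ s) (ν (suc v ℕ.+ suc v)) (τ s (suc v) w) ⟩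
          negPoch′ s * q ^ s * (ν (suc v ℕ.+ suc v) * τ s (suc v) w)
            ≈⟨ *-congˡ (trans (*-congʳ (ν-factor (suc s))) (trans (τ-v s v w) (*-congʳ (ν-square (suc v))))) ⟨
          negPoch′ s * q ^ s * ((1# + q ^ suc s) * ν (suc s) * τ (suc s) v w)
            ≈⟨ solve 5 (λ n p Q f t → n :* (p :* (Q :* f) :* t) := p :* Q :* (f :* n :* t)) refl (ν (suc s)) (negPoch′ s) (q ^ s) (1# + q ^ suc s) (τ (suc s) v w) ⟨
          C (suc s) v w ∎

        y-split : ∀ s v w → ν (s ℕ.+ (v ℕ.+ v)) * y s v w ≈ prevˢ (λ s v → A s v (suc w)) s v + prevᵛ (λ s v → C s v w) s v
        y-split s v w = begin
          ν (s ℕ.+ (v ℕ.+ v)) * y s v w                              ≈⟨ *-congʳ (ν-+ s (v ℕ.+ v)) ⟩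
          (ν s + q ^ s * ν (v ℕ.+ v)) * y s v w                      ≈⟨ distribʳ _ _ _ ⟩
          ν s * y s v w + q ^ s * ν (v ℕ.+ v) * y s v w              ≈⟨ +-cong (part-s s v w) (part-v s v w) ⟩
          prevˢ (λ s v → A s v (suc w)) s v + prevᵛ (λ s v → C s v w) s v ∎

        open Recurrence y A C y-0 y-split y-join (λ v w → trans (*-congʳ ν-0) (zeroˡ _)) public

      -- The opposite splitting, `ν (v + v)` plus q^(2v) `ν s`: the stray powers now depend on v and
      -- w, and accumulate to q^(2vw).
      module Shifted where
        y A C : ℕ → ℕ → ℕ → Carrier
        y s v w = negPoch s * (q ^ ((v ℕ.+ v) ℕ.* w) * τ s v w)
        A s v w = ν (w ℕ.+ w) * y s v w
        C s v w = q ^ (w ℕ.+ w) * ν s * y s v w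

        y-0 : ∀ w → y 0 0 w ≈ 1#
        y-0 w = solve 0 (con 1 :* (con 1 :* (con 1 :* con 1)) := con 1) refl

        y-join : ∀ s v w → A s v w + C s v w ≈ ν (s ℕ.+ (w ℕ.+ w)) * y s v w
        y-join s v w rewrite ℕ.+-comm s (w ℕ.+ w) = begin
          ν (w ℕ.+ w) * y s v w + q ^ (w ℕ.+ w) * ν s * y s v w   ≈⟨ distribʳ _ _ _ ⟨
          (ν (w ℕ.+ w) + q ^ (w ℕ.+ w) * ν s) * y s v w           ≈⟨ *-congʳ (ν-+ (w ℕ.+ w) s) ⟨
          ν (w ℕ.+ w ℕ.+ s) * y s v w                             ∎

        part-s : ∀ s v w → q ^ (v ℕ.+ v) * ν s * y s v w ≈ prevˢ (λ s v → A s v (suc w)) s v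
        part-s zero    v w = trans (*-congʳ (trans (*-congˡ ν-0) (zeroʳ _))) (zeroˡ _)
        part-s (suc s) v w = begin
          q ^ (v ℕ.+ v) * ν (suc s) * (negPoch s * (1# + q ^ suc s) * (q ^ ((v ℕ.+ v) ℕ.* w) * τ (suc s) v w))
            ≈⟨ solve 6 (λ V n p f Q t → V :* n :* (p :* f :* (Q :* t)) := p :* (V :* Q :* (f :* n :* t))) refl
                 (q ^ (v ℕ.+ v)) (ν (suc s)) (negPoch s) (1# + q ^ suc s) (q ^ ((v ℕ.+ v) ℕ.* w)) (τ (suc s) v w) ⟩
          negPoch s * (q ^ (v ℕ.+ v) * q ^ ((v ℕ.+ v) ℕ.* w) * ((1# + q ^ suc s) * ν (suc s) * τ (suc s) v w))
            ≈⟨ *-congˡ (*-cong (sym (pow (v ℕ.+ v) ((v ℕ.+ v) ℕ.* w) (≡.sym (ℕ.*-suc (v ℕ.+ v) w))))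
                 (trans (*-congʳ (ν-factor (suc s))) (trans (τ-w s v w) (*-congʳ (ν-square (suc w)))))) ⟩
          negPoch s * (q ^ ((v ℕ.+ v) ℕ.* suc w) * (ν (suc w ℕ.+ suc w) * τ s v (suc w)))
            ≈⟨ solve 4 (λ p Q n t → p :* (Q :* (n :* t)) := n :* (p :* (Q :* t))) refl (negPoch s) (q ^ ((v ℕ.+ v) ℕ.* suc w)) (ν (suc w ℕ.+ suc w)) (τ s v (suc w)) ⟩
          A s v (suc w) ∎

        part-v : ∀ s v w → ν (v ℕ.+ v) * y s v w ≈ prevᵛ (λ s v → C s v w) s v
        part-v s zero    w = trans (*-congʳ ν-0) (zeroˡ _)
        part-v s (suc v) w = begin
          ν (suc v ℕ.+ suc v) * (negPoch s * (q ^ ((suc v ℕ.+ suc v) ℕ.* w) * τ s (suc v) w))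
            ≈⟨ solve 4 (λ p Q n t → n :* (p :* (Q :* t)) := p :* (Q :* (n :* t))) refl (negPoch s) (q ^ ((suc v ℕ.+ suc v) ℕ.* w)) (ν (suc v ℕ.+ suc v)) (τ s (suc v) w) ⟩
          negPoch s * (q ^ ((suc v ℕ.+ suc v) ℕ.* w) * (ν (suc v ℕ.+ suc v) * τ s (suc v) w))
            ≈⟨ *-congˡ (*-cong (pow (w ℕ.+ w) ((v ℕ.+ v) ℕ.* w) (identity v w))
                 (sym (trans (*-congʳ (ν-factor (suc s))) (trans (τ-v s v w) (*-congʳ (ν-square (suc v))))))) ⟩
          negPoch s * (q ^ (w ℕ.+ w) * q ^ ((v ℕ.+ v) ℕ.* w) * ((1# + q ^ suc s) * ν (suc s) * τ (suc s) v w))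
            ≈⟨ solve 6 (λ V n p f Q t → V :* n :* (p :* f :* (Q :* t)) := p :* (V :* Q :* (f :* n :* t))) refl
                 (q ^ (w ℕ.+ w)) (ν (suc s)) (negPoch s) (1# + q ^ suc s) (q ^ ((v ℕ.+ v) ℕ.* w)) (τ (suc s) v w) ⟨
          C (suc s) v w ∎
          where
          identity : ∀ v w → w ℕ.+ w ℕ.+ (v ℕ.+ v) ℕ.* w ≡ (suc v ℕ.+ suc v) ℕ.* w
          identity = solve-∀

        y-split : ∀ s v w → ν (s ℕ.+ (v ℕ.+ v)) * y s v w ≈ prevˢ (λ s v → A s v (suc w)) s v + prevᵛ (λ s v → C s v w) s v
        y-split s v w = begin
          ν (s ℕ.+ (v ℕ.+ v)) * y s v w                                      ≡⟨ ≡.cong (λ k → ν k * y s v w) (ℕ.+-comm s (v ℕ.+ v)) ⟩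
          ν (v ℕ.+ v ℕ.+ s) * y s v w                                        ≈⟨ *-congʳ (ν-+ (v ℕ.+ v) s) ⟩
          (ν (v ℕ.+ v) + q ^ (v ℕ.+ v) * ν s) * y s v w                      ≈⟨ trans (distribʳ _ _ _) (+-comm _ _) ⟩
          q ^ (v ℕ.+ v) * ν s * y s v w + ν (v ℕ.+ v) * y s v w              ≈⟨ +-cong (part-s s v w) (part-v s v w) ⟩
          prevˢ (λ s v → A s v (suc w)) s v + prevᵛ (λ s v → C s v w) s v    ∎

        C-0 : ∀ v w → C 0 v w ≈ 0#
        C-0 v w = trans (*-congʳ (trans (*-congˡ ν-0) (zeroʳ _))) (zeroˡ _)

        open Recurrence y A C y-0 y-split y-join C-0 public

      -- [2r; r-x] vanishes for r < x, so r = x+v and L = 2x+h, and [2r; r-x] becomes [2v+2x; v],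
      -- the second factor of `τ` with w = v+2x. The sum is thus that of `evaluate` at N = 2x, up to
      -- the constant `κ`.
      assemble : ∀ L x (κ : Carrier) (φ : ℕ → ℕ → Carrier) (y : ℕ → ℕ → ℕ → Carrier) →
        (∀ N h → conv₂ h (λ s v → y s v (v ℕ.+ N)) ≈ gauss h (h ℕ.+ (N ℕ.+ N))) →
        (∀ s v → φ s (x ℕ.+ v) * S.gauss v (v ℕ.+ (x ℕ.+ x)) ≈ κ * y s v (v ℕ.+ (x ℕ.+ x))) →
        conv₂ L (λ s r → φ s r * S.γ (r ℕ.+ x) r x) ≈ κ * γ (L ℕ.+ (x ℕ.+ x)) L (x ℕ.+ x)
      assemble L x κ φ y evaluate term with ≤-gap (x ℕ.+ x) L
      ... | inj₁ L<2x = begin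
        conv₂ L _                                ≈⟨ conv₂-zero L vanish ⟩
        0#                                       ≈⟨ zeroʳ κ ⟨
        κ * 0#                                   ≡⟨ ≡.cong (κ *_) (γ-< (L ℕ.+ (x ℕ.+ x)) L<2x) ⟨
        κ * γ (L ℕ.+ (x ℕ.+ x)) L (x ℕ.+ x)      ∎
        where
        vanish : ∀ s r → s ℕ.+ (r ℕ.+ r) ≡ L → φ s r * S.γ (r ℕ.+ x) r x ≈ 0#
        vanish s r e with ℕ.<-≤-connex r x
        ... | inj₁ r<x rewrite S.γ-< (r ℕ.+ x) r<x = zeroʳ _
        ... | inj₂ x≤r = ⊥-elim (ℕ.<-irrefl (≡.sym e) (ℕ.<-≤-trans L<2x (ℕ.≤-trans (ℕ.+-mono-≤ x≤r x≤r) (ℕ.m≤n+m _ s))))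
      ... | inj₂ (h , ≡.refl) = begin
        conv₂ (x ℕ.+ x ℕ.+ h) (λ s r → φ s r * S.γ (r ℕ.+ x) r x)
          ≈⟨ conv₂-drop x h _ (λ s r r<x → trans (*-congˡ (reflexive (S.γ-< (r ℕ.+ x) r<x))) (zeroʳ _)) ⟩
        conv₂ h (λ s v → φ s (x ℕ.+ v) * S.γ (x ℕ.+ v ℕ.+ x) (x ℕ.+ v) x)
          ≈⟨ conv₂-cong h (λ s v _ → trans (*-congˡ (centre v)) (term s v)) ⟩
        conv₂ h (λ s v → κ * y s v (v ℕ.+ (x ℕ.+ x)))
          ≈⟨ trans (conv₂-*ˡ h κ _) (*-congˡ (evaluate (x ℕ.+ x) h)) ⟩
        κ * gauss h (h ℕ.+ (x ℕ.+ x ℕ.+ (x ℕ.+ x)))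
          ≈⟨ *-congˡ (gauss-comm h _) ⟩
        κ * gauss (h ℕ.+ (x ℕ.+ x ℕ.+ (x ℕ.+ x))) h
          ≡⟨ ≡.cong (κ *_) (γ-≡ (x ℕ.+ x) h (top x h) ≡.refl) ⟨
        κ * γ (x ℕ.+ x ℕ.+ h ℕ.+ (x ℕ.+ x)) (x ℕ.+ x ℕ.+ h) (x ℕ.+ x) ∎
        where
        top : ∀ x h → x ℕ.+ x ℕ.+ h ℕ.+ (x ℕ.+ x) ≡ h ℕ.+ (x ℕ.+ x ℕ.+ (x ℕ.+ x))
        top = solve-∀
        middle : ∀ x v → x ℕ.+ v ℕ.+ x ≡ v ℕ.+ (x ℕ.+ x)
        middle = solve-∀
        centre : ∀ v → S.γ (x ℕ.+ v ℕ.+ x) (x ℕ.+ v) x ≈ S.gauss v (v ℕ.+ (x ℕ.+ x))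
        centre v = trans (reflexive (≡.trans (S.γ-+ _ x v) (≡.cong (λ X → S.gauss X v) (middle x v)))) (S.gauss-comm _ v)

      middle′ : ∀ x v → x ℕ.+ v ℕ.+ (x ℕ.+ v) ≡ v ℕ.+ (v ℕ.+ (x ℕ.+ x))
      middle′ = solve-∀

    -- The coefficients of [2r; r-x] do not involve x, so the expansion passes through a theta
    -- series in which x is a multiple of j.
    double : ∀ L x →
      conv₂ L (λ s r → negPoch′ s * S.gauss s (r ℕ.+ r) * S.γ (r ℕ.+ x) r x) ≈ γ (L ℕ.+ (x ℕ.+ x)) L (x ℕ.+ x)
    double L x = trans (assemble L x 1# _ Plain.y Plain.evaluate term) (*-identityˡ _)
      where
      term : ∀ s v → negPoch′ s * S.gauss s (x ℕ.+ v ℕ.+ (x ℕ.+ v)) * S.gauss v (v ℕ.+ (x ℕ.+ x)) ≈ 1# * Plain.y s v (v ℕ.+ (x ℕ.+ x))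
      term s v rewrite middle′ x v = trans (*-assoc _ _ _) (sym (*-identityˡ _))

    -- With r = x+v and w = v+2x one has 2r² = 2x² + 2vw: the q^(2vw) of `Shifted` and the required
    -- q^(2x²) combine to a power free of x.
    double-shift : ∀ L x →
      conv₂ L (λ s r → negPoch s * q ^ ((r ℕ.+ r) ℕ.* r) * S.gauss s (r ℕ.+ r) * S.γ (r ℕ.+ x) r x) ≈
      q ^ ((x ℕ.+ x) ℕ.* x) * γ (L ℕ.+ (x ℕ.+ x)) L (x ℕ.+ x)
    double-shift L x = assemble L x _ _ Shifted.y Shifted.evaluate term
      where
      exponent : ∀ x v → (x ℕ.+ x) ℕ.* x ℕ.+ (v ℕ.+ v) ℕ.* (v ℕ.+ (x ℕ.+ x)) ≡ (x ℕ.+ v ℕ.+ (x ℕ.+ v)) ℕ.* (x ℕ.+ v)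
      exponent = solve-∀
      term : ∀ s v → negPoch s * q ^ ((x ℕ.+ v ℕ.+ (x ℕ.+ v)) ℕ.* (x ℕ.+ v)) * S.gauss s (x ℕ.+ v ℕ.+ (x ℕ.+ v)) * S.gauss v (v ℕ.+ (x ℕ.+ x)) ≈
        q ^ ((x ℕ.+ x) ℕ.* x) * Shifted.y s v (v ℕ.+ (x ℕ.+ x))
      term s v = begin
        negPoch s * q ^ ((x ℕ.+ v ℕ.+ (x ℕ.+ v)) ℕ.* (x ℕ.+ v)) * S.gauss s (x ℕ.+ v ℕ.+ (x ℕ.+ v)) * S.gauss v w
          ≡⟨ ≡.cong (λ k → negPoch s * q ^ ((x ℕ.+ v ℕ.+ (x ℕ.+ v)) ℕ.* (x ℕ.+ v)) * S.gauss s k * S.gauss v w) (middle′ x v) ⟩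
        negPoch s * q ^ ((x ℕ.+ v ℕ.+ (x ℕ.+ v)) ℕ.* (x ℕ.+ v)) * S.gauss s (v ℕ.+ w) * S.gauss v w
          ≈⟨ *-congʳ (*-congʳ (*-congˡ (pow ((x ℕ.+ x) ℕ.* x) ((v ℕ.+ v) ℕ.* w) (exponent x v)))) ⟩
        negPoch s * (X * V) * S.gauss s (v ℕ.+ w) * S.gauss v w
          ≈⟨ solve 5 (λ p X V g h → p :* (X :* V) :* g :* h := X :* (p :* (V :* (g :* h)))) refl (negPoch s) X V (S.gauss s (v ℕ.+ w)) (S.gauss v w) ⟩
        X * Shifted.y s v w ∎
        where
        w = v ℕ.+ (x ℕ.+ x)
        X = q ^ ((x ℕ.+ x) ℕ.* x)
        V = q ^ ((v ℕ.+ v) ℕ.* w)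

  -- Positivity: Euclid's algorithm and the induction on k

  module Positivity {p : Level} (Pos : Carrier → Set p)
    (resp : ∀ {x y} → x ≈ y → Pos x → Pos y)
    (0-pos : Pos 0#) (1-pos : Pos 1#)
    (+-pos : ∀ {x y} → Pos x → Pos y → Pos (x + y))
    (*-pos : ∀ {x y} → Pos x → Pos y → Pos (x * y)) where

    ^-pos : ∀ {x} n → Pos x → Pos (x ^ n)
    ^-pos zero    h = 1-pos
    ^-pos (suc n) h = *-pos h (^-pos n h)

    conv-pos : ∀ n {f : ℕ → ℕ → Carrier} → (∀ s t → s ℕ.+ t ≡ n → Pos (f s t)) → Pos (conv n f)
    conv-pos zero    h = h 0 0 ≡.refl
    conv-pos (suc n) h = +-pos (h 0 (suc n) ≡.refl) (conv-pos n λ s t e → h (suc s) t (≡.cong suc e))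

    conv₂-pos : ∀ n {f : ℕ → ℕ → Carrier} → (∀ s v → s ℕ.+ (v ℕ.+ v) ≡ n → Pos (f s v)) → Pos (conv₂ n f)
    conv₂-pos zero          h = h 0 0 ≡.refl
    conv₂-pos (suc zero)    h = h 1 0 ≡.refl
    conv₂-pos (suc (suc n)) h = +-pos (h (suc (suc n)) 0 (ℕ.+-identityʳ _)) (conv₂-pos n λ s v e → h s (suc v) (sum-suc {s} {v} e))

    module _ (q : Carrier) (regular : Regular q) (q-pos : Pos q) where
      open QBinomial q regular
      open Doubling q regular

      gauss-pos : ∀ a b → Pos (gauss a b)
      gauss-pos zero    b       = 1-pos
      gauss-pos (suc a) zero    = 1-pos
      gauss-pos (suc a) (suc b) = +-pos (gauss-pos a (suc b)) (*-pos (^-pos (suc a) q-pos) (gauss-pos (suc a) b))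

      γ-pos : ∀ X N s → Pos (γ X N s)
      γ-pos X N       zero    = gauss-pos X N
      γ-pos X zero    (suc s) = 0-pos
      γ-pos X (suc N) (suc s) = γ-pos X N s

      negPoch-pos : ∀ s → Pos (negPoch s)
      negPoch-pos zero    = 1-pos
      negPoch-pos (suc s) = *-pos (negPoch-pos s) (+-pos 1-pos (^-pos (suc s) q-pos))

      negPoch′-pos : ∀ s → Pos (negPoch′ s)
      negPoch′-pos zero    = 1-pos
      negPoch′-pos (suc s) = *-pos (negPoch′-pos s) (*-pos (^-pos s q-pos) (+-pos 1-pos (^-pos (suc s) q-pos)))

      -- `suc k ≡ a * b` states k = ab-1 without subtraction. N is a fixed truncation of the theta
      -- sum; it has to bound both L and M because the swap exchanges them, and the Burge transform
      -- replaces them by t and i with i + t = L.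
      PositiveP : ℕ → ℕ → Set p
      PositiveP a b = ∀ N k L M → suc k ≡ a ℕ.* b → L ℕ.≤ N → M ℕ.≤ N → Pos (P N k a b L M)

      positive-swap : ∀ {a b} → PositiveP a b → PositiveP b a
      positive-swap {a} {b} h N k L M e L≤N M≤N = resp (P-swap N k a b M L) (h N k M L (≡.trans e (ℕ.*-comm b a)) M≤N L≤N)

      sum-boundˡ : ∀ {i t L N} → i ℕ.+ t ≡ L → L ℕ.≤ N → i ℕ.≤ N
      sum-boundˡ {i} {t} ≡.refl = ℕ.≤-trans (ℕ.m≤m+n i t)

      sum-boundʳ : ∀ {i t L N} → i ℕ.+ t ≡ L → L ℕ.≤ N → t ℕ.≤ N
      sum-boundʳ {i} {t} ≡.refl = ℕ.≤-trans (ℕ.m≤n+m t i)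

      -- The p for (a+b, b) is the p for (a, b) plus b². The summand `b + a * suc b` is what
      -- `suc a * suc b` reduces to below its successor, so the induction hypothesis applies with
      -- `≡.refl`.
      exponent-split : ∀ a b k → suc k ≡ (suc a ℕ.+ suc b) ℕ.* suc b → (b ℕ.+ a ℕ.* suc b) ℕ.+ suc b ℕ.* suc b ≡ k
      exponent-split a b k e = ℕ.suc-injective (≡.trans (identity a b) (≡.sym e))
        where
        identity : ∀ a b → suc (b ℕ.+ a ℕ.* suc b ℕ.+ suc b ℕ.* suc b) ≡ (suc a ℕ.+ suc b) ℕ.* suc b
        identity = solve-∀

      positive-step : ∀ {a b} → PositiveP (suc a) (suc b) → PositiveP (suc a ℕ.+ suc b) (suc b)
      positive-step {a} {b} h N k L M e L≤N M≤N with exponent-split a b k e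
      ... | ≡.refl = resp (sym (P-burge N (b ℕ.+ a ℕ.* suc b) (suc a) (suc b) L M)) (conv-pos L λ i t i+t →
        *-pos (*-pos (^-pos (i ℕ.* i) q-pos) (γ-pos (L ℕ.+ L) M i))
              (h N _ t i ≡.refl (sum-boundʳ i+t L≤N) (sum-boundˡ i+t L≤N)))

      positive-base : PositiveP 1 1
      positive-base N zero L M e L≤N M≤N = resp (sym (begin
        P N 0 1 1 L M                       ≈⟨ theta-cong q N 0 (λ j → reflexive (≡.cong₂ (B L M) (ℕ.*-identityʳ j) (ℕ.*-identityʳ j))) ⟩
        theta q N 0 (λ j → B L M j j)       ≈⟨ theta-B N L M L≤N ⟩
        q ^ (L ℕ.* M) * gauss L M           ∎)) (*-pos (^-pos (L ℕ.* M) q-pos) (gauss-pos L M))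

      -- Euclid's algorithm on (a, b)
      positiveP : ∀ n a b → suc a ℕ.+ suc b ℕ.≤ n → Coprime (suc a) (suc b) → PositiveP (suc a) (suc b)
      positiveP (suc n) a b (ℕ.s≤s a+b≤n) coprime with ℕ.<-cmp a b
      ... | tri≈ _ ≡.refl _ with coprime-refl coprime
      ...   | ≡.refl = positive-base
      positiveP (suc n) a b (ℕ.s≤s a+b≤n) coprime | tri< a<b _ _ with ℕ.m≤n⇒∃[o]m+o≡n a<b
      ...   | o , ≡.refl = positive-swap (≡.subst (λ k → PositiveP k (suc a)) (size o a)
                (positive-step (positiveP n o a bound (Coprimality.sym (coprime-reduce 1 (≡.subst (Coprime (suc a)) (size′ o a) coprime))))))
        where
        size : ∀ o a → suc o ℕ.+ suc a ≡ suc (suc a ℕ.+ o)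
        size = solve-∀
        size′ : ∀ o a → suc (suc a ℕ.+ o) ≡ suc o ℕ.+ 1 ℕ.* suc a
        size′ = solve-∀
        bound : suc o ℕ.+ suc a ℕ.≤ n
        bound = ℕ.≤-trans (ℕ.≤-reflexive (size o a)) (ℕ.≤-trans (ℕ.m≤n+m _ a) a+b≤n)
      positiveP (suc n) a b (ℕ.s≤s a+b≤n) coprime | tri> _ _ b<a with ℕ.m≤n⇒∃[o]m+o≡n b<a
      ...   | o , ≡.refl = ≡.subst (λ k → PositiveP k (suc b)) (size o b)
                (positive-step (positiveP n o b bound (Coprimality.sym (coprime-reduce 1 (≡.subst (Coprime (suc b)) (size′ o b) (Coprimality.sym coprime))))))
        where
        size : ∀ o a → suc o ℕ.+ suc a ≡ suc (suc a ℕ.+ o)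
        size = solve-∀
        size′ : ∀ o a → suc (suc a ℕ.+ o) ≡ suc o ℕ.+ 1 ℕ.* suc a
        size′ = solve-∀
        size″ : ∀ b o → suc b ℕ.+ o ℕ.+ suc b ≡ b ℕ.+ (suc o ℕ.+ suc b)
        size″ = solve-∀
        bound : suc o ℕ.+ suc b ℕ.≤ n
        bound = ℕ.≤-trans (ℕ.m≤n+m _ b) (ℕ.≤-trans (ℕ.≤-reflexive (≡.sym (size″ b o))) a+b≤n)

      central-pos₀ : ∀ a b k N L → Coprime a b → suc k ≡ a ℕ.* b → b ℕ.≤ a → L ℕ.≤ N →
        Pos (theta q N k (λ j → γ (L ℕ.+ j ℕ.* a) L (j ℕ.* a)))
      central-pos₀ zero b k N L coprime () b≤a L≤N
      central-pos₀ (suc a) zero k N L coprime e b≤a L≤N with ≡.trans e (ℕ.*-zeroʳ (suc a))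
      ... | ()
      central-pos₀ (suc a) (suc b) k N L coprime e b≤a L≤N with ℕ.m≤n⇒m<n∨m≡n b≤a
      ... | inj₁ (ℕ.s≤s b<a) with ℕ.m≤n⇒∃[o]m+o≡n b<a
      ...   | o , ≡.refl = ≡.subst (λ a → suc k ≡ a ℕ.* suc b → Pos (theta q N k (λ j → γ (L ℕ.+ j ℕ.* a) L (j ℕ.* a)))) (size o b) result e
        where
        size : ∀ o a → suc o ℕ.+ suc a ≡ suc (suc a ℕ.+ o)
        size = solve-∀
        size′ : ∀ o a → suc (suc a ℕ.+ o) ≡ suc o ℕ.+ 1 ℕ.* suc a
        size′ = solve-∀
        result : suc k ≡ (suc o ℕ.+ suc b) ℕ.* suc b → Pos (theta q N k (λ j → γ (L ℕ.+ j ℕ.* (suc o ℕ.+ suc b)) L (j ℕ.* (suc o ℕ.+ suc b))))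
        result e with exponent-split o b k e
        ... | ≡.refl = resp (sym (P-burge-∞ N (b ℕ.+ o ℕ.* suc b) (suc o) (suc b) L)) (conv-pos L λ i t i+t →
          *-pos (^-pos (i ℕ.* i) q-pos)
                (positiveP _ o b ℕ.≤-refl (Coprimality.sym (coprime-reduce 1 (≡.subst (Coprime (suc b)) (size′ o b) (Coprimality.sym coprime))))
                   N _ t i ≡.refl (sum-boundʳ i+t L≤N) (sum-boundˡ i+t L≤N)))
      central-pos₀ (suc a) (suc b) k N L coprime e b≤a L≤N | inj₂ ≡.refl with coprime-refl coprime
      central-pos₀ (suc a) (suc b) zero N L coprime e b≤a L≤N | inj₂ ≡.refl | ≡.refl = resp (sym
        (theta-cong q N 0 λ j → reflexive (≡.cong (λ x → γ (L ℕ.+ x) L x) (ℕ.*-identityʳ j)))) (central L L≤N)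
        where
        central : ∀ L → L ℕ.≤ N → Pos (theta q N 0 (λ j → γ (L ℕ.+ j) L j))
        central zero    _   = resp (sym (trans (alt-head N _ (λ j → zeroʳ _)) (*-identityˡ 1#))) 1-pos
        central (suc L) L≤N = resp (sym (theta-central N L L≤N)) 0-pos

    -- The theta weights are in base q^(2^k), the binomials in base q. Passing from q to q² lowers k
    -- by one and leaves the base of the weights unchanged, so q is quantified inside the induction.
    central-pos : ∀ k (q : Carrier) (regular : Regular q) (q-pos : Pos q) → let open QBinomial q regular in
      ∀ a b r N L → Coprime a b → suc r ≡ a ℕ.* b → b ℕ.≤ 2 ℕ.^ k ℕ.* a → L ℕ.≤ N →
      Pos (theta (q ^ (2 ℕ.^ k)) N r (λ j → γ (L ℕ.+ j ℕ.* (2 ℕ.^ k ℕ.* a)) L (j ℕ.* (2 ℕ.^ k ℕ.* a))))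
    central-pos zero q regular q-pos a b r N L coprime e b≤a L≤N rewrite ℕ.*-identityˡ a =
      resp (theta-congQ N r _ (sym (*-identityʳ q))) (central-pos₀ q regular q-pos a b r N L coprime e b≤a L≤N)
    central-pos (suc k) q regular q-pos a b r N L coprime e b≤2ma L≤N = result
      where
      open QBinomial q regular
      open Doubling q regular
      m = 2 ℕ.^ k
      x : ℕ → ℕ
      x j = j ℕ.* (m ℕ.* a)
      twice : ∀ j → x j ℕ.+ x j ≡ j ℕ.* (2 ℕ.^ suc k ℕ.* a)
      twice j = identity j m a
        where
        identity : ∀ j m a → j ℕ.* (m ℕ.* a) ℕ.+ j ℕ.* (m ℕ.* a) ≡ j ℕ.* (2 ℕ.* m ℕ.* a)
        identity = solve-∀
      C : ℕ → Carrier
      C j = γ (L ℕ.+ j ℕ.* (2 ℕ.^ suc k ℕ.* a)) L (j ℕ.* (2 ℕ.^ suc k ℕ.* a))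
      C-twice : ∀ j → γ (L ℕ.+ (x j ℕ.+ x j)) L (x j ℕ.+ x j) ≡ C j
      C-twice j = ≡.cong (λ n → γ (L ℕ.+ n) L n) (twice j)
      base : q ^ (2 ℕ.^ suc k) ≈ (q ^ 2) ^ m
      base = sym (^-assocʳ q 2 m)
      q²-pos = ^-pos 2 q-pos
      r-bound : ∀ s v → s ℕ.+ (v ℕ.+ v) ≡ L → v ℕ.≤ N
      r-bound s v ≡.refl = ℕ.≤-trans (ℕ.≤-trans (ℕ.m≤m+n v v) (ℕ.m≤n+m (v ℕ.+ v) s)) L≤N

      result : Pos (theta (q ^ (2 ℕ.^ suc k)) N r C)
      -- The bound on b has doubled to 2ma. If b ≤ ma, the induction hypothesis applies to b itself;
      -- otherwise it applies to b - ma, which is again at most ma.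
      result with ≤-gap (suc (m ℕ.* a)) b
      ... | inj₁ b<1+ma = resp (sym (begin
        theta (q ^ (2 ℕ.^ suc k)) N r C
          ≈⟨ theta-congQ N r C base ⟩
        theta ((q ^ 2) ^ m) N r C
          ≈⟨ theta-cong _ N r (λ j → sym (trans (double L (x j)) (reflexive (C-twice j)))) ⟩
        theta ((q ^ 2) ^ m) N r (λ j → conv₂ L (λ s v → negPoch′ s * S.gauss s (v ℕ.+ v) * S.γ (v ℕ.+ x j) v (x j)))
          ≈⟨ theta-conv₂ _ N r L (λ s v → negPoch′ s * S.gauss s (v ℕ.+ v)) (λ s v j → S.γ (v ℕ.+ x j) v (x j)) ⟩
        conv₂ L (λ s v → negPoch′ s * S.gauss s (v ℕ.+ v) * theta ((q ^ 2) ^ m) N r (λ j → S.γ (v ℕ.+ x j) v (x j))) ∎))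
        (conv₂-pos L λ s v s+2v → *-pos (*-pos (negPoch′-pos q regular q-pos s) (gauss-pos (q ^ 2) (regular-square regular) q²-pos s (v ℕ.+ v)))
          (central-pos k (q ^ 2) (regular-square regular) q²-pos a b r N v coprime e (ℕ.s≤s⁻¹ b<1+ma) (r-bound s v s+2v)))
      ... | inj₂ (b′ , ≡.refl) with ℕ.m≤n⇒∃[o]m+o≡n (positive-product a b′ e)
      -- `r′` is a(b-ma) - 1, the p belonging to the reduced parameter; the subtraction is
      -- legitimate because `e` forces a to be nonzero.
      ...   | r′ , r′-eq = resp (sym (begin
        theta Q N r C
          ≡⟨ ≡.cong (λ r → theta Q N r C) r-eq ⟩
        theta Q N (r′ ℕ.+ u) C
          ≈⟨ theta-+ Q N r′ u C ⟩
        theta Q N r′ (λ j → Q ^ (u ℕ.* (j ℕ.* j)) * C j)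
          ≈⟨ theta-congQ N r′ _ base ⟩
        theta ((q ^ 2) ^ m) N r′ (λ j → Q ^ (u ℕ.* (j ℕ.* j)) * C j)
          ≈⟨ theta-cong _ N r′ (λ j → sym (trans (double-shift L (x j)) (*-cong (power j) (reflexive (C-twice j))))) ⟩
        theta ((q ^ 2) ^ m) N r′ (λ j → conv₂ L (λ s v → negPoch s * q ^ ((v ℕ.+ v) ℕ.* v) * S.gauss s (v ℕ.+ v) * S.γ (v ℕ.+ x j) v (x j)))
          ≈⟨ theta-conv₂ _ N r′ L (λ s v → negPoch s * q ^ ((v ℕ.+ v) ℕ.* v) * S.gauss s (v ℕ.+ v)) (λ s v j → S.γ (v ℕ.+ x j) v (x j)) ⟩
        conv₂ L (λ s v → negPoch s * q ^ ((v ℕ.+ v) ℕ.* v) * S.gauss s (v ℕ.+ v) * theta ((q ^ 2) ^ m) N r′ (λ j → S.γ (v ℕ.+ x j) v (x j))) ∎))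
        (conv₂-pos L λ s v s+2v → *-pos (*-pos (*-pos (negPoch-pos q regular q-pos s) (^-pos ((v ℕ.+ v) ℕ.* v) q-pos)) (gauss-pos (q ^ 2) (regular-square regular) q²-pos s (v ℕ.+ v)))
          (central-pos k (q ^ 2) (regular-square regular) q²-pos a (suc b′) r′ N v
            (coprime-reduce m (≡.subst (Coprime a) (b-eq m a b′) coprime)) r′-eq
            (ℕ.+-cancelˡ-≤ (m ℕ.* a) _ _ (≡.subst₂ ℕ._≤_ (≡.sym (ℕ.+-suc (m ℕ.* a) b′)) (two m a) b≤2ma)) (r-bound s v s+2v)))
        where
        Q = q ^ (2 ℕ.^ suc k)
        -- This is both the drop ma² in ab when b loses ma, and the exponent demanded by
        -- `double-shift`: as Q = q^(2m), Q^(u j²) = q^(2(maj)²).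
        u = m ℕ.* a ℕ.* a
        b-eq : ∀ m a b′ → suc (m ℕ.* a) ℕ.+ b′ ≡ suc b′ ℕ.+ m ℕ.* a
        b-eq = solve-∀
        two : ∀ m a → 2 ℕ.* m ℕ.* a ≡ m ℕ.* a ℕ.+ m ℕ.* a
        two = solve-∀
        r-eq : r ≡ r′ ℕ.+ u
        r-eq = ℕ.suc-injective (≡.trans e (≡.trans (identity a m b′) (≡.cong (ℕ._+ u) (≡.sym r′-eq))))
          where
          identity : ∀ a m b′ → a ℕ.* (suc (m ℕ.* a) ℕ.+ b′) ≡ a ℕ.* suc b′ ℕ.+ m ℕ.* a ℕ.* a
          identity = solve-∀
        power : ∀ j → q ^ ((x j ℕ.+ x j) ℕ.* x j) ≈ Q ^ (u ℕ.* (j ℕ.* j))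
        power j = trans (^-congʳ q (identity j m a)) (sym (^-assocʳ q (2 ℕ.^ suc k) (u ℕ.* (j ℕ.* j))))
          where
          identity : ∀ j m a → (j ℕ.* (m ℕ.* a) ℕ.+ j ℕ.* (m ℕ.* a)) ℕ.* (j ℕ.* (m ℕ.* a)) ≡ 2 ℕ.* m ℕ.* (m ℕ.* a ℕ.* a ℕ.* (j ℕ.* j))
          identity = solve-∀

-- The ring of power series

_⊕_ : PS → PS → PS
(f ⊕ g) n = f n ℤ.+ g n

⊖_ : PS → PS
(⊖ f) n = ℤ.- f n

_·_ : ℤ → PS → PS
(k · f) n = k ℤ.* f n

tail : PS → PS
tail f n = f (suc n)

Σ<-cong : ∀ n {f g : ℕ → ℤ} → (∀ i → i ℕ.< n → f i ≡ g i) → Σ< n f ≡ Σ< n g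
Σ<-cong zero    h = ≡.refl
Σ<-cong (suc n) h = ≡.cong₂ ℤ._+_ (Σ<-cong n λ i i<n → h i (ℕ.m<n⇒m<1+n i<n)) (h n ℕ.≤-refl)

Σ<-0 : ∀ n {f : ℕ → ℤ} → (∀ i → i ℕ.< n → f i ≡ + 0) → Σ< n f ≡ + 0
Σ<-0 zero    h = ≡.refl
Σ<-0 (suc n) h = ≡.cong₂ ℤ._+_ (Σ<-0 n λ i i<n → h i (ℕ.m<n⇒m<1+n i<n)) (h n ℕ.≤-refl)

Σ<-head : ∀ n (f : ℕ → ℤ) → Σ< (suc n) f ≡ f 0 ℤ.+ Σ< n (f ∘ suc)
Σ<-head zero    f = ℤ.+-comm (+ 0) (f 0)
Σ<-head (suc n) f = ≡.trans (≡.cong (ℤ._+ f (suc n)) (Σ<-head n f)) (ℤ.+-assoc (f 0) _ _)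

⊛-0 : ∀ f g → (f ⊛ g) 0 ≡ f 0 ℤ.* g 0
⊛-0 f g = ℤ.+-identityˡ _

-- Splitting off a constant coefficient gives recursions by which commutativity and associativity
-- follow by induction on the degree, without rearranging double sums.
⊛-suc : ∀ f g n → (f ⊛ g) (suc n) ≡ f 0 ℤ.* g (suc n) ℤ.+ (tail f ⊛ g) n
⊛-suc f g n = Σ<-head (suc n) _

⊛-sucʳ : ∀ f g n → (f ⊛ g) (suc n) ≡ (f ⊛ tail g) n ℤ.+ f (suc n) ℤ.* g 0
⊛-sucʳ f g n = ≡.cong₂ ℤ._+_
  (Σ<-cong (suc n) λ i i<1+n → ≡.cong (λ m → f i ℤ.* g m) (ℕ.+-∸-assoc 1 (ℕ.s≤s⁻¹ i<1+n)))
  (≡.cong (λ m → f (suc n) ℤ.* g m) (ℕ.n∸n≡0 n))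

⊛-cong : ∀ {f f′ g g′} → f ≗ f′ → g ≗ g′ → (f ⊛ g) ≗ (f′ ⊛ g′)
⊛-cong h k n = Σ<-cong (suc n) λ i _ → ≡.cong₂ ℤ._*_ (h i) (k (n ∸ i))

⊛-comm : ∀ f g → (f ⊛ g) ≗ (g ⊛ f)
⊛-comm f g zero    = ≡.trans (⊛-0 f g) (≡.trans (ℤ.*-comm (f 0) (g 0)) (≡.sym (⊛-0 g f)))
⊛-comm f g (suc n) = begin
  (f ⊛ g) (suc n)                            ≡⟨ ⊛-suc f g n ⟩
  f 0 ℤ.* g (suc n) ℤ.+ (tail f ⊛ g) n       ≡⟨ ≡.cong₂ ℤ._+_ (ℤ.*-comm (f 0) (g (suc n))) (⊛-comm (tail f) g n) ⟩
  g (suc n) ℤ.* f 0 ℤ.+ (g ⊛ tail f) n       ≡⟨ ℤ.+-comm (g (suc n) ℤ.* f 0) _ ⟩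
  (g ⊛ tail f) n ℤ.+ g (suc n) ℤ.* f 0       ≡⟨ ⊛-sucʳ g f n ⟨
  (g ⊛ f) (suc n)                            ∎
  where open ≡.≡-Reasoning

⊛-distribʳ : ∀ h f g → ((f ⊕ g) ⊛ h) ≗ ((f ⊛ h) ⊕ (g ⊛ h))
⊛-distribʳ h f g n = go (suc n)
  where
  identity : ∀ a b x y z → a ℤ.+ b ℤ.+ (x ℤ.+ y) ℤ.* z ≡ a ℤ.+ x ℤ.* z ℤ.+ (b ℤ.+ y ℤ.* z)
  identity = ℤ-solve-∀
  go : ∀ m → Σ< m (λ i → (f i ℤ.+ g i) ℤ.* h (n ∸ i)) ≡ Σ< m (λ i → f i ℤ.* h (n ∸ i)) ℤ.+ Σ< m (λ i → g i ℤ.* h (n ∸ i))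
  go zero    = ≡.refl
  go (suc m) = ≡.trans (≡.cong (ℤ._+ (f m ℤ.+ g m) ℤ.* h (n ∸ m)) (go m))
    (identity (Σ< m (λ i → f i ℤ.* h (n ∸ i))) (Σ< m (λ i → g i ℤ.* h (n ∸ i))) (f m) (g m) (h (n ∸ m)))

⊛-distribˡ : ∀ h f g → (h ⊛ (f ⊕ g)) ≗ ((h ⊛ f) ⊕ (h ⊛ g))
⊛-distribˡ h f g n = ≡.trans (⊛-comm h (f ⊕ g) n) (≡.trans (⊛-distribʳ h f g n) (≡.cong₂ ℤ._+_ (⊛-comm f h n) (⊛-comm g h n)))

⊛-scale : ∀ k f g → ((k · f) ⊛ g) ≗ (k · (f ⊛ g))
⊛-scale k f g n = go (suc n)
  where
  identity : ∀ k a x z → k ℤ.* a ℤ.+ k ℤ.* x ℤ.* z ≡ k ℤ.* (a ℤ.+ x ℤ.* z)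
  identity = ℤ-solve-∀
  go : ∀ m → Σ< m (λ i → k ℤ.* f i ℤ.* g (n ∸ i)) ≡ k ℤ.* Σ< m (λ i → f i ℤ.* g (n ∸ i))
  go zero    = ≡.sym (ℤ.*-zeroʳ k)
  go (suc m) = ≡.trans (≡.cong (ℤ._+ k ℤ.* f m ℤ.* g (n ∸ m)) (go m)) (identity k (Σ< m (λ i → f i ℤ.* g (n ∸ i))) (f m) (g (n ∸ m)))

⊛-assoc : ∀ f g h → ((f ⊛ g) ⊛ h) ≗ (f ⊛ (g ⊛ h))
⊛-assoc f g h zero = begin
  ((f ⊛ g) ⊛ h) 0               ≡⟨ ⊛-0 (f ⊛ g) h ⟩
  (f ⊛ g) 0 ℤ.* h 0             ≡⟨ ≡.cong (ℤ._* h 0) (⊛-0 f g) ⟩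
  f 0 ℤ.* g 0 ℤ.* h 0           ≡⟨ ℤ.*-assoc (f 0) (g 0) (h 0) ⟩
  f 0 ℤ.* (g 0 ℤ.* h 0)         ≡⟨ ≡.cong (f 0 ℤ.*_) (⊛-0 g h) ⟨
  f 0 ℤ.* (g ⊛ h) 0             ≡⟨ ⊛-0 f (g ⊛ h) ⟨
  (f ⊛ (g ⊛ h)) 0               ∎
  where open ≡.≡-Reasoning
⊛-assoc f g h (suc n) = begin
  ((f ⊛ g) ⊛ h) (suc n)
    ≡⟨ ⊛-suc (f ⊛ g) h n ⟩
  (f ⊛ g) 0 ℤ.* h (suc n) ℤ.+ (tail (f ⊛ g) ⊛ h) n
    ≡⟨ ≡.cong₂ ℤ._+_ (≡.cong (ℤ._* h (suc n)) (⊛-0 f g)) (≡.trans (⊛-cong {tail (f ⊛ g)} {(f 0 · tail g) ⊕ (tail f ⊛ g)} {h} {h} (⊛-suc f g) (λ _ → ≡.refl) n)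
         (≡.trans (⊛-distribʳ h (f 0 · tail g) (tail f ⊛ g) n) (≡.cong₂ ℤ._+_ (⊛-scale (f 0) (tail g) h n) (⊛-assoc (tail f) g h n)))) ⟩
  f 0 ℤ.* g 0 ℤ.* h (suc n) ℤ.+ (f 0 ℤ.* (tail g ⊛ h) n ℤ.+ (tail f ⊛ (g ⊛ h)) n)
    ≡⟨ identity (f 0) (g 0) (h (suc n)) ((tail g ⊛ h) n) ((tail f ⊛ (g ⊛ h)) n) ⟩
  f 0 ℤ.* (g 0 ℤ.* h (suc n) ℤ.+ (tail g ⊛ h) n) ℤ.+ (tail f ⊛ (g ⊛ h)) n
    ≡⟨ ≡.cong (λ z → f 0 ℤ.* z ℤ.+ (tail f ⊛ (g ⊛ h)) n) (⊛-suc g h n) ⟨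
  f 0 ℤ.* (g ⊛ h) (suc n) ℤ.+ (tail f ⊛ (g ⊛ h)) n
    ≡⟨ ⊛-suc f (g ⊛ h) n ⟨
  (f ⊛ (g ⊛ h)) (suc n) ∎
  where
  open ≡.≡-Reasoning
  identity : ∀ x y z u v → x ℤ.* y ℤ.* z ℤ.+ (x ℤ.* u ℤ.+ v) ≡ x ℤ.* (y ℤ.* z ℤ.+ u) ℤ.+ v
  identity = ℤ-solve-∀

⊛-zeroˡ : ∀ f n → (zeroPS ⊛ f) n ≡ + 0
⊛-zeroˡ f n = Σ<-0 (suc n) λ i _ → ℤ.*-zeroˡ (f (n ∸ i))

⊛-identityˡ : ∀ f → (onePS ⊛ f) ≗ f
⊛-identityˡ f zero    = ≡.trans (⊛-0 onePS f) (ℤ.*-identityˡ (f 0))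
⊛-identityˡ f (suc n) = ≡.trans (⊛-suc onePS f n) (≡.trans (≡.cong₂ ℤ._+_ (ℤ.*-identityˡ (f (suc n))) (⊛-zeroˡ f n)) (ℤ.+-identityʳ _))

-- Opaque, so that the factors of a product remain visible to unification.
opaque
  _⊠_ : PS → PS → PS
  _⊠_ = _⊛_

  ⊠≡⊛ : ∀ f g → f ⊠ g ≡ f ⊛ g
  ⊠≡⊛ f g = ≡.refl

  PS-isCommutativeRing : IsCommutativeRing _≗_ _⊕_ _⊠_ ⊖_ zeroPS onePS
  PS-isCommutativeRing = record
    { isRing = record
      { +-isAbelianGroup = record
        { isGroup = record
          { isMonoid = record
            { isSemigroup = record
              { isMagma = record
                { isEquivalence = record { refl = λ _ → ≡.refl ; sym = λ h n → ≡.sym (h n) ; trans = λ h k n → ≡.trans (h n) (k n) }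
                ; ∙-cong = λ h k n → ≡.cong₂ ℤ._+_ (h n) (k n) }
              ; assoc = λ f g h n → ℤ.+-assoc (f n) (g n) (h n) }
            ; identity = (λ f n → ℤ.+-identityˡ (f n)) , (λ f n → ℤ.+-identityʳ (f n)) }
          ; inverse = (λ f n → ℤ.+-inverseˡ (f n)) , (λ f n → ℤ.+-inverseʳ (f n))
          ; ⁻¹-cong = λ h n → ≡.cong ℤ.-_ (h n) }
        ; comm = λ f g n → ℤ.+-comm (f n) (g n) }
      ; *-cong = ⊛-cong
      ; *-assoc = ⊛-assoc
      ; *-identity = ⊛-identityˡ , (λ f n → ≡.trans (⊛-comm f onePS n) (⊛-identityˡ f n))
      ; distrib = ⊛-distribˡ , ⊛-distribʳ }
    ; *-comm = ⊛-comm }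

PS-ring : CommutativeRing 0ℓ 0ℓ
PS-ring = record { isCommutativeRing = PS-isCommutativeRing }

-- The series of the statement as elements of the ring

module Coefficients where
  open CommutativeRing PS-ring hiding (zero)
  open import Algebra.Properties.Ring ring using (-‿distribˡ-*)
  open import Algebra.Properties.Semiring.Exp semiring using (_^_)
  open import Algebra.Solver.Ring.NaturalCoefficients.Default commutativeSemiring
  open import Relation.Binary.Reasoning.Setoid setoid
  open QSeries PS-ring

  ⊛≈* : ∀ f g → f ⊛ g ≈ f * g
  ⊛≈* f g n = ≡.cong (λ h → h n) (≡.sym (⊠≡⊛ f g))

  X : PS
  X zero          = + 0
  X (suc zero)    = + 1
  X (suc (suc _)) = + 0

  X*-0 : ∀ f → (X * f) 0 ≡ + 0
  X*-0 f rewrite ⊠≡⊛ X f = ⊛-0 X f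

  X*-suc : ∀ f n → (X * f) (suc n) ≡ f n
  X*-suc f n rewrite ⊠≡⊛ X f = ≡.trans (⊛-suc X f n) (≡.trans (ℤ.+-identityˡ _)
    (≡.trans (⊛-cong {tail X} {onePS} {f} {f} (λ { zero → ≡.refl ; (suc _) → ≡.refl }) (λ _ → ≡.refl) n) (⊛-identityˡ f n)))

  shift-suc : ∀ e f n → shift (suc e) f (suc n) ≡ shift e f n
  shift-suc zero    f n = ≡.refl
  shift-suc (suc e) f n = ≡.refl

  shift-X^ : ∀ e f → shift e f ≗ X ^ e * f
  shift-X^ zero    f n       = ≡.sym (*-identityˡ f n)
  shift-X^ (suc e) f zero    = ≡.sym (≡.trans (*-assoc X (X ^ e) f 0) (X*-0 (X ^ e * f)))
  shift-X^ (suc e) f (suc n) = ≡.trans (shift-suc e f n) (≡.trans (shift-X^ e f n)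
    (≡.sym (≡.trans (*-assoc X (X ^ e) f (suc n)) (X*-suc (X ^ e * f) n))))

  X^-coefficient : ∀ i n → (X ^ i) n ≡ (if n ≡ᵇ i then + 1 else + 0)
  X^-coefficient zero    zero    = ≡.refl
  X^-coefficient zero    (suc n) = ≡.refl
  X^-coefficient (suc i) zero    = X*-0 (X ^ i)
  X^-coefficient (suc i) (suc n) = ≡.trans (X*-suc (X ^ i) n) (X^-coefficient i n)

  oneMinusQ^≈ : ∀ i → oneMinusQ^ i ≈ 1# - X ^ i
  oneMinusQ^≈ i n = ≡.cong₂ ℤ._-_ (≡.sym (X^-coefficient 0 n)) (≡.sym (X^-coefficient i n))

  -- The coefficients of `geomInv i` have period i+1, so subtracting the shift by i+1 cancels all of
  -- them except those below i+1, which are the coefficients of 1.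
  geomInv-inverse : ∀ i → geomInv i * (1# - X ^ suc i) ≈ 1#
  geomInv-inverse i = begin
    geomInv i * (1# - X ^ suc i)                   ≈⟨ *-comm _ _ ⟩
    (1# - X ^ suc i) * geomInv i                   ≈⟨ distribʳ _ _ _ ⟩
    1# * geomInv i + - (X ^ suc i) * geomInv i     ≈⟨ +-cong (*-identityˡ _) (trans (sym (-‿distribˡ-* _ _)) (-‿cong (sym (shift-X^ (suc i) (geomInv i))))) ⟩
    geomInv i - shift (suc i) (geomInv i)          ≈⟨ coefficients ⟩
    1#                                             ∎
    where
    coefficients : (geomInv i - shift (suc i) (geomInv i)) ≗ 1#
    coefficients n with ≤-gap (suc i) n
    ... | inj₁ n<1+i rewrite ℕ.m<n⇒m%n≡m n<1+i = ≡.trans (≡.cong (λ z → δ ℤ.+ ℤ.- z) (shift-< n n<1+i)) (≡.trans (ℤ.+-identityʳ δ) (≡.sym (δ-eq n)))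
      where
      δ = if n ≡ᵇ 0 then + 1 else + 0
      δ-eq : ∀ n → onePS n ≡ (if n ≡ᵇ 0 then + 1 else + 0)
      δ-eq zero    = ≡.refl
      δ-eq (suc n) = ≡.refl
      shift-< : ∀ n → n ℕ.< suc i → shift (suc i) (geomInv i) n ≡ + 0
      shift-< n n<1+i with suc i ≤ᵇ n in eq
      ... | false = ≡.refl
      ... | true  = ⊥-elim (ℕ.<⇒≱ n<1+i (ℕ.≤ᵇ⇒≤ (suc i) n (≡.subst Bool.T (≡.sym eq) tt)))
    ... | inj₂ (m , ≡.refl) = ≡.trans (≡.cong₂ (λ y z → y ℤ.- z) (≡.cong value (≡.trans (≡.cong (ℕ._% suc i) (ℕ.+-comm (suc i) m)) (ℕ.[m+n]%n≡m%n m (suc i)))) (shift-+ (suc i) m)) (ℤ.+-inverseʳ (geomInv i m))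
      where
      value : ℕ → ℤ
      value r = if r ≡ᵇ 0 then + 1 else + 0
      shift-+ : ∀ e m → shift e (geomInv i) (e ℕ.+ m) ≡ geomInv i m
      shift-+ zero    m = ≡.refl
      shift-+ (suc e) m = ≡.trans (shift-suc e (geomInv i) (e ℕ.+ m)) (shift-+ e m)

  X-regular : Regular X
  X-regular n {x} {y} e = begin
    x                                       ≈⟨ expand x ⟩
    geomInv n * ((1# - X ^ suc n) * x)      ≈⟨ *-congˡ e ⟩
    geomInv n * ((1# - X ^ suc n) * y)      ≈⟨ expand y ⟨
    y                                       ∎
    where
    expand : ∀ z → z ≈ geomInv n * ((1# - X ^ suc n) * z)
    expand z = begin
      z                                     ≈⟨ *-identityˡ z ⟨
      1# * z                                ≈⟨ *-congʳ (geomInv-inverse n) ⟨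
      geomInv n * (1# - X ^ suc n) * z      ≈⟨ *-assoc _ _ _ ⟩
      geomInv n * ((1# - X ^ suc n) * z)    ∎

  open QBinomial X X-regular

  qPoch≈fact : ∀ n → qPoch n ≈ fact n
  qPoch≈fact zero    = refl
  qPoch≈fact (suc n) = trans (⊛≈* (qPoch n) (oneMinusQ^ (suc n))) (*-cong (qPoch≈fact n) (oneMinusQ^≈ (suc n)))

  qPochInv-inverse : ∀ n → qPochInv n * fact n ≈ 1#
  qPochInv-inverse zero    = *-identityˡ 1#
  qPochInv-inverse (suc n) = begin
    qPochInv (suc n) * (fact n * ν (suc n))          ≈⟨ *-congʳ (⊛≈* (qPochInv n) (geomInv n)) ⟩
    qPochInv n * geomInv n * (fact n * ν (suc n))    ≈⟨ solve 4 (λ a b c d → a :* b :* (c :* d) := a :* c :* (b :* d)) refl (qPochInv n) (geomInv n) (fact n) (ν (suc n)) ⟩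
    qPochInv n * fact n * (geomInv n * ν (suc n))    ≈⟨ *-cong (qPochInv-inverse n) (geomInv-inverse n) ⟩
    1# * 1#                                          ≈⟨ *-identityˡ 1# ⟩
    1#                                               ∎

  qBinom-gauss : ∀ m d → qBinom (m ℕ.+ d) (+ m) ≈ gauss m d
  qBinom-gauss m d with m ≤ᵇ m ℕ.+ d | ℕ.≤⇒≤ᵇ (ℕ.m≤m+n m d)
  ... | true | _ rewrite ℕ.m+n∸m≡n m d = begin
    qPoch (m ℕ.+ d) ⊛ qPochInv m ⊛ qPochInv d
      ≈⟨ trans (⊛≈* (qPoch (m ℕ.+ d) ⊛ qPochInv m) (qPochInv d)) (*-congʳ (⊛≈* (qPoch (m ℕ.+ d)) (qPochInv m))) ⟩
    qPoch (m ℕ.+ d) * qPochInv m * qPochInv d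
      ≈⟨ *-congʳ (*-congʳ (trans (qPoch≈fact (m ℕ.+ d)) (sym (gauss-fact m d)))) ⟩
    gauss m d * (fact m * fact d) * qPochInv m * qPochInv d
      ≈⟨ solve 5 (λ g a b c d → g :* (a :* b) :* c :* d := g :* (c :* a :* (d :* b))) refl (gauss m d) (fact m) (fact d) (qPochInv m) (qPochInv d) ⟩
    gauss m d * (qPochInv m * fact m * (qPochInv d * fact d))
      ≈⟨ *-congˡ (*-cong (qPochInv-inverse m) (qPochInv-inverse d)) ⟩
    gauss m d * (1# * 1#)
      ≈⟨ solve 1 (λ g → g :* (con 1 :* con 1) := g) refl (gauss m d) ⟩
    gauss m d ∎

  qBinom-> : ∀ n m → n ℕ.< m → qBinom n (+ m) ≈ 0#
  qBinom-> n m n<m with m ≤ᵇ n in eq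
  ... | false = refl
  ... | true  = ⊥-elim (ℕ.<⇒≱ n<m (ℕ.≤ᵇ⇒≤ m n (≡.subst Bool.T (≡.sym eq) tt)))

  twice-+ : ∀ x d → 2 ℕ.* (x ℕ.+ d) ≡ x ℕ.+ d ℕ.+ x ℕ.+ d
  twice-+ = solve-∀

  twice-+′ : ∀ x d → 2 ℕ.* (x ℕ.+ d) ≡ d ℕ.+ (x ℕ.+ d ℕ.+ x)
  twice-+′ = solve-∀

  qBinom-right : ∀ L x → qBinom (2 ℕ.* L) (+ (L ℕ.+ x)) ≈ γ (L ℕ.+ x) L x
  qBinom-right L x with ≤-gap x L
  ... | inj₁ L<x rewrite γ-< (L ℕ.+ x) L<x = qBinom-> _ _ (≡.subst (ℕ._< L ℕ.+ x) (≡.cong (L ℕ.+_) (≡.sym (ℕ.+-identityʳ L))) (ℕ.+-monoʳ-< L L<x))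
  ... | inj₂ (d , ≡.refl) rewrite γ-+ (x ℕ.+ d ℕ.+ x) x d | twice-+ x d = qBinom-gauss (x ℕ.+ d ℕ.+ x) d

  qBinom-left : ∀ L x → qBinom (2 ℕ.* L) (+ L ℤ.- + x) ≈ γ (L ℕ.+ x) L x
  qBinom-left L x with ≤-gap x L
  ... | inj₁ L<x rewrite γ-< (L ℕ.+ x) L<x | ℤ.m-n≡m⊖n L x | ℤ.⊖-< L<x = negative (ℕ.m<n⇒0<n∸m L<x)
    where
    negative : ∀ {y} → 0 ℕ.< y → qBinom (2 ℕ.* L) (ℤ.- + y) ≈ 0#
    negative {suc y} _ = refl
  ... | inj₂ (d , ≡.refl) rewrite γ-+ (x ℕ.+ d ℕ.+ x) x d | ℤ.m-n≡m⊖n (x ℕ.+ d) x | ℤ.⊖-≥ (ℕ.m≤m+n x d) | ℕ.m+n∸m≡n x d | twice-+′ x d =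
    trans (qBinom-gauss d (x ℕ.+ d ℕ.+ x)) (gauss-comm d _)

-- The degree bound belongs to the predicate, so that being a polynomial is carried through the
-- positivity induction together with nonnegativity.
NonNegPoly : PS → Set
NonNegPoly f = Σ ℕ λ D → ((n : ℕ) → D ℕ.< n → f n ≡ + 0) × ((n : ℕ) → + 0 ℤ.≤ f n)

*-nonNeg : ∀ {x y} → + 0 ℤ.≤ x → + 0 ℤ.≤ y → + 0 ℤ.≤ x ℤ.* y
*-nonNeg {+ m} {+ n} _ _ = ≡.subst (+ 0 ℤ.≤_) (ℤ.pos-* m n) (ℤ.+≤+ ℕ.z≤n)

Σ<-nonNeg : ∀ n {f : ℕ → ℤ} → (∀ i → + 0 ℤ.≤ f i) → + 0 ℤ.≤ Σ< n f
Σ<-nonNeg zero    h = ℤ.≤-refl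
Σ<-nonNeg (suc n) h = ℤ.+-mono-≤ (Σ<-nonNeg n h) (h n)

nonNegPoly-resp : ∀ {f g} → f ≗ g → NonNegPoly f → NonNegPoly g
nonNegPoly-resp f≗g (D , vanish , nonNeg) =
  D , (λ n D<n → ≡.trans (≡.sym (f≗g n)) (vanish n D<n)) , (λ n → ≡.subst (+ 0 ℤ.≤_) (f≗g n) (nonNeg n))

nonNegPoly-0 : NonNegPoly zeroPS
nonNegPoly-0 = 0 , (λ _ _ → ≡.refl) , (λ _ → ℤ.≤-refl)

nonNegPoly-1 : NonNegPoly onePS
nonNegPoly-1 = 0 , (λ { (suc n) _ → ≡.refl }) , (λ { zero → ℤ.+≤+ ℕ.z≤n ; (suc n) → ℤ.≤-refl })

nonNegPoly-+ : ∀ {f g} → NonNegPoly f → NonNegPoly g → NonNegPoly (f ⊕ g)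
nonNegPoly-+ (D , vanish , nonNeg) (D′ , vanish′ , nonNeg′) =
  D ℕ.+ D′ ,
  (λ n D+D′<n → ≡.cong₂ ℤ._+_ (vanish n (ℕ.≤-<-trans (ℕ.m≤m+n D D′) D+D′<n)) (vanish′ n (ℕ.≤-<-trans (ℕ.m≤n+m D′ D) D+D′<n))) ,
  (λ n → ℤ.+-mono-≤ (nonNeg n) (nonNeg′ n))

nonNegPoly-⊛ : ∀ {f g} → NonNegPoly f → NonNegPoly g → NonNegPoly (f ⊛ g)
nonNegPoly-⊛ {f} {g} (D , vanish , nonNeg) (D′ , vanish′ , nonNeg′) =
  D ℕ.+ D′ ,
  (λ n D+D′<n → Σ<-0 (suc n) λ i _ → term n i D+D′<n) ,
  (λ n → Σ<-nonNeg (suc n) λ i → *-nonNeg (nonNeg i) (nonNeg′ (n ∸ i)))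
  where
  term : ∀ n i → D ℕ.+ D′ ℕ.< n → f i ℤ.* g (n ∸ i) ≡ + 0
  term n i D+D′<n with ℕ.<-≤-connex D i
  ... | inj₁ D<i rewrite vanish i D<i = ℤ.*-zeroˡ (g (n ∸ i))
  ... | inj₂ i≤D rewrite vanish′ (n ∸ i) (ℕ.m+n≤o⇒m≤o∸n (suc D′) (ℕ.≤-trans (ℕ.s≤s (ℕ.≤-trans (ℕ.+-monoʳ-≤ D′ i≤D) (ℕ.≤-reflexive (ℕ.+-comm D′ D)))) D+D′<n)) = ℤ.*-zeroʳ (f i)

nonNegPoly-* : ∀ {f g} → NonNegPoly f → NonNegPoly g → NonNegPoly (f ⊠ g)
nonNegPoly-* {f} {g} hf hg rewrite ⊠≡⊛ f g = nonNegPoly-⊛ hf hg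

-- Symmetric sums as alternating sums

sign : ℕ → ℤ
sign j = (ℤ.- + 1) ℤ.^ j

sign-suc : ∀ j x → sign (suc j) ℤ.* x ≡ ℤ.- (sign j ℤ.* x)
sign-suc j x = ≡.trans (ℤ.*-assoc (ℤ.- + 1) (sign j) x) (ℤ.-1*i≡-i (sign j ℤ.* x))

-- Σ_{|j| ≤ L} h j
Σ± : ℕ → (ℤ → ℤ) → ℤ
Σ± zero    h = h (+ 0)
Σ± (suc L) h = Σ± L h ℤ.+ (h (+ suc L) ℤ.+ h -[1+ L ])

-- Going from L to L+1 adds one term at each end. Peeling off the lower one shifts the index by one,
-- which compensates for the new centre.
Σ<-centred : ∀ L (h : ℤ → ℤ) → Σ< (suc (2 ℕ.* L)) (λ i → h (+ i ℤ.- + L)) ≡ Σ± L h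
Σ<-centred zero    h = ℤ.+-identityˡ (h (+ 0))
Σ<-centred (suc L) h rewrite ℕ.+-suc L (L ℕ.+ 0) = begin
  Σ< (2 ℕ.+ 2 ℕ.* L) f ℤ.+ f (2 ℕ.+ 2 ℕ.* L)
    ≡⟨ ≡.cong (ℤ._+ f (2 ℕ.+ 2 ℕ.* L)) (Σ<-head (suc (2 ℕ.* L)) f) ⟩
  h -[1+ L ] ℤ.+ Σ< (suc (2 ℕ.* L)) (λ i → f (suc i)) ℤ.+ f (2 ℕ.+ 2 ℕ.* L)
    ≡⟨ ≡.cong₂ (λ x y → h -[1+ L ] ℤ.+ x ℤ.+ y)
         (≡.trans (Σ<-cong (suc (2 ℕ.* L)) (λ i _ → ≡.cong h (lower i))) (Σ<-centred L h)) (≡.cong h top) ⟩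
  h -[1+ L ] ℤ.+ Σ± L h ℤ.+ h (+ suc L)
    ≡⟨ rearrange (h -[1+ L ]) (Σ± L h) (h (+ suc L)) ⟩
  Σ± L h ℤ.+ (h (+ suc L) ℤ.+ h -[1+ L ]) ∎
  where
  open ≡.≡-Reasoning
  f : ℕ → ℤ
  f i = h (+ i ℤ.- + suc L)
  lower : ∀ i → + suc i ℤ.- + suc L ≡ + i ℤ.- + L
  lower i = ≡.trans (ℤ.[1+m]⊖[1+n]≡m⊖n i L) (≡.sym (ℤ.m-n≡m⊖n i L))
  size : ∀ L → 2 ℕ.+ 2 ℕ.* L ≡ suc L ℕ.+ suc L
  size = solve-∀
  top : + (2 ℕ.+ 2 ℕ.* L) ℤ.- + suc L ≡ + suc L
  top = ≡.trans (≡.cong (λ z → + z ℤ.- + suc L) (size L)) (≡.trans (ℤ.+-assoc (+ suc L) (+ suc L) (ℤ.- + suc L)) (≡.trans (≡.cong (ℤ._+_ (+ suc L)) (ℤ.+-inverseʳ (+ suc L))) (ℤ.+-identityʳ (+ suc L))))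
  rearrange : ∀ x y z → x ℤ.+ y ℤ.+ z ≡ y ℤ.+ (z ℤ.+ x)
  rearrange = ℤ-solve-∀

open QSeries PS-ring using (alt; weight)

-- `alt` unfolds at j = 0 and `Σ±` at the largest |j|; this lets them be compared by induction.
alt-last : ∀ N f n → alt (suc N) f n ≡ alt N f n ℤ.+ sign (suc N) ℤ.* f (suc N) n
alt-last zero    f n = ≡.cong (ℤ._+_ (f 0 n)) (≡.sym (ℤ.-1*i≡-i (f 1 n)))
alt-last (suc N) f n = begin
  f 0 n ℤ.- alt (suc N) (λ j → f (suc j)) n
    ≡⟨ ≡.cong (λ z → f 0 n ℤ.- z) (alt-last N (λ j → f (suc j)) n) ⟩
  f 0 n ℤ.- (alt N (λ j → f (suc j)) n ℤ.+ sign (suc N) ℤ.* x)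
    ≡⟨ rearrange (f 0 n) (alt N (λ j → f (suc j)) n) (sign (suc N) ℤ.* x) ⟩
  f 0 n ℤ.- alt N (λ j → f (suc j)) n ℤ.+ ℤ.- (sign (suc N) ℤ.* x)
    ≡⟨ ≡.cong (ℤ._+_ (f 0 n ℤ.- alt N (λ j → f (suc j)) n)) (sign-suc (suc N) x) ⟨
  f 0 n ℤ.- alt N (λ j → f (suc j)) n ℤ.+ sign (suc (suc N)) ℤ.* x ∎
  where
  open ≡.≡-Reasoning
  x = f (suc (suc N)) n
  rearrange : ∀ a b c → a ℤ.- (b ℤ.+ c) ≡ a ℤ.- b ℤ.+ ℤ.- c
  rearrange = ℤ-solve-∀

Σ±≡alt : ∀ N h w n → h (+ 0) ≡ w 0 n →
  (∀ j → h (+ suc j) ℤ.+ h -[1+ j ] ≡ sign (suc j) ℤ.* w (suc j) n) → Σ± N h ≡ alt N w n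
Σ±≡alt zero    h w n e e± = e
Σ±≡alt (suc N) h w n e e± = ≡.trans (≡.cong₂ ℤ._+_ (Σ±≡alt N h w n e e±) (e± N)) (≡.sym (alt-last N w n))

-- The exponents

2*tri : ∀ j → + 2 ℤ.* + tri j ≡ + j ℤ.* (+ 1 ℤ.+ + j)
2*tri zero    = ≡.refl
2*tri (suc j) = begin
  + 2 ℤ.* (+ 1 ℤ.+ + j ℤ.+ + tri j)                   ≡⟨ ℤ.*-distribˡ-+ (+ 2) (+ 1 ℤ.+ + j) (+ tri j) ⟩
  + 2 ℤ.* (+ 1 ℤ.+ + j) ℤ.+ + 2 ℤ.* + tri j           ≡⟨ ≡.cong (ℤ._+_ (+ 2 ℤ.* (+ 1 ℤ.+ + j))) (2*tri j) ⟩
  + 2 ℤ.* (+ 1 ℤ.+ + j) ℤ.+ + j ℤ.* (+ 1 ℤ.+ + j)     ≡⟨ identity (+ j) ⟩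
  (+ 1 ℤ.+ + j) ℤ.* (+ 1 ℤ.+ (+ 1 ℤ.+ + j))           ∎
  where
  open ≡.≡-Reasoning
  identity : ∀ j → + 2 ℤ.* (+ 1 ℤ.+ j) ℤ.+ j ℤ.* (+ 1 ℤ.+ j) ≡ (+ 1 ℤ.+ j) ℤ.* (+ 1 ℤ.+ (+ 1 ℤ.+ j))
  identity = ℤ-solve-∀

halve : ∀ n → ℤ.∣ (+ n ℤ.* + 2) ℤ./ + 2 ∣ ≡ n
halve n rewrite ≡.sym (ℤ.pos-* n 2) | ℤ.*-identityˡ (+ (n ℕ.* 2 ℕ./ 2)) = ℕ.m*n/n≡m n 2

module _ (k a b r : ℕ) (e : suc r ≡ a ℕ.* b) where
  private
    m = 2 ℕ.^ k

    coefficient : + 2 ℤ.* + a ℤ.* + b ≡ + 2 ℤ.* (+ 1 ℤ.+ + r)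
    coefficient = ≡.trans (ℤ.*-assoc (+ 2) (+ a) (+ b)) (≡.cong (+ 2 ℤ.*_) (≡.trans (≡.sym (ℤ.pos-* a b)) (≡.cong +_ (≡.sym e))))

    value : ∀ j t → + m ℤ.* (+ r ℤ.* ((+ 1 ℤ.+ + j) ℤ.* (+ 1 ℤ.+ + j)) ℤ.+ + t) ≡ + (m ℕ.* (r ℕ.* (suc j ℕ.* suc j) ℕ.+ t))
    value j t = ≡.sym (≡.trans (ℤ.pos-* m _) (≡.cong (λ z → + m ℤ.* (z ℤ.+ + t)) (≡.trans (ℤ.pos-* r _) (≡.cong (+ r ℤ.*_) (ℤ.pos-* (suc j) (suc j))))))

  expo-0 : ℤ.∣ expo k (+ a) (+ b) (+ 0) ∣ ≡ 0
  expo-0 rewrite ℤ.*-zeroʳ (+ m) = ≡.refl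

  -- With r = ab-1 and J = j+1 the exponent is 2^k (r J² + J(J-1)/2), and J(J-1)/2 is `tri j`; for
  -- -J it is J(J+1)/2, hence `tri (suc j)` in `expo--`. Writing the numerator as an explicit
  -- multiple of 2 makes the integer division exact.
  expo-+ : ∀ j → ℤ.∣ expo k (+ a) (+ b) (+ suc j) ∣ ≡ m ℕ.* (r ℕ.* (suc j ℕ.* suc j) ℕ.+ tri j)
  expo-+ j rewrite coefficient = ≡.trans (≡.cong (λ z → ℤ.∣ z ℤ./ + 2 ∣) (begin
    + m ℤ.* (+ 1 ℤ.+ + j) ℤ.* ((+ 2 ℤ.* (+ 1 ℤ.+ + r) ℤ.- + 1) ℤ.* (+ 1 ℤ.+ + j) ℤ.- + 1)
      ≡⟨ expand (+ m) (+ r) (+ j) ⟩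
    + m ℤ.* (+ 2 ℤ.* (+ r ℤ.* ((+ 1 ℤ.+ + j) ℤ.* (+ 1 ℤ.+ + j))) ℤ.+ + j ℤ.* (+ 1 ℤ.+ + j))
      ≡⟨ ≡.cong (λ z → + m ℤ.* (+ 2 ℤ.* (+ r ℤ.* ((+ 1 ℤ.+ + j) ℤ.* (+ 1 ℤ.+ + j))) ℤ.+ z)) (2*tri j) ⟨
    + m ℤ.* (+ 2 ℤ.* (+ r ℤ.* ((+ 1 ℤ.+ + j) ℤ.* (+ 1 ℤ.+ + j))) ℤ.+ + 2 ℤ.* + tri j)
      ≡⟨ factor (+ m) (+ r ℤ.* ((+ 1 ℤ.+ + j) ℤ.* (+ 1 ℤ.+ + j))) (+ tri j) ⟩
    + m ℤ.* (+ r ℤ.* ((+ 1 ℤ.+ + j) ℤ.* (+ 1 ℤ.+ + j)) ℤ.+ + tri j) ℤ.* + 2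
      ≡⟨ ≡.cong (ℤ._* + 2) (value j (tri j)) ⟩
    + (m ℕ.* (r ℕ.* (suc j ℕ.* suc j) ℕ.+ tri j)) ℤ.* + 2 ∎)) (halve _)
    where
    open ≡.≡-Reasoning
    expand : ∀ m r j → m ℤ.* (+ 1 ℤ.+ j) ℤ.* ((+ 2 ℤ.* (+ 1 ℤ.+ r) ℤ.- + 1) ℤ.* (+ 1 ℤ.+ j) ℤ.- + 1) ≡
      m ℤ.* (+ 2 ℤ.* (r ℤ.* ((+ 1 ℤ.+ j) ℤ.* (+ 1 ℤ.+ j))) ℤ.+ j ℤ.* (+ 1 ℤ.+ j))
    expand = ℤ-solve-∀
    factor : ∀ m x t → m ℤ.* (+ 2 ℤ.* x ℤ.+ + 2 ℤ.* t) ≡ m ℤ.* (x ℤ.+ t) ℤ.* + 2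
    factor = ℤ-solve-∀

  expo-- : ∀ j → ℤ.∣ expo k (+ a) (+ b) -[1+ j ] ∣ ≡ m ℕ.* (r ℕ.* (suc j ℕ.* suc j) ℕ.+ tri (suc j))
  expo-- j rewrite coefficient = ≡.trans (≡.cong (λ z → ℤ.∣ z ℤ./ + 2 ∣) (begin
    + m ℤ.* ℤ.- (+ 1 ℤ.+ + j) ℤ.* ((+ 2 ℤ.* (+ 1 ℤ.+ + r) ℤ.- + 1) ℤ.* ℤ.- (+ 1 ℤ.+ + j) ℤ.- + 1)
      ≡⟨ expand (+ m) (+ r) (+ j) ⟩
    + m ℤ.* (+ 2 ℤ.* (+ r ℤ.* ((+ 1 ℤ.+ + j) ℤ.* (+ 1 ℤ.+ + j))) ℤ.+ (+ 1 ℤ.+ + j) ℤ.* (+ 1 ℤ.+ (+ 1 ℤ.+ + j)))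
      ≡⟨ ≡.cong (λ z → + m ℤ.* (+ 2 ℤ.* (+ r ℤ.* ((+ 1 ℤ.+ + j) ℤ.* (+ 1 ℤ.+ + j))) ℤ.+ z)) (2*tri (suc j)) ⟨
    + m ℤ.* (+ 2 ℤ.* (+ r ℤ.* ((+ 1 ℤ.+ + j) ℤ.* (+ 1 ℤ.+ + j))) ℤ.+ + 2 ℤ.* + tri (suc j))
      ≡⟨ factor (+ m) (+ r ℤ.* ((+ 1 ℤ.+ + j) ℤ.* (+ 1 ℤ.+ + j))) (+ tri (suc j)) ⟩
    + m ℤ.* (+ r ℤ.* ((+ 1 ℤ.+ + j) ℤ.* (+ 1 ℤ.+ + j)) ℤ.+ + tri (suc j)) ℤ.* + 2
      ≡⟨ ≡.cong (ℤ._* + 2) (value j (tri (suc j))) ⟩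
    + (m ℕ.* (r ℕ.* (suc j ℕ.* suc j) ℕ.+ tri (suc j))) ℤ.* + 2 ∎)) (halve _)
    where
    open ≡.≡-Reasoning
    expand : ∀ m r j → m ℤ.* ℤ.- (+ 1 ℤ.+ j) ℤ.* ((+ 2 ℤ.* (+ 1 ℤ.+ r) ℤ.- + 1) ℤ.* ℤ.- (+ 1 ℤ.+ j) ℤ.- + 1) ≡
      m ℤ.* (+ 2 ℤ.* (r ℤ.* ((+ 1 ℤ.+ j) ℤ.* (+ 1 ℤ.+ j))) ℤ.+ (+ 1 ℤ.+ j) ℤ.* (+ 1 ℤ.+ (+ 1 ℤ.+ j)))
    expand = ℤ-solve-∀
    factor : ∀ m x t → m ℤ.* (+ 2 ℤ.* x ℤ.+ + 2 ℤ.* t) ≡ m ℤ.* (x ℤ.+ t) ℤ.* + 2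
    factor = ℤ-solve-∀

module _ where
  open CommutativeRing PS-ring using (_≈_; *-congˡ; *-congʳ; +-cong; *-identityˡ; trans; sym; setoid) renaming (_*_ to _⊗_; _+_ to _⊞_)
  open import Algebra.Properties.Semiring.Exp (CommutativeRing.semiring PS-ring) using (_^_; ^-homo-*; ^-assocʳ)
  open import Algebra.Solver.Ring.NaturalCoefficients.Default (CommutativeRing.commutativeSemiring PS-ring) using (solve; _:+_; _:*_; _:=_)
  open import Relation.Binary.Reasoning.Setoid setoid
  open Coefficients
  open QSeries PS-ring using (theta; module QBinomial; module Positivity)
  open QBinomial X X-regular

  central : ℕ → ℕ → ℕ → PS
  central K L j = γ (L ℕ.+ j ℕ.* K) L (j ℕ.* K)

  -- The lower indices L-Kj and L+Kj give the same q-binomial coefficient, and j and -j have the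
  -- same sign, so their two powers of q combine into one `weight` in base X^(2^k). The truncation N
  -- = L is that of `G`.
  G≡theta : ∀ k a b r L → suc r ≡ a ℕ.* b →
    G k (+ a) (+ b) L ≈ theta (X ^ (2 ℕ.^ k)) L r (central (2 ℕ.^ k ℕ.* a) L)
  G≡theta k a b r L e n = ≡.trans (Σ<-centred L h) (Σ±≡alt L h _ n h-0 h-±)
    where
    m = 2 ℕ.^ k
    Q = X ^ m
    binomial : ℤ → PS
    binomial j = qBinom (2 ℕ.* L) (+ L ℤ.- K k (+ a) ℤ.* j)
    h : ℤ → ℤ
    h j = sign ℤ.∣ j ∣ ℤ.* shift ℤ.∣ expo k (+ a) (+ b) j ∣ (binomial j) n

    Kj : ∀ j → K k (+ a) ℤ.* + j ≡ + (j ℕ.* (m ℕ.* a))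
    Kj j = ≡.trans (≡.cong (ℤ._* + j) (≡.sym (ℤ.pos-* m a))) (≡.trans (ℤ.*-comm (+ (m ℕ.* a)) (+ j)) (≡.sym (ℤ.pos-* j (m ℕ.* a))))

    binomial-+ : ∀ j → binomial (+ j) ≈ central (m ℕ.* a) L j
    binomial-+ j rewrite Kj j = qBinom-left L (j ℕ.* (m ℕ.* a))

    binomial-- : ∀ j → binomial -[1+ j ] ≈ central (m ℕ.* a) L (suc j)
    binomial-- j rewrite ≡.sym (ℤ.neg-distribʳ-* (K k (+ a)) (+ suc j)) | Kj (suc j) | ℤ.neg-involutive (+ (suc j ℕ.* (m ℕ.* a))) =
      qBinom-right L (suc j ℕ.* (m ℕ.* a))

    power : ∀ x t f → shift (m ℕ.* (x ℕ.+ t)) f ≈ Q ^ x ⊗ Q ^ t ⊗ f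
    power x t f = trans (shift-X^ (m ℕ.* (x ℕ.+ t)) f) (*-congʳ (trans (sym (^-assocʳ X m (x ℕ.+ t))) (^-homo-* Q x t)))

    h-0 : h (+ 0) ≡ (weight Q r 0 ⊗ central (m ℕ.* a) L 0) n
    h-0 rewrite expo-0 k a b r e = ≡.trans (ℤ.*-identityˡ _) (trans (binomial-+ 0) (sym (*-identityˡ _)) n)

    pair : ∀ j → (shift ℤ.∣ expo k (+ a) (+ b) (+ suc j) ∣ (binomial (+ suc j))) ⊞ (shift ℤ.∣ expo k (+ a) (+ b) -[1+ j ] ∣ (binomial -[1+ j ])) ≈
      weight Q r (suc j) ⊗ central (m ℕ.* a) L (suc j)
    pair j rewrite expo-+ k a b r e j | expo-- k a b r e j = begin
      shift (m ℕ.* (x ℕ.+ tri j)) (binomial (+ suc j)) ⊞ shift (m ℕ.* (x ℕ.+ tri (suc j))) (binomial -[1+ j ])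
        ≈⟨ +-cong (trans (power x (tri j) _) (*-congˡ (binomial-+ (suc j)))) (trans (power x (tri (suc j)) _) (*-congˡ (binomial-- j))) ⟩
      Q ^ x ⊗ Q ^ tri j ⊗ c ⊞ Q ^ x ⊗ Q ^ tri (suc j) ⊗ c
        ≈⟨ solve 4 (λ x s t c → x :* s :* c :+ x :* t :* c := x :* (s :+ t) :* c) (λ _ → ≡.refl) (Q ^ x) (Q ^ tri j) (Q ^ tri (suc j)) c ⟩
      weight Q r (suc j) ⊗ c ∎
      where
      x = r ℕ.* (suc j ℕ.* suc j)
      c = central (m ℕ.* a) L (suc j)

    h-± : ∀ j → h (+ suc j) ℤ.+ h -[1+ j ] ≡ sign (suc j) ℤ.* (weight Q r (suc j) ⊗ central (m ℕ.* a) L (suc j)) n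
    h-± j = ≡.trans (≡.sym (ℤ.*-distribˡ-+ (sign (suc j)) _ _)) (≡.cong (sign (suc j) ℤ.*_) (pair j n))

  X-nonNegPoly : NonNegPoly X
  X-nonNegPoly = 1 , (λ { (suc (suc n)) _ → ≡.refl ; (suc zero) (ℕ.s≤s ()) }) ,
    (λ { zero → ℤ.≤-refl ; (suc zero) → ℤ.+≤+ ℕ.z≤n ; (suc (suc n)) → ℤ.≤-refl })

  G-nonNegPoly : ∀ k a b L → Coprime a b → 0 ℕ.< a → 0 ℕ.< b → b ℕ.≤ 2 ℕ.^ k ℕ.* a → NonNegPoly (G k (+ a) (+ b) L)
  G-nonNegPoly k (suc a) (suc b) L coprime _ _ b≤2ᵏa = nonNegPoly-resp
    (sym (G≡theta k (suc a) (suc b) (b ℕ.+ a ℕ.* suc b) L ≡.refl))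
    (Positivity.central-pos NonNegPoly nonNegPoly-resp nonNegPoly-0 nonNegPoly-1 nonNegPoly-+ nonNegPoly-*
      k X X-regular X-nonNegPoly (suc a) (suc b) (b ℕ.+ a ℕ.* suc b) L L coprime ≡.refl b≤2ᵏa ℕ.≤-refl)

open import Data.Integer using (∣_∣; _<_; _≤_; _*_)
open import Data.Nat as N using ()

theorem9p13 : (k : ℕ) (a b : ℤ) → Coprime ∣ a ∣ ∣ b ∣ → + 0 < b → b < + (2 N.^ k) * a →
    (L : ℕ) → Σ ℕ (λ D → ((n : ℕ) → D N.< n → G k a b L n ≡ + 0) × ((n : ℕ) → + 0 ≤ G k a b L n))
-- 0 < b < 2^k a excludes a ≤ 0, so only positive a and b reach the argument over the natural
-- numbers.
theorem9p13 k (+ zero) b coprime 0<b b<2ᵏa L =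
  ⊥-elim (ℤ.<-asym 0<b (≡.subst (b ℤ.<_) (ℤ.*-zeroʳ (+ (2 ℕ.^ k))) b<2ᵏa))
theorem9p13 k (+ suc a) (+ b) coprime (ℤ.+<+ 0<b) b<2ᵏa L =
  G-nonNegPoly k (suc a) b L coprime (ℕ.s≤s ℕ.z≤n) 0<b
    (ℕ.<⇒≤ (ℤ.drop‿+<+ (≡.subst (+ b ℤ.<_) (≡.sym (ℤ.pos-* (2 ℕ.^ k) (suc a))) b<2ᵏa)))
theorem9p13 k -[1+ a ] b coprime 0<b b<2ᵏa L =
  ⊥-elim (ℤ.<-asym 0<b (ℤ.<-≤-trans b<2ᵏa (≡.subst (+ (2 ℕ.^ k) ℤ.* -[1+ a ] ℤ.≤_) (ℤ.*-zeroʳ (+ (2 ℕ.^ k))) (ℤ.*-monoˡ-≤-nonNeg (+ (2 ℕ.^ k)) (ℤ.-≤+ {a} {0})))))
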